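{- Let $D>1$ be a squarefree integer, let $u=A+B\sqrt{D}\in\mathcal{S}_D$, let $C=C(u)$, and let $[a,2b,c]\in H$ (so $a>0$, $\gcd(a,2b,c)=1$, $b^2-ac=-27C^2D$). Let $p\equiv 1 \pmod 3$ be a prime with $p=ax^2+2bxy+cy^2$ for some integers $x,y$, and assume that $$\gcd(ap,\,3N(u)Dy)=1.$$ Then $u$ is a cubic residue modulo $p$ (i.e. $u^{(p-1)/3}\equiv 1 \pmod p$, where $\sqrt{D}$ is interpreted as a square root of $D$ modulo $p$, which exists) if and only if $$\left(\frac{9A-(B/C)\,b\,(1+2\omega)}{a}\right)_3=1.$$
   Context: For squarefree $D>1$, let $\mathcal{O}$ be the ring of integers of $\mathbb{Q}(\sqrt{D})$. The set $\mathcal{S}_D$ consists of those $u=A+B\sqrt{D}$ with $A,B\in\mathbb{Z}$ such that the norm $N(u)=A^2-B^2D$ is the cube of an integer, $u$ is not a cube in $\mathcal{O}$, and $\gcd(A,B)$ is not divisible by the cube of any prime. For $u\in\mathcal{S}_D$, $C(u)$ is the product of the distinct odd primes that divide $\gcd(A,B)$ but do not divide $D$ (so $C\mid B$). With $d=-27C^2D$, $H=H(4d)$ denotes the form class group of discriminant $4d$, consisting of the (proper equivalence) classes of primitive binary quadratic forms $[a,2b,c]=ax^2+2bxy+cy^2$ with $a>0$ and $b^2-ac=d$. Let $\omega=(-1+i\sqrt{3})/2$. For $\alpha\in\mathbb{Z}[\omega]$ and a prime $\pi$ of $\mathbb{Z}[\omega]$ not dividing $3$, $(\alpha/\pi)_3\in\{0,1,\omega,\omega^2\}$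 is the cubic residue symbol, defined by $(\alpha/\pi)_3\equiv \alpha^{(N\pi-1)/3}\pmod{\pi}$; for a nonzero element (in particular a positive rational integer) $n$ of $\mathbb{Z}[\omega]$ coprime to $3$, $(\alpha/n)_3$ is defined multiplicatively via the factorization of $n$ into primes of $\mathbb{Z}[\omega]$. -}

module Defs where

open import Data.Nat as ℕ using (ℕ; zero; suc; NonZero)
import Data.Nat.Divisibility as ℕD
open import Data.Nat.Primality using (Prime; prime?; prime⇒nonZero)
import Data.Nat.GCD as ℕG
open import Data.Integer as ℤ using (ℤ; +_; ∣_∣)
open import Data.Integer.Divisibility using (_∣_)
open import Data.List using (List; []; _∷_; filter; upTo; map)
open import Data.Nat.ListAction using (product)
import Data.Nat.Properties as ℕP
open import Data.List.Relation.Unary.All using (All; []; _∷_)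
open import Data.List.Relation.Unary.All.Properties using (all-filter)
open import Data.Product using (Σ; ∃; _×_; _,_; proj₁; proj₂)
open import Data.Sum using (_⊎_)
open import Relation.Binary.PropositionalEquality using (_≡_; _≢_)
open import Relation.Nullary using (¬_; Dec)
open import Relation.Nullary.Decidable using (_×-dec_; ¬?)

SquareFree : ℕ → Set
SquareFree n = ∀ p → Prime p → ¬ (p ℕ.* p ℕD.∣ n)

infix 4 _≡ℤ_[mod_]
_≡ℤ_[mod_] : ℤ → ℤ → ℤ → Set
x ≡ℤ y [mod m ] = m ∣ (x ℤ.- y)

normQD : ℕ → ℤ → ℤ → ℤ
normQD D A B = A ℤ.* A ℤ.- B ℤ.* B ℤ.* + D

-- The element (x + y√D)/2 of Q(√D) lies in O:
--   if D ≡ 1 (mod 4): x ≡ y (mod 2);  otherwise: x and y both even.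
InO : ℕ → ℤ → ℤ → Set
InO D x y = (D ℕ.% 4 ≡ 1 × ((+ 2) ∣ (x ℤ.- y)))
          ⊎ (D ℕ.% 4 ≢ 1 × ((+ 2) ∣ x) × ((+ 2) ∣ y))

-- A + B√D is a cube in O: there is v = (x + y√D)/2 ∈ O with v³ = A + B√D,
-- i.e. (x³ + 3xy²D) + (3x²y + y³D)√D = 8A + 8B√D.
IsCubeInO : ℕ → ℤ → ℤ → Set
IsCubeInO D A B = ∃ λ x → ∃ λ y → InO D x y
  × (x ℤ.* x ℤ.* x ℤ.+ + 3 ℤ.* x ℤ.* y ℤ.* y ℤ.* + D ≡ + 8 ℤ.* A)
  × (+ 3 ℤ.* x ℤ.* x ℤ.* y ℤ.+ y ℤ.* y ℤ.* y ℤ.* + D ≡ + 8 ℤ.* B)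

InS : ℕ → ℤ → ℤ → Set
InS D A B = (∃ λ n → normQD D A B ≡ n ℤ.* n ℤ.* n)
          × ¬ IsCubeInO D A B
          × (∀ p → Prime p → ¬ (p ℕ.^ 3 ℕD.∣ ℕG.gcd ∣ A ∣ ∣ B ∣))

CPrimeFactor : ℕ → ℕ → ℕ → Set
CPrimeFactor D g p = Prime p × ¬ (2 ℕD.∣ p) × p ℕD.∣ g × ¬ (p ℕD.∣ D)

gcdAB : ℤ → ℤ → ℕ
gcdAB A B = ℕG.gcd ∣ A ∣ ∣ B ∣

cPrimeFactor? : (D g p : ℕ) → Dec (CPrimeFactor D g p)
cPrimeFactor? D g p =
  prime? p ×-dec (¬? (2 ℕD.∣? p) ×-dec (p ℕD.∣? g ×-dec ¬? (p ℕD.∣? D)))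

cPrimes : ℕ → ℤ → ℤ → List ℕ
cPrimes D A B = filter (cPrimeFactor? D (gcdAB A B)) (upTo (suc (gcdAB A B)))

Cof : ℕ → ℤ → ℤ → ℕ
Cof D A B = product (cPrimes D A B)

private
  prod-nonZero : ∀ {xs : List ℕ} → All NonZero xs → NonZero (product xs)
  prod-nonZero [] = _
  prod-nonZero {x ∷ xs} (nz ∷ nzs) =
    ℕP.m*n≢0 x (product xs) {{nz}} {{prod-nonZero nzs}}

  all-map : ∀ {P Q : ℕ → Set} → (∀ {x} → P x → Q x) → ∀ {xs} → All P xs → All Q xs
  all-map f [] = []
  all-map f (p ∷ ps) = f p ∷ all-map f ps

instance
  Cof-nonZero : ∀ {D A B} → NonZero (Cof D A B)
  Cof-nonZero {D} {A} {B} = prod-nonZero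
    (all-map (λ pr → prime⇒nonZero (proj₁ pr)) (all-filter (cPrimeFactor? D (gcdAB A B)) (upTo (suc (gcdAB A B)))))

-- The ring Z[ω], ω = (-1 + i√3)/2, ω² = -1 - ω.  x +ω y ω stands for x + yω.

record Zω : Set where
  constructor _+ω_ω
  field
    re : ℤ
    im : ℤ
open Zω public

infixl 7 _*ω_
infixl 6 _-ω_

_-ω_ : Zω → Zω → Zω
(a +ω b ω) -ω (c +ω d ω) = (a ℤ.- c) +ω (b ℤ.- d) ω

-- (a + bω)(c + dω) = ac + (ad + bc)ω + bd ω² = (ac - bd) + (ad + bc - bd)ω
_*ω_ : Zω → Zω → Zω
(a +ω b ω) *ω (c +ω d ω) =
  (a ℤ.* c ℤ.- b ℤ.* d) +ω (a ℤ.* d ℤ.+ b ℤ.* c ℤ.- b ℤ.* d) ω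

fromℤ : ℤ → Zω
fromℤ n = n +ω (+ 0) ω

0ω 1ω ω ω² : Zω
0ω = fromℤ (+ 0)
1ω = fromℤ (+ 1)
ω  = (+ 0) +ω (+ 1) ω
ω² = ω *ω ω

_^ω_ : Zω → ℕ → Zω
α ^ω zero = 1ω
α ^ω suc k = α *ω (α ^ω k)

productω : List Zω → Zω
productω [] = 1ω
productω (x ∷ xs) = x *ω productω xs

normω : Zω → ℤ
normω (a +ω b ω) = a ℤ.* a ℤ.- a ℤ.* b ℤ.+ b ℤ.* b

_∣ω_ : Zω → Zω → Set
π ∣ω α = ∃ λ κ → α ≡ κ *ω π

IsUnitω : Zω → Set
IsUnitω ε = ∃ λ v → ε *ω v ≡ 1ω

IsPrimeω : Zω → Set
IsPrimeω π = π ≢ 0ω × ¬ IsUnitω π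
  × (∀ α β → π ∣ω (α *ω β) → π ∣ω α ⊎ π ∣ω β)

CubicSymPrime : Zω → Zω → Zω → Set
CubicSymPrime α π χ = (χ ≡ 0ω ⊎ χ ≡ 1ω ⊎ χ ≡ ω ⊎ χ ≡ ω²)
  × π ∣ω ((α ^ω ((∣ normω π ∣ ℕ.∸ 1) ℕ./ 3)) -ω χ)

-- (α/n)₃ = χ for a nonzero n ∈ Z[ω] coprime to 3, defined multiplicatively:
-- n = ε π₁ ⋯ πₖ (ε a unit, πᵢ primes not dividing 3) and χ = ∏ (α/πᵢ)₃.
-- (By unique factorisation this does not depend on the factorisation.)
CubicSym : Zω → Zω → Zω → Set
CubicSym α n χ = ∃ λ (ε : Zω) → ∃ λ (fs : List (Zω × Zω)) →
    IsUnitω ε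
  × All (λ f → IsPrimeω (proj₁ f) × ¬ (proj₁ f ∣ω fromℤ (+ 3)) × CubicSymPrime α (proj₁ f) (proj₂ f)) fs
  × n ≡ ε *ω productω (map proj₁ fs)
  × χ ≡ productω (map proj₂ fs)

-- B/C(u) (exact integer division; C(u) ≥ 1 and C(u) ∣ B)

BoverC : ℕ → ℤ → ℤ → ℤ
BoverC D A B = ℤ._/ℕ_ B (Cof D A B) {{Cof-nonZero {D} {A} {B}}}

{-# OPTIONS --safe #-}
-- Put z = ax + by and w = Cy, so that n = ap = z² + 27Dw². Modulo p the square root of D is z/(3w√-3) up to
-- sign, and modulo a the element E = Bz + 3Aw√-3 is the numerator of the symbol in the theorem up to √-3 and
-- a rational factor. For rational q, the symbol (E/q)₃ does not see rational factors of E nor √-3, whose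
-- square is rational. Since N(u) is a cube, (E/p)₃ = 1 exactly when u is a cubic residue modulo p, so
-- everything follows from (E/n)₃ = 1.
--
-- After removing rational factors, and multiplying u by √D if 3 obstructs, E becomes r = X + 3Y√-3 with X, Y
-- coprime and 3 ∤ X, and by reciprocity (r/n)₃ = M(n) for a multiplicative function M that is periodic modulo
-- N(r) = X² + 27Y². The identity N(E) = B²n + 27w²N(u) turns n into a cube modulo N(r), up to factors that
-- divide 2XY; on those M is trivial, because there r is rational, or rational times √-3. If 3 divides Y, then
-- M(3) = 1 follows from X² ≡ -27Y².
--
-- Reciprocity between a primary r and the rational primes q is proved by dividing r by Jacobi sums. For p ≡ 1
-- (mod 3) the Jacobi sum J of a cubic character χ modulo p satisfies J conj(J) = p and J ≡ -1 (mod 3) and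
-- vanishes at one of the two places above p; comparing the Gauss sum g with g^q modulo q gives (J/q)₃ = χ(q).
-- If p divides N(r) but not r, then J (for a suitable choice of place) divides r, and r is a product of such
-- J and of rational primes. No Euclidean division in Z[ω] is needed, and the same J split p into prime
-- elements, as the definition of the symbol in the theorem requires.
module Submission where

open import Algebra.Bundles using (CommutativeRing; Semiring)
import Algebra.Properties.CommutativeSemigroup
import Algebra.Properties.CommutativeSemiring.Exp
import Algebra.Properties.Ring
import Algebra.Properties.Semiring.Binomial
import Algebra.Properties.Semiring.Exp
import Algebra.Properties.Semiring.Mult
import Algebra.Properties.Semiring.Sum
open import Data.Empty using (⊥; ⊥-elim)
open import Data.Fin using (Fin; zero; suc; toℕ; fromℕ; fromℕ<; inject₁)
import Data.Fin.Permutation as Perm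
import Data.Fin.Properties as Finₚ
open import Data.Integer as ℤ using (ℤ; +_)
import Data.Integer.DivMod as ℤ/
open import Data.Integer.Divisibility.Signed
  using (_∣_; divides; ∣ᵤ⇒∣; ∣⇒∣ᵤ; _∣?_; ∣m∣n⇒∣m+n; ∣m∣n⇒∣m-n; ∣m⇒∣-m; ∣n⇒∣m*n; ∣m⇒∣m*n; ∣-trans; ∣-refl)
open import Data.Integer.GCD using (gcd)
import Data.Integer.Properties as ℤₚ
import Data.Integer.Tactic.RingSolver as ℤSolver
open import Data.List using (List; []; _∷_; map; upTo)
open import Data.List.Membership.Propositional.Properties using (∈-filter⁺; ∈-upTo⁺)
open import Data.List.Relation.Unary.All using (All; []; _∷_)
import Data.List.Relation.Unary.All as All
import Data.List.Relation.Unary.All.Properties as Allₚ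
open import Data.List.Relation.Unary.AllPairs using ([]; _∷_)
open import Data.List.Relation.Unary.Unique.Propositional using (Unique)
import Data.List.Relation.Unary.Unique.Propositional.Properties as Uniqueₚ
open import Data.Maybe using (just; nothing)
open import Data.Nat as ℕ using (ℕ; zero; suc)
open import Data.Nat.Combinatorics using (nCn≡1; k![n∸k]!∣n!; nCk≡n!/k![n-k]!) renaming (_C_ to _choose_)
import Data.Nat.Divisibility as ℕ∣
import Data.Nat.DivMod as ℕ/
import Data.Nat.GCD as ℕG
open import Data.Nat.Induction using (<-wellFounded)
open import Data.Nat.ListAction using (product)
open import Data.Nat.ListAction.Properties using (∈⇒∣product)
open import Data.Nat.Primality using (Prime; euclidsLemma; prime⇒nonZero; prime⇒nonTrivial; prime⇒irreducible; prime?)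
open import Data.Nat.Primality.Factorisation using (PrimeFactorisation; factorise)
import Data.Nat.Properties as ℕₚ
import Data.Nat.Tactic.RingSolver as ℕSolver
open import Data.Product using (∃; _×_; _,_; proj₁; proj₂)
open import Data.Sum using (_⊎_; inj₁; inj₂; [_,_]′)
open import Data.Vec.Functional using (Vector)
open import Function.Bundles using (_⇔_; mk⇔; Equivalence)
open import Induction.WellFounded using (Acc; acc)
open import Level using (0ℓ)
open import Relation.Binary.PropositionalEquality
  using (_≡_; _≢_; refl; sym; trans; cong; cong₂; subst; subst₂; module ≡-Reasoning)
import Relation.Binary.Reasoning.Setoid
import Relation.Nullary.Decidable
open import Relation.Nullary using (¬_; yes; no; Dec)
import Tactic.RingSolver
open import Tactic.RingSolver.Core.AlmostCommutativeRing using (AlmostCommutativeRing; fromCommutativeRing)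

open import Defs

-- The hypotheses on gcd(A, B) act at a single point. Dividing u by g = gcd(A, B) leaves N₀ g² = m³
-- in place of a cube, so the primes of g reappear in the cofactor of n. As g is cube-free, each of
-- them divides N₀, which keeps it prime to N(r); and it divides 2XY because it is 2, or divides D
-- and then Y, or divides C and hence w and Y. This is what the factor C² in the discriminant is
-- for. The factor 27 makes the coefficient of √-3 divisible by 3, so that r is primary without
-- adjusting a unit; being 3³ it disappears from the congruence that exhibits n as a cube.
--
-- Reciprocity speaks only of primes other than 3, while 3 may divide the cofactors of n; hence the
-- separate computation of M(3).
--
-- A Gauss sum would live in an extension of Z[ω] by a p-th root of unity. Here it is an element of
-- the group ring of translations, acting on functions from ℤ to Z[ω]. All that is used of this ring
-- is that translations commute and that the q-th power is additive modulo q.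

infixl 6 _⊞_
infixl 7 _⊠_
infixr 8 _↑_
infix 8 ⊟_

-- Opaque, since conversion checking would otherwise compare elements of Zω coordinate by coordinate.
opaque
  _⊞_ _⊠_ : Zω → Zω → Zω
  (a +ω b ω) ⊞ (c +ω d ω) = (a ℤ.+ c) +ω (b ℤ.+ d) ω
  α ⊠ β = α *ω β

  ⊟_ conj : Zω → Zω
  ⊟ (a +ω b ω) = (ℤ.- a) +ω (ℤ.- b) ω
  conj (a +ω b ω) = (a ℤ.- b) +ω (ℤ.- b) ω

  _↑_ : Zω → ℕ → Zω
  α ↑ n = α ^ω n

opaque
  unfolding _⊞_ ⊟_

  ⊞-assoc : ∀ α β γ → (α ⊞ β) ⊞ γ ≡ α ⊞ (β ⊞ γ)
  ⊞-assoc α β γ = cong₂ _+ω_ω (ℤₚ.+-assoc (re α) (re β) (re γ)) (ℤₚ.+-assoc (im α) (im β) (im γ))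

  ⊞-comm : ∀ α β → α ⊞ β ≡ β ⊞ α
  ⊞-comm α β = cong₂ _+ω_ω (ℤₚ.+-comm (re α) (re β)) (ℤₚ.+-comm (im α) (im β))

  ⊞-identityˡ : ∀ α → 0ω ⊞ α ≡ α
  ⊞-identityˡ α = cong₂ _+ω_ω (ℤₚ.+-identityˡ (re α)) (ℤₚ.+-identityˡ (im α))

  ⊞-inverseˡ : ∀ α → ⊟ α ⊞ α ≡ 0ω
  ⊞-inverseˡ α = cong₂ _+ω_ω (ℤₚ.+-inverseˡ (re α)) (ℤₚ.+-inverseˡ (im α))

opaque
  unfolding _⊞_ _⊠_

  ⊠-assoc : ∀ α β γ → (α ⊠ β) ⊠ γ ≡ α ⊠ (β ⊠ γ)
  ⊠-assoc (a +ω b ω) (c +ω d ω) (e +ω f ω) = cong₂ _+ω_ω (l₁ a b c d e f) (l₂ a b c d e f)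
    where
    l₁ : ∀ a b c d e f → (a ℤ.* c ℤ.- b ℤ.* d) ℤ.* e ℤ.- (a ℤ.* d ℤ.+ b ℤ.* c ℤ.- b ℤ.* d) ℤ.* f
      ≡ a ℤ.* (c ℤ.* e ℤ.- d ℤ.* f) ℤ.- b ℤ.* (c ℤ.* f ℤ.+ d ℤ.* e ℤ.- d ℤ.* f)
    l₁ = ℤSolver.solve-∀
    l₂ : ∀ a b c d e f → (a ℤ.* c ℤ.- b ℤ.* d) ℤ.* f ℤ.+ (a ℤ.* d ℤ.+ b ℤ.* c ℤ.- b ℤ.* d) ℤ.* e ℤ.- (a ℤ.* d ℤ.+ b ℤ.* c ℤ.- b ℤ.* d) ℤ.* f
      ≡ a ℤ.* (c ℤ.* f ℤ.+ d ℤ.* e ℤ.- d ℤ.* f) ℤ.+ b ℤ.* (c ℤ.* e ℤ.- d ℤ.* f) ℤ.- b ℤ.* (c ℤ.* f ℤ.+ d ℤ.* e ℤ.- d ℤ.* f)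
    l₂ = ℤSolver.solve-∀

  ⊠-comm : ∀ α β → α ⊠ β ≡ β ⊠ α
  ⊠-comm (a +ω b ω) (c +ω d ω) = cong₂ _+ω_ω (l₁ a b c d) (l₂ a b c d)
    where
    l₁ : ∀ a b c d → a ℤ.* c ℤ.- b ℤ.* d ≡ c ℤ.* a ℤ.- d ℤ.* b
    l₁ = ℤSolver.solve-∀
    l₂ : ∀ a b c d → a ℤ.* d ℤ.+ b ℤ.* c ℤ.- b ℤ.* d ≡ c ℤ.* b ℤ.+ d ℤ.* a ℤ.- d ℤ.* b
    l₂ = ℤSolver.solve-∀

  ⊠-identityˡ : ∀ α → 1ω ⊠ α ≡ α
  ⊠-identityˡ (a +ω b ω) = cong₂ _+ω_ω (l₁ a b) (l₂ a b)
    where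
    l₁ : ∀ a b → + 1 ℤ.* a ℤ.- + 0 ℤ.* b ≡ a
    l₁ = ℤSolver.solve-∀
    l₂ : ∀ a b → + 1 ℤ.* b ℤ.+ + 0 ℤ.* a ℤ.- + 0 ℤ.* b ≡ b
    l₂ = ℤSolver.solve-∀

  ⊠-distribˡ-⊞ : ∀ α β γ → α ⊠ (β ⊞ γ) ≡ (α ⊠ β) ⊞ (α ⊠ γ)
  ⊠-distribˡ-⊞ (a +ω b ω) (c +ω d ω) (e +ω f ω) = cong₂ _+ω_ω (l₁ a b c d e f) (l₂ a b c d e f)
    where
    l₁ : ∀ a b c d e f → a ℤ.* (c ℤ.+ e) ℤ.- b ℤ.* (d ℤ.+ f) ≡ (a ℤ.* c ℤ.- b ℤ.* d) ℤ.+ (a ℤ.* e ℤ.- b ℤ.* f)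
    l₁ = ℤSolver.solve-∀
    l₂ : ∀ a b c d e f → a ℤ.* (d ℤ.+ f) ℤ.+ b ℤ.* (c ℤ.+ e) ℤ.- b ℤ.* (d ℤ.+ f)
      ≡ (a ℤ.* d ℤ.+ b ℤ.* c ℤ.- b ℤ.* d) ℤ.+ (a ℤ.* f ℤ.+ b ℤ.* e ℤ.- b ℤ.* f)
    l₂ = ℤSolver.solve-∀

⊠-identityʳ : ∀ α → α ⊠ 1ω ≡ α
⊠-identityʳ α = trans (⊠-comm α 1ω) (⊠-identityˡ α)

⊠-distribʳ-⊞ : ∀ α β γ → (β ⊞ γ) ⊠ α ≡ (β ⊠ α) ⊞ (γ ⊠ α)
⊠-distribʳ-⊞ α β γ = trans (⊠-comm (β ⊞ γ) α) (trans (⊠-distribˡ-⊞ α β γ) (cong₂ _⊞_ (⊠-comm α β) (⊠-comm α γ)))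

Zω-commutativeRing : CommutativeRing 0ℓ 0ℓ
Zω-commutativeRing = record
  { Carrier = Zω
  ; _≈_ = _≡_
  ; _+_ = _⊞_
  ; _*_ = _⊠_
  ; -_ = ⊟_
  ; 0# = 0ω
  ; 1# = 1ω
  ; isCommutativeRing = record
    { isRing = record
      { +-isAbelianGroup = record
        { isGroup = record
          { isMonoid = record
            { isSemigroup = record
              { isMagma = record { isEquivalence = Relation.Binary.PropositionalEquality.isEquivalence ; ∙-cong = cong₂ _⊞_ }
              ; assoc = ⊞-assoc }
            ; identity = ⊞-identityˡ , λ α → trans (⊞-comm α 0ω) (⊞-identityˡ α) }
          ; inverse = ⊞-inverseˡ , λ α → trans (⊞-comm α (⊟ α)) (⊞-inverseˡ α)
          ; ⁻¹-cong = cong ⊟_ }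
        ; comm = ⊞-comm }
      ; *-cong = cong₂ _⊠_
      ; *-assoc = ⊠-assoc
      ; *-identity = ⊠-identityˡ , ⊠-identityʳ
      ; distrib = ⊠-distribˡ-⊞ , ⊠-distribʳ-⊞ }
    ; *-comm = ⊠-comm } }

Zω-ring : AlmostCommutativeRing 0ℓ 0ℓ
Zω-ring = fromCommutativeRing Zω-commutativeRing λ { ((+ 0) +ω (+ 0) ω) → just refl; _ → nothing }

open CommutativeRing Zω-commutativeRing public using () renaming (zeroˡ to ⊠-zeroˡ; zeroʳ to ⊠-zeroʳ)

-- The quotient by a principal ideal keeps the carrier and coarsens the equality, so that general
-- results on rings and semirings apply to congruences as they stand.
module Modulo {c ℓ} (R : CommutativeRing c ℓ) (m : CommutativeRing.Carrier R) where
  open CommutativeRing R renaming (refl to ≈-refl; sym to ≈-sym; trans to ≈-trans)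
  open Algebra.Properties.Ring ring
  open Relation.Binary.Reasoning.Setoid setoid

  infix 4 _≋_
  record _≋_ (x y : Carrier) : Set (c Level.⊔ ℓ) where
    constructor mod
    field
      quot : Carrier
      diff : x - y ≈ quot * m

  private
    telescope : ∀ x y z → x - z ≈ (x - y) + (y - z)
    telescope x y z = begin
      x - z               ≈⟨ +-congʳ (+-identityʳ x) ⟨
      x + 0# - z          ≈⟨ +-congʳ (+-congˡ (-‿inverseˡ y)) ⟨
      x + (- y + y) - z   ≈⟨ +-congʳ (+-assoc _ _ _) ⟨
      x - y + y - z       ≈⟨ +-assoc _ _ _ ⟩
      (x - y) + (y - z)   ∎

  ≈⇒≋ : ∀ {x y} → x ≈ y → x ≋ y
  ≈⇒≋ {x} {y} e = mod 0# (≈-trans (≈-trans (+-congʳ e) (-‿inverseʳ y)) (≈-sym (zeroˡ m)))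

  ≋-sym : ∀ {x y} → x ≋ y → y ≋ x
  ≋-sym {x} {y} (mod k e) = mod (- k) (begin
    y - x          ≈⟨ +-congʳ (-‿involutive y) ⟨
    - - y - x      ≈⟨ -‿+-comm _ _ ⟩
    - (- y + x)    ≈⟨ -‿cong (+-comm _ _) ⟩
    - (x - y)      ≈⟨ -‿cong e ⟩
    - (k * m)      ≈⟨ -‿distribˡ-* k m ⟩
    - k * m        ∎)

  ≋-trans : ∀ {x y z} → x ≋ y → y ≋ z → x ≋ z
  ≋-trans {x} {y} {z} (mod k e) (mod l f) =
    mod (k + l) (≈-trans (telescope x y z) (≈-trans (+-cong e f) (≈-sym (distribʳ m k l))))

  +-cong-≋ : ∀ {x y u v} → x ≋ y → u ≋ v → x + u ≋ y + v
  +-cong-≋ {x} {y} {u} {v} (mod k e) (mod l f) = mod (k + l) (begin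
    (x + u) - (y + v)          ≈⟨ +-congˡ (-‿+-comm y v) ⟨
    (x + u) + (- y - v)        ≈⟨ +-assoc _ _ _ ⟩
    x + (u + (- y - v))        ≈⟨ +-congˡ (+-assoc _ _ _) ⟨
    x + (u + - y - v)          ≈⟨ +-congˡ (+-congʳ (+-comm _ _)) ⟩
    x + (- y + u - v)          ≈⟨ +-congˡ (+-assoc _ _ _) ⟩
    x + (- y + (u - v))        ≈⟨ +-assoc _ _ _ ⟨
    (x - y) + (u - v)          ≈⟨ +-cong e f ⟩
    k * m + l * m              ≈⟨ distribʳ m k l ⟨
    (k + l) * m                ∎)

  *-congʳ-≋ : ∀ {x y} z → x ≋ y → x * z ≋ y * z
  *-congʳ-≋ {x} {y} z (mod k e) = mod (k * z) (begin
    x * z - y * z     ≈⟨ +-congˡ (-‿distribˡ-* y z) ⟩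
    x * z + - y * z   ≈⟨ distribʳ z x (- y) ⟨
    (x - y) * z       ≈⟨ *-congʳ e ⟩
    k * m * z         ≈⟨ *-assoc _ _ _ ⟩
    k * (m * z)       ≈⟨ *-congˡ (*-comm m z) ⟩
    k * (z * m)       ≈⟨ *-assoc _ _ _ ⟨
    k * z * m         ∎)

  *-cong-≋ : ∀ {x y u v} → x ≋ y → u ≋ v → x * u ≋ y * v
  *-cong-≋ {x} {y} {u} {v} e f =
    ≋-trans (*-congʳ-≋ u e) (≋-trans (≈⇒≋ (*-comm y u)) (≋-trans (*-congʳ-≋ y f) (≈⇒≋ (*-comm v y))))

  -‿cong-≋ : ∀ {x y} → x ≋ y → - x ≋ - y
  -‿cong-≋ {x} {y} (mod k e) = mod (- k) (begin
    - x - - y    ≈⟨ -‿+-comm x (- y) ⟩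
    - (x - y)    ≈⟨ -‿cong e ⟩
    - (k * m)    ≈⟨ -‿distribˡ-* k m ⟩
    - k * m      ∎)

  quotientRing : CommutativeRing c (c Level.⊔ ℓ)
  quotientRing = record
    { Carrier = Carrier
    ; _≈_ = _≋_
    ; _+_ = _+_
    ; _*_ = _*_
    ; -_ = -_
    ; 0# = 0#
    ; 1# = 1#
    ; isCommutativeRing = record
      { isRing = record
        { +-isAbelianGroup = record
          { isGroup = record
            { isMonoid = record
              { isSemigroup = record
                { isMagma = record
                  { isEquivalence = record { refl = ≈⇒≋ ≈-refl ; sym = ≋-sym ; trans = ≋-trans }
                  ; ∙-cong = +-cong-≋ }
                ; assoc = λ x y z → ≈⇒≋ (+-assoc x y z) }
              ; identity = (λ x → ≈⇒≋ (+-identityˡ x)) , (λ x → ≈⇒≋ (+-identityʳ x)) }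
            ; inverse = (λ x → ≈⇒≋ (-‿inverseˡ x)) , (λ x → ≈⇒≋ (-‿inverseʳ x))
            ; ⁻¹-cong = -‿cong-≋ }
          ; comm = λ x y → ≈⇒≋ (+-comm x y) }
        ; *-cong = *-cong-≋
        ; *-assoc = λ x y z → ≈⇒≋ (*-assoc x y z)
        ; *-identity = (λ x → ≈⇒≋ (*-identityˡ x)) , (λ x → ≈⇒≋ (*-identityʳ x))
        ; distrib = (λ x y z → ≈⇒≋ (distribˡ x y z)) , (λ x y z → ≈⇒≋ (distribʳ x y z)) }
      ; *-comm = λ x y → ≈⇒≋ (*-comm x y) } }

-- The freshman's dream

prime∤! : ∀ {p} → Prime p → ∀ k → k ℕ.< p → ¬ (p ℕ∣.∣ k ℕ.!)
prime∤! pr zero k<p d = ℕₚ.<⇒≱ (ℕ.nonTrivial⇒n>1 _ {{prime⇒nonTrivial pr}}) (ℕ∣.∣⇒≤ d)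
prime∤! pr (suc k) k<p d with euclidsLemma (suc k) (k ℕ.!) pr d
... | inj₁ e = ℕₚ.<⇒≱ k<p (ℕ∣.∣⇒≤ e)
... | inj₂ e = prime∤! pr k (ℕₚ.<-trans (ℕₚ.n<1+n k) k<p) e

-- In (p choose k) k! (p - k)! = p! the two factorials are products of numbers below p, so the
-- factor p must lie in the binomial coefficient.
prime∣C : ∀ {p} → Prime p → ∀ k → 0 ℕ.< k → k ℕ.< p → p ℕ∣.∣ p choose k
prime∣C {p} pr k 0<k k<p with euclidsLemma (p choose k) (k ℕ.! ℕ.* (p ℕ.∸ k) ℕ.!) pr
                                (subst (p ℕ∣.∣_) (sym C*k!≡p!) (p∣p! (prime⇒nonZero pr)))
  where
  nz = (k ℕₚ.!* (p ℕ.∸ k) !≢0)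
  C*k!≡p! : (p choose k) ℕ.* (k ℕ.! ℕ.* (p ℕ.∸ k) ℕ.!) ≡ p ℕ.!
  C*k!≡p! = trans (cong (ℕ._* (k ℕ.! ℕ.* (p ℕ.∸ k) ℕ.!)) (nCk≡n!/k![n-k]! (ℕₚ.<⇒≤ k<p))) (ℕ/.m/n*n≡m {{nz}} (k![n∸k]!∣n! (ℕₚ.<⇒≤ k<p)))
  p∣p! : ∀ {n} → ℕ.NonZero n → n ℕ∣.∣ n ℕ.!
  p∣p! {suc n} _ = ℕ∣.m∣m*n (n ℕ.!)
... | inj₁ d = d
... | inj₂ d with euclidsLemma (k ℕ.!) ((p ℕ.∸ k) ℕ.!) pr d
...   | inj₁ e = ⊥-elim (prime∤! pr k k<p e)
...   | inj₂ e = ⊥-elim (prime∤! pr (p ℕ.∸ k) (ℕₚ.∸-monoʳ-< 0<k (ℕₚ.<⇒≤ k<p)) e)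

module Freshman {c ℓ} (S : Semiring c ℓ) where
  open Semiring S hiding (zero) renaming (refl to ≈-refl; sym to ≈-sym; trans to ≈-trans)
  open Algebra.Properties.Semiring.Mult S renaming (_×_ to _·_)
  open Algebra.Properties.Semiring.Exp S
  open Algebra.Properties.Semiring.Sum S
  open Relation.Binary.Reasoning.Setoid setoid

  module _ {p : ℕ} (pr : Prime p) (char : ∀ x → p · x ≈ 0#) where

    multiple≈0 : ∀ n → p ℕ∣.∣ n → ∀ x → n · x ≈ 0#
    multiple≈0 n (ℕ∣.divides k refl) x = begin
      (k ℕ.* p) · x   ≈⟨ ×-assocˡ x k p ⟨
      k · (p · x)     ≈⟨ ×-congʳ k (char x) ⟩
      k · 0#          ≈⟨ ×-zeroʳ k ⟩
      0#              ∎
      where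
      ×-zeroʳ : ∀ k → k · 0# ≈ 0#
      ×-zeroʳ zero = ≈-refl
      ×-zeroʳ (suc k) = ≈-trans (+-identityˡ _) (×-zeroʳ k)

    sum≈0 : ∀ {n} (v : Vector Carrier n) → (∀ i → v i ≈ 0#) → sum v ≈ 0#
    sum≈0 {n} v v≈0 = begin
      sum v                 ≈⟨ sum-cong-≋ v≈0 ⟩
      sum {n} (λ _ → 0#)    ≈⟨ sum-replicate-zero n ⟩
      0#                    ∎

    -- Commutation is assumed of x and y only, since the lemma is applied to operators, which do not
    -- commute in general, as well as to quotient rings.
    freshman : ∀ x y → x * y ≈ y * x → (x + y) ^ p ≈ x ^ p + y ^ p
    freshman x y xy≈yx = go p refl
      where
      open Algebra.Properties.Semiring.Binomial S x y
      go : ∀ n → n ≡ p → (x + y) ^ n ≈ x ^ n + y ^ n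
      go zero 0≡p = ⊥-elim (ℕ.≢-nonZero⁻¹ p {{prime⇒nonZero pr}} (sym 0≡p))
      go (suc n) e = begin
        (x + y) ^ suc n                       ≈⟨ theorem xy≈yx (suc n) ⟩
        t zero + sum (λ i → t (suc i))        ≈⟨ +-congˡ (sum-init-last (λ i → t (suc i))) ⟩
        t zero + (sum (λ i → t (suc (inject₁ i))) + t (suc (fromℕ n)))
          ≈⟨ +-congˡ (+-congʳ (sum≈0 _ middle)) ⟩
        t zero + (0# + t (suc (fromℕ n)))     ≈⟨ +-congˡ (+-identityˡ _) ⟩
        t zero + t (suc (fromℕ n))            ≈⟨ +-cong first last ⟩
        y ^ suc n + x ^ suc n                 ≈⟨ +-comm _ _ ⟩
        x ^ suc n + y ^ suc n                 ∎
        where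
        t = binomialTerm (suc n)
        middle : ∀ i → t (suc (inject₁ i)) ≈ 0#
        middle i = multiple≈0 _ (subst (λ m → p ℕ∣.∣ m choose suc (toℕ (inject₁ i))) (sym e)
          (prime∣C pr _ (ℕ.s≤s ℕ.z≤n) (subst (suc (toℕ (inject₁ i)) ℕ.<_) e
            (ℕ.s≤s (subst (ℕ._< n) (sym (Finₚ.toℕ-inject₁ i)) (Finₚ.toℕ<n i)))))) _
        first : t zero ≈ y ^ suc n
        first = ≈-trans (×-homo-1 _) (*-identityˡ _)
        last : t (suc (fromℕ n)) ≈ x ^ suc n
        last rewrite Finₚ.toℕ-fromℕ n | nCn≡1 (suc n) | ℕₚ.n∸n≡0 n = ≈-trans (×-homo-1 _) (*-identityʳ _)

-- Translation operators

module Operators {c ℓ} (R : CommutativeRing c ℓ) where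
  open CommutativeRing R hiding (zero) renaming (refl to ≈-refl; sym to ≈-sym; trans to ≈-trans)
  open Algebra.Properties.Semiring.Exp semiring using (_^_)

  -- Additivity is part of the data because it is the left distributive law for composition, and
  -- `app-0` the right annihilation law.
  record Operator : Set (c Level.⊔ ℓ) where
    field
      app : (ℤ → Carrier) → ℤ → Carrier
      app-cong : ∀ {f g} → (∀ x → f x ≈ g x) → ∀ x → app f x ≈ app g x
      app-+ : ∀ f g x → app (λ x → f x + g x) x ≈ app f x + app g x
      app-0 : ∀ x → app (λ _ → 0#) x ≈ 0#
  open Operator public

  infix 4 _≈ₒ_
  record _≈ₒ_ (F G : Operator) : Set (c Level.⊔ ℓ) where
    constructor pointwise
    field at : ∀ f x → app F f x ≈ app G f x
  open _≈ₒ_ public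

  private
    interchange : ∀ a b c d → (a + b) + (c + d) ≈ (a + c) + (b + d)
    interchange a b c d = begin
      (a + b) + (c + d)   ≈⟨ +-assoc a b (c + d) ⟩
      a + (b + (c + d))   ≈⟨ +-congˡ (+-assoc b c d) ⟨
      a + (b + c + d)     ≈⟨ +-congˡ (+-congʳ (+-comm b c)) ⟩
      a + (c + b + d)     ≈⟨ +-congˡ (+-assoc c b d) ⟩
      a + (c + (b + d))   ≈⟨ +-assoc a c (b + d) ⟨
      (a + c) + (b + d)   ∎
      where open Relation.Binary.Reasoning.Setoid setoid

  _+ₒ_ _∘ₒ_ : Operator → Operator → Operator
  F +ₒ G = record
    { app = λ f x → app F f x + app G f x
    ; app-cong = λ e x → +-cong (app-cong F e x) (app-cong G e x)
    ; app-+ = λ f g x → ≈-trans (+-cong (app-+ F f g x) (app-+ G f g x)) (interchange _ _ _ _)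
    ; app-0 = λ x → ≈-trans (+-cong (app-0 F x) (app-0 G x)) (+-identityˡ 0#) }
  F ∘ₒ G = record
    { app = λ f → app F (app G f)
    ; app-cong = λ e → app-cong F (app-cong G e)
    ; app-+ = λ f g x → ≈-trans (app-cong F (app-+ G f g) x) (app-+ F (app G f) (app G g) x)
    ; app-0 = λ x → ≈-trans (app-cong F (app-0 G) x) (app-0 F x) }

  0ₒ 1ₒ : Operator
  0ₒ = record { app = λ _ _ → 0# ; app-cong = λ _ _ → ≈-refl ; app-+ = λ _ _ _ → ≈-sym (+-identityˡ 0#) ; app-0 = λ _ → ≈-refl }
  1ₒ = record { app = λ f → f ; app-cong = λ e → e ; app-+ = λ _ _ _ → ≈-refl ; app-0 = λ _ → ≈-refl }

  operatorSemiring : Semiring (c Level.⊔ ℓ) (c Level.⊔ ℓ)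
  operatorSemiring = record
    { Carrier = Operator
    ; _≈_ = _≈ₒ_
    ; _+_ = _+ₒ_
    ; _*_ = _∘ₒ_
    ; 0# = 0ₒ
    ; 1# = 1ₒ
    ; isSemiring = record
      { isSemiringWithoutAnnihilatingZero = record
        { +-isCommutativeMonoid = record
          { isMonoid = record
            { isSemigroup = record
              { isMagma = record
                { isEquivalence = record
                  { refl = pointwise λ _ _ → ≈-refl
                  ; sym = λ e → pointwise λ f x → ≈-sym (at e f x)
                  ; trans = λ e e′ → pointwise λ f x → ≈-trans (at e f x) (at e′ f x) }
                ; ∙-cong = λ e e′ → pointwise λ f x → +-cong (at e f x) (at e′ f x) }
              ; assoc = λ _ _ _ → pointwise λ _ _ → +-assoc _ _ _ }
            ; identity = (λ _ → pointwise λ _ _ → +-identityˡ _) , (λ _ → pointwise λ _ _ → +-identityʳ _) }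
          ; comm = λ _ _ → pointwise λ _ _ → +-comm _ _ }
        ; *-cong = λ {F} {F′} e e′ → pointwise λ f x → ≈-trans (app-cong F (at e′ f) x) (at e _ x)
        ; *-assoc = λ _ _ _ → pointwise λ _ _ → ≈-refl
        ; *-identity = (λ _ → pointwise λ _ _ → ≈-refl) , (λ _ → pointwise λ _ _ → ≈-refl)
        ; distrib = (λ F _ _ → pointwise λ _ x → app-+ F _ _ x) , (λ _ _ _ → pointwise λ _ _ → ≈-refl) }
      ; zero = (λ _ → pointwise λ _ _ → ≈-refl) , (λ F → pointwise λ _ x → app-0 F x) } }

  private module S = Semiring operatorSemiring
  open Algebra.Properties.Semiring.Exp operatorSemiring public using () renaming (_^_ to _^ₒ_)
  open Algebra.Properties.Semiring.Sum operatorSemiring public using () renaming (sum to sumₒ)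
  open Algebra.Properties.Semiring.Sum semiring using (sum)

  sumₒ-app : ∀ {n} (v : Vector Operator n) f x → app (sumₒ v) f x ≡ sum (λ i → app (v i) f x)
  sumₒ-app {zero} v f x = refl
  sumₒ-app {suc n} v f x = cong (λ y → app (v zero) f x + y) (sumₒ-app (λ i → v (suc i)) f x)

  -- The monomial a[t] of the group ring R[ℤ]; sums of these contain the Gauss sum and the shift by
  -- 1.
  T : Carrier → ℤ → Operator
  T a t = record
    { app = λ f x → a * f (x ℤ.+ t)
    ; app-cong = λ e x → *-congˡ (e _)
    ; app-+ = λ f g x → distribˡ a _ _
    ; app-0 = λ x → zeroʳ a }

  T-comm : ∀ a s b t → (T a s ∘ₒ T b t) ≈ₒ (T b t ∘ₒ T a s)
  T-comm a s b t = pointwise λ f x → begin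
    a * (b * f (x ℤ.+ s ℤ.+ t))  ≈⟨ *-assoc a b _ ⟨
    a * b * f (x ℤ.+ s ℤ.+ t)    ≈⟨ *-congʳ (*-comm a b) ⟩
    b * a * f (x ℤ.+ s ℤ.+ t)    ≡⟨ cong (λ y → b * a * f y) (swap x s t) ⟩
    b * a * f (x ℤ.+ t ℤ.+ s)    ≈⟨ *-assoc b a _ ⟩
    b * (a * f (x ℤ.+ t ℤ.+ s))  ∎
    where
    open Relation.Binary.Reasoning.Setoid setoid
    swap : ∀ x s t → x ℤ.+ s ℤ.+ t ≡ x ℤ.+ t ℤ.+ s
    swap = ℤSolver.solve-∀

  T-^ : ∀ a t n → (T a t ^ₒ n) ≈ₒ T (a ^ n) (+ n ℤ.* t)
  T-^ a t zero = pointwise λ f x → ≈-trans (≈-sym (*-identityˡ _)) (reflexive (cong (λ y → 1# * f y) (x≡x+0t x t)))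
    where
    x≡x+0t : ∀ x t → x ≡ x ℤ.+ + 0 ℤ.* t
    x≡x+0t = ℤSolver.solve-∀
  T-^ a t (suc n) = pointwise λ f x → begin
    a * app (T a t ^ₒ n) f (x ℤ.+ t)             ≈⟨ *-congˡ (at (T-^ a t n) f _) ⟩
    a * (a ^ n * f (x ℤ.+ t ℤ.+ + n ℤ.* t))      ≈⟨ *-assoc _ _ _ ⟨
    a * a ^ n * f (x ℤ.+ t ℤ.+ + n ℤ.* t)        ≡⟨ cong (λ y → a * a ^ n * f y) (shift x t (+ n)) ⟩
    a * a ^ n * f (x ℤ.+ + suc n ℤ.* t)          ∎
    where
    open Relation.Binary.Reasoning.Setoid setoid
    shift : ∀ x t n → x ℤ.+ t ℤ.+ n ℤ.* t ≡ x ℤ.+ (+ 1 ℤ.+ n) ℤ.* t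
    shift = ℤSolver.solve-∀

  sum-commutes : ∀ {n} F (v : Vector Operator n) → (∀ i → (F ∘ₒ v i) ≈ₒ (v i ∘ₒ F)) → (F ∘ₒ sumₒ v) ≈ₒ (sumₒ v ∘ₒ F)
  sum-commutes {zero} F v e = pointwise λ _ x → app-0 F x
  sum-commutes {suc n} F v e = S.trans (S.distribˡ F (v zero) (sumₒ λ i → v (suc i)))
    (S.trans (S.+-cong (e zero) (sum-commutes F (λ i → v (suc i)) λ i → e (suc i)))
      (S.sym (S.distribʳ F (v zero) (sumₒ λ i → v (suc i)))))

  module _ {p : ℕ} (pr : Prime p) (char : ∀ x → Algebra.Properties.Semiring.Mult._×_ semiring p x ≈ 0#) where
    open Freshman operatorSemiring

    charₒ : ∀ F → Algebra.Properties.Semiring.Mult._×_ operatorSemiring p F ≈ₒ 0ₒ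
    charₒ F = pointwise λ f x → ≈-trans (reflexive (×-app p f x)) (char _)
      where
      ×-app : ∀ n f x → app (Algebra.Properties.Semiring.Mult._×_ operatorSemiring n F) f x
                      ≡ Algebra.Properties.Semiring.Mult._×_ semiring n (app F f x)
      ×-app zero f x = refl
      ×-app (suc n) f x = cong (λ y → app F f x + y) (×-app n f x)

    freshmanₒ : ∀ F G → (F ∘ₒ G) ≈ₒ (G ∘ₒ F) → ((F +ₒ G) ^ₒ p) ≈ₒ ((F ^ₒ p) +ₒ (G ^ₒ p))
    freshmanₒ = freshman pr charₒ

    -- The terms commute, so the p-th power is additive on the sum, and it takes the monomial a[t]
    -- to aᵖ[pt].
    frobenius : ∀ {n} (a : Fin n → Carrier) (t : Fin n → ℤ) →
      (sumₒ (λ i → T (a i) (t i)) ^ₒ p) ≈ₒ sumₒ (λ i → T (a i ^ p) (+ p ℤ.* t i))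
    frobenius {zero} a t = go p refl
      where
      go : ∀ n → n ≡ p → (0ₒ ^ₒ n) ≈ₒ 0ₒ
      go zero 0≡p = ⊥-elim (ℕ.≢-nonZero⁻¹ p {{prime⇒nonZero pr}} (sym 0≡p))
      go (suc n) _ = pointwise λ _ _ → ≈-refl
    frobenius {suc n} a t = S.trans
      (freshmanₒ (T (a zero) (t zero)) (sumₒ λ i → T (a (suc i)) (t (suc i)))
        (sum-commutes (T (a zero) (t zero)) (λ i → T (a (suc i)) (t (suc i)))
          λ i → T-comm (a zero) (t zero) (a (suc i)) (t (suc i))))
      (S.+-cong (T-^ (a zero) (t zero) p) (frobenius (λ i → a (suc i)) (λ i → t (suc i))))

-- Congruences and cube roots of unity

open import Data.Integer using (_+_; _*_; _-_; -_; _^_)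

module ModuloFermat {c ℓ} (R : CommutativeRing c ℓ) {p : ℕ} (pr : Prime p) where
  open CommutativeRing R hiding (_+_; _*_; _-_; -_; zero) renaming (refl to ≈-refl; sym to ≈-sym; trans to ≈-trans)
  open Algebra.Properties.Semiring.Exp semiring using (^-congˡ) renaming (_^_ to _^ᴿ_)
  open Algebra.Properties.Semiring.Mult semiring renaming (_×_ to _·_)
  open Freshman semiring

  1^ : ∀ n → 1# ^ᴿ n ≈ 1#
  1^ zero = ≈-refl
  1^ (suc n) = ≈-trans (*-identityˡ _) (1^ n)

  -- Induction on n: the freshman's dream gives (1 + n)ᵖ = 1 + nᵖ.
  fermat-natural : (∀ x → p · x ≈ 0#) → ∀ n → (n · 1#) ^ᴿ p ≈ n · 1#
  fermat-natural char zero = go p refl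
    where
    go : ∀ n → n ≡ p → 0# ^ᴿ n ≈ 0#
    go zero 0≡p = ⊥-elim (ℕ.≢-nonZero⁻¹ p {{prime⇒nonZero pr}} (sym 0≡p))
    go (suc n) _ = zeroˡ _
  fermat-natural char (suc n) = ≈-trans (freshman pr char 1# (n · 1#) (*-comm _ _))
    (+-cong (1^ p) (fermat-natural char n))

module ℤmod (m : ℤ) where
  open Modulo ℤₚ.+-*-commutativeRing m public renaming (≈⇒≋ to ≡⇒≋)

  ≋-refl : ∀ {x} → x ≋ x
  ≋-refl = ≡⇒≋ refl

  ≋⇒∣ : ∀ {x y} → x ≋ y → m ∣ x - y
  ≋⇒∣ (mod k e) = divides k e

  ∣⇒≋ : ∀ {x y} → m ∣ x - y → x ≋ y
  ∣⇒≋ (divides k e) = mod k e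

  ≋0⇒∣ : ∀ {x} → x ≋ + 0 → m ∣ x
  ≋0⇒∣ {x} e = subst (m ∣_) (ℤₚ.+-identityʳ x) (≋⇒∣ e)

  ∣⇒≋0 : ∀ {x} → m ∣ x → x ≋ + 0
  ∣⇒≋0 {x} d = ∣⇒≋ (subst (m ∣_) (sym (ℤₚ.+-identityʳ x)) d)

  ∣-resp-≋ : ∀ {x y} → x ≋ y → m ∣ x → m ∣ y
  ∣-resp-≋ e d = ≋0⇒∣ (≋-trans (≋-sym e) (∣⇒≋0 d))

  ^-cong-≋ : ∀ {x y} n → x ≋ y → x ^ n ≋ y ^ n
  ^-cong-≋ zero e = ≋-refl
  ^-cong-≋ (suc n) e = *-cong-≋ e (^-cong-≋ n e)

  *-congˡ-≋ : ∀ x {y z} → y ≋ z → x * y ≋ x * z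
  *-congˡ-≋ x e = *-cong-≋ (≋-refl {x}) e

^-distribʳ-* : ∀ x y n → (x * y) ^ n ≡ x ^ n * y ^ n
^-distribʳ-* x y zero = refl
^-distribʳ-* x y (suc n) = trans (cong (x * y *_) (^-distribʳ-* x y n)) (interchange x y (x ^ n) (y ^ n))
  where
  interchange : ∀ x y u v → x * y * (u * v) ≡ x * u * (y * v)
  interchange = ℤSolver.solve-∀

module PrimeMod {p : ℕ} (pr : Prime p) where
  open ℤmod (+ p)

  private
    _·_ : ℕ → ℤ → ℤ
    _·_ = Algebra.Properties.Semiring.Mult._×_ (CommutativeRing.semiring quotientRing)
    _^ᴿ_ : ℤ → ℕ → ℤ
    _^ᴿ_ = Algebra.Properties.Semiring.Exp._^_ (CommutativeRing.semiring quotientRing)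

    ·≡* : ∀ n x → n · x ≡ + n * x
    ·≡* zero x = sym (ℤₚ.*-zeroˡ x)
    ·≡* (suc n) x = trans (cong (λ y → x + y) (·≡* n x)) (distrib x (+ n))
      where
      distrib : ∀ x n → x + n * x ≡ (+ 1 + n) * x
      distrib = ℤSolver.solve-∀

    ^ᴿ≡^ : ∀ x n → x ^ᴿ n ≡ x ^ n
    ^ᴿ≡^ x zero = refl
    ^ᴿ≡^ x (suc n) = cong (x *_) (^ᴿ≡^ x n)

  char-p : ∀ x → Algebra.Properties.Semiring.Mult._×_ (CommutativeRing.semiring quotientRing) p x ≋ + 0
  char-p x = ∣⇒≋0 (divides x (trans (·≡* p x) (ℤₚ.*-comm (+ p) x)))

  residue : ℤ → ℕ
  residue x = ℤ/._%ℕ_ x p {{prime⇒nonZero pr}}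

  residue<p : ∀ x → residue x ℕ.< p
  residue<p x = ℤ/.n%ℕd<d x p {{prime⇒nonZero pr}}

  ≋-residue : ∀ x → x ≋ + residue x
  ≋-residue x = ∣⇒≋ (divides q (trans (cong (_- + residue x) (ℤ/.a≡a%ℕn+[a/ℕn]*n x p {{prime⇒nonZero pr}})) (cancel (+ residue x) (q * + p))))
    where
    q = ℤ/._/ℕ_ x p {{prime⇒nonZero pr}}
    cancel : ∀ a b → a + b - a ≡ b
    cancel = ℤSolver.solve-∀

  fermat : ∀ x → x ^ p ≋ x
  fermat x = ≋-trans (^-cong-≋ p (≋-residue x)) (≋-trans (subst₂ _≋_ (trans (cong (_^ᴿ p) (n·1 (residue x))) (^ᴿ≡^ _ p)) (n·1 (residue x))
    (ModuloFermat.fermat-natural quotientRing pr char-p (residue x))) (≋-sym (≋-residue x)))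
    where
    n·1 : ∀ n → n · (+ 1) ≡ + n
    n·1 n = trans (·≡* n (+ 1)) (ℤₚ.*-identityʳ (+ n))

  euclid : ∀ x y → + p ∣ x * y → + p ∣ x ⊎ + p ∣ y
  euclid x y d with euclidsLemma ℤ.∣ x ∣ ℤ.∣ y ∣ pr (subst (p ℕ∣.∣_) (ℤₚ.abs-* x y) (∣⇒∣ᵤ d))
  ... | inj₁ e = inj₁ (∣ᵤ⇒∣ e)
  ... | inj₂ e = inj₂ (∣ᵤ⇒∣ e)

  ∤-* : ∀ {x y} → ¬ (+ p ∣ x) → ¬ (+ p ∣ y) → ¬ (+ p ∣ x * y)
  ∤-* {x} {y} p∤x p∤y d with euclid x y d
  ... | inj₁ e = p∤x e
  ... | inj₂ e = p∤y e

  p∤1 : ¬ (+ p ∣ + 1)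
  p∤1 d = ℕₚ.<⇒≱ (ℕ.nonTrivial⇒n>1 p {{prime⇒nonTrivial pr}}) (ℕ∣.∣⇒≤ (∣⇒∣ᵤ d))

  ∣-^ : ∀ x n → + p ∣ x ^ n → + p ∣ x
  ∣-^ x zero d = ⊥-elim (p∤1 d)
  ∣-^ x (suc n) d with euclid x (x ^ n) d
  ... | inj₁ e = e
  ... | inj₂ e = ∣-^ x n e

  cancelˡ : ∀ x {y z} → ¬ (+ p ∣ x) → x * y ≋ x * z → y ≋ z
  cancelˡ x {y} {z} p∤x e = [ (λ d → ⊥-elim (p∤x d)) , ∣⇒≋ ]′ (euclid x (y - z) (subst (+ p ∣_) (distrib x y z) (≋⇒∣ e)))
    where
    distrib : ∀ x y z → x * y - x * z ≡ x * (y - z)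
    distrib = ℤSolver.solve-∀

  fermat-unit : ∀ x → ¬ (+ p ∣ x) → ∀ {k} → p ≡ suc k → x ^ k ≋ + 1
  fermat-unit x p∤x {k} refl = cancelˡ x p∤x (≋-trans (fermat x) (≡⇒≋ (sym (ℤₚ.*-identityʳ x))))

  inverse : ∀ x → ¬ (+ p ∣ x) → ∃ λ y → x * y ≋ + 1
  inverse x p∤x = go p refl
    where
    go : ∀ n → p ≡ n → ∃ λ y → x * y ≋ + 1
    go zero e = ⊥-elim (ℕ.≢-nonZero⁻¹ p {{prime⇒nonZero pr}} e)
    go (suc zero) e = ⊥-elim (p∤1 (divides (+ 1) (subst (λ n → + 1 ≡ + 1 * + n) (sym e) refl)))
    -- Here p = k + 2, and x^(p-2) inverts x by Fermat.
    go (suc (suc k)) e = x ^ k , fermat-unit x p∤x e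

infix 9 _⁻¹
infixl 7 _∙_

-- Values of symbols are kept in an abstract group of order 3, where identities are settled by
-- cases; `⟦_⟧` embeds it into Z[ω].
data μ₃ : Set where
  𝟙 ζ ζ² : μ₃

_∙_ : μ₃ → μ₃ → μ₃
𝟙 ∙ y = y
ζ ∙ 𝟙 = ζ
ζ ∙ ζ = ζ²
ζ ∙ ζ² = 𝟙
ζ² ∙ 𝟙 = ζ²
ζ² ∙ ζ = 𝟙
ζ² ∙ ζ² = ζ

_⁻¹ : μ₃ → μ₃
𝟙 ⁻¹ = 𝟙
ζ ⁻¹ = ζ²
ζ² ⁻¹ = ζ

∙-assoc : ∀ x y z → (x ∙ y) ∙ z ≡ x ∙ (y ∙ z)
∙-assoc 𝟙 y z = refl
∙-assoc ζ 𝟙 z = refl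
∙-assoc ζ ζ 𝟙 = refl
∙-assoc ζ ζ ζ = refl
∙-assoc ζ ζ ζ² = refl
∙-assoc ζ ζ² 𝟙 = refl
∙-assoc ζ ζ² ζ = refl
∙-assoc ζ ζ² ζ² = refl
∙-assoc ζ² 𝟙 z = refl
∙-assoc ζ² ζ 𝟙 = refl
∙-assoc ζ² ζ ζ = refl
∙-assoc ζ² ζ ζ² = refl
∙-assoc ζ² ζ² 𝟙 = refl
∙-assoc ζ² ζ² ζ = refl
∙-assoc ζ² ζ² ζ² = refl

∙-comm : ∀ x y → x ∙ y ≡ y ∙ x
∙-comm 𝟙 𝟙 = refl
∙-comm 𝟙 ζ = refl
∙-comm 𝟙 ζ² = refl
∙-comm ζ 𝟙 = refl
∙-comm ζ ζ = refl
∙-comm ζ ζ² = refl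
∙-comm ζ² 𝟙 = refl
∙-comm ζ² ζ = refl
∙-comm ζ² ζ² = refl

∙-identityʳ : ∀ x → x ∙ 𝟙 ≡ x
∙-identityʳ 𝟙 = refl
∙-identityʳ ζ = refl
∙-identityʳ ζ² = refl

square≡⁻¹ : ∀ x → x ∙ x ≡ x ⁻¹
square≡⁻¹ 𝟙 = refl
square≡⁻¹ ζ = refl
square≡⁻¹ ζ² = refl

cube≡𝟙 : ∀ x → x ∙ (x ∙ x) ≡ 𝟙
cube≡𝟙 𝟙 = refl
cube≡𝟙 ζ = refl
cube≡𝟙 ζ² = refl

square≡𝟙⇒≡𝟙 : ∀ x → x ∙ x ≡ 𝟙 → x ≡ 𝟙
square≡𝟙⇒≡𝟙 𝟙 _ = refl

⟦_⟧ : μ₃ → Zω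
⟦ 𝟙 ⟧ = 1ω
⟦ ζ ⟧ = ω
⟦ ζ² ⟧ = ω²

opaque
  unfolding _⊠_ conj

  ⟦⟧-∙ : ∀ x y → ⟦ x ∙ y ⟧ ≡ ⟦ x ⟧ ⊠ ⟦ y ⟧
  ⟦⟧-∙ 𝟙 𝟙 = refl
  ⟦⟧-∙ 𝟙 ζ = refl
  ⟦⟧-∙ 𝟙 ζ² = refl
  ⟦⟧-∙ ζ 𝟙 = refl
  ⟦⟧-∙ ζ ζ = refl
  ⟦⟧-∙ ζ ζ² = refl
  ⟦⟧-∙ ζ² 𝟙 = refl
  ⟦⟧-∙ ζ² ζ = refl
  ⟦⟧-∙ ζ² ζ² = refl

  ⟦⟧-conj : ∀ x → conj ⟦ x ⟧ ≡ ⟦ x ⁻¹ ⟧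
  ⟦⟧-conj 𝟙 = refl
  ⟦⟧-conj ζ = refl
  ⟦⟧-conj ζ² = refl

opaque
  unfolding _↑_ _⊠_

  ↑≡^ω : ∀ α n → α ↑ n ≡ α ^ω n
  ↑≡^ω α n = refl

  ⊠≡*ω : ∀ α β → α ⊠ β ≡ α *ω β
  ⊠≡*ω α β = refl

  ↑-zero : ∀ α → α ↑ 0 ≡ 1ω
  ↑-zero α = refl

  ↑-suc : ∀ α n → α ↑ suc n ≡ α ⊠ (α ↑ n)
  ↑-suc α n = refl

∣ω⇒ : ∀ {π α} → π ∣ω α → ∃ λ κ → α ≡ κ ⊠ π
∣ω⇒ {π} (κ , e) = κ , trans e (sym (⊠≡*ω κ π))

⇒∣ω : ∀ {π α} κ → α ≡ κ ⊠ π → π ∣ω α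
⇒∣ω {π} κ e = κ , trans e (⊠≡*ω κ π)

module _ where
  private
    module E = Algebra.Properties.CommutativeSemiring.Exp (CommutativeRing.commutativeSemiring Zω-commutativeRing)

    exp≡↑ : ∀ α n → α E.^ n ≡ α ↑ n
    exp≡↑ α zero = sym (↑-zero α)
    exp≡↑ α (suc n) = trans (cong (α ⊠_) (exp≡↑ α n)) (sym (↑-suc α n))

  ↑-homo-* : ∀ α m n → α ↑ (m ℕ.+ n) ≡ (α ↑ m) ⊠ (α ↑ n)
  ↑-homo-* α m n = trans (sym (exp≡↑ α (m ℕ.+ n))) (trans (E.^-homo-* α m n) (cong₂ _⊠_ (exp≡↑ α m) (exp≡↑ α n)))

  ↑-assocʳ : ∀ α m n → (α ↑ m) ↑ n ≡ α ↑ (m ℕ.* n)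
  ↑-assocʳ α m n = trans (sym (trans (cong (E._^ n) (exp≡↑ α m)) (exp≡↑ _ n))) (trans (E.^-assocʳ α m n) (exp≡↑ α (m ℕ.* n)))

  ↑-distrib-⊠ : ∀ α β n → (α ⊠ β) ↑ n ≡ (α ↑ n) ⊠ (β ↑ n)
  ↑-distrib-⊠ α β n = trans (sym (exp≡↑ _ n)) (trans (E.^-distrib-* α β n) (cong₂ _⊠_ (exp≡↑ α n) (exp≡↑ β n)))

1ω↑ : ∀ n → 1ω ↑ n ≡ 1ω
1ω↑ zero = ↑-zero 1ω
1ω↑ (suc n) = trans (↑-suc 1ω n) (trans (⊠-identityˡ _) (1ω↑ n))

opaque
  unfolding _⊞_ _⊠_

  fromℤ-+ : ∀ a b → fromℤ (a + b) ≡ fromℤ a ⊞ fromℤ b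
  fromℤ-+ a b = refl

  fromℤ-⊠ : ∀ m α → fromℤ m ⊠ α ≡ (m * re α) +ω (m * im α) ω
  fromℤ-⊠ m (a +ω b ω) = cong₂ _+ω_ω (l₁ m a b) (l₂ m a b)
    where
    l₁ : ∀ m a b → m * a - + 0 * b ≡ m * a
    l₁ = ℤSolver.solve-∀
    l₂ : ∀ m a b → m * b + + 0 * a - + 0 * b ≡ m * b
    l₂ = ℤSolver.solve-∀

fromℤ-* : ∀ a b → fromℤ (a * b) ≡ fromℤ a ⊠ fromℤ b
fromℤ-* a b = sym (trans (fromℤ-⊠ a (fromℤ b)) (cong₂ _+ω_ω refl (ℤₚ.*-zeroʳ a)))

fromℤ-^ : ∀ a n → fromℤ (a ^ n) ≡ fromℤ a ↑ n
fromℤ-^ a zero = sym (↑-zero _)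
fromℤ-^ a (suc n) = trans (fromℤ-* a (a ^ n)) (trans (cong (fromℤ a ⊠_) (fromℤ-^ a n)) (sym (↑-suc _ n)))

opaque
  unfolding _⊠_ _⊞_ ⊟_ conj

  conj-* : ∀ α β → conj (α ⊠ β) ≡ conj α ⊠ conj β
  conj-* (a +ω b ω) (c +ω d ω) = cong₂ _+ω_ω (l₁ a b c d) (l₂ a b c d)
    where
    l₁ : ∀ a b c d → (a * c - b * d) - (a * d + b * c - b * d) ≡ (a - b) * (c - d) - (- b) * (- d)
    l₁ = ℤSolver.solve-∀
    l₂ : ∀ a b c d → - (a * d + b * c - b * d) ≡ (a - b) * (- d) + (- b) * (c - d) - (- b) * (- d)
    l₂ = ℤSolver.solve-∀

  conj-⊟ : ∀ α → conj (⊟ α) ≡ ⊟ conj α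
  conj-⊟ (a +ω b ω) = cong₂ _+ω_ω (l₁ a b) refl
    where
    l₁ : ∀ a b → - a - (- b) ≡ - (a - b)
    l₁ = ℤSolver.solve-∀

  conj-⊞ : ∀ α β → conj (α ⊞ β) ≡ conj α ⊞ conj β
  conj-⊞ (a +ω b ω) (c +ω d ω) = cong₂ _+ω_ω (l₁ a b c d) (l₂ b d)
    where
    l₁ : ∀ a b c d → (a + c) - (b + d) ≡ (a - b) + (c - d)
    l₁ = ℤSolver.solve-∀
    l₂ : ∀ b d → - (b + d) ≡ - b + - d
    l₂ = ℤSolver.solve-∀

  conj-involutive : ∀ α → conj (conj α) ≡ α
  conj-involutive (a +ω b ω) = cong₂ _+ω_ω (l₁ a b) (ℤₚ.neg-involutive b)
    where
    l₁ : ∀ a b → a - b - (- b) ≡ a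
    l₁ = ℤSolver.solve-∀

  conj-fromℤ : ∀ m → conj (fromℤ m) ≡ fromℤ m
  conj-fromℤ m = cong (_+ω (+ 0) ω) (ℤₚ.+-identityʳ m)

  ⊠-conj : ∀ α → α ⊠ conj α ≡ fromℤ (normω α)
  ⊠-conj (a +ω b ω) = cong₂ _+ω_ω (l₁ a b) (l₂ a b)
    where
    l₁ : ∀ a b → a * (a - b) - b * (- b) ≡ a * a - a * b + b * b
    l₁ = ℤSolver.solve-∀
    l₂ : ∀ a b → a * (- b) + b * (a - b) - b * (- b) ≡ + 0
    l₂ = ℤSolver.solve-∀

  normω-* : ∀ α β → normω (α ⊠ β) ≡ normω α * normω β
  normω-* (a +ω b ω) (c +ω d ω) = l a b c d
    where
    l : ∀ a b c d → (a * c - b * d) * (a * c - b * d) - (a * c - b * d) * (a * d + b * c - b * d)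
        + (a * d + b * c - b * d) * (a * d + b * c - b * d)
      ≡ (a * a - a * b + b * b) * (c * c - c * d + d * d)
    l = ℤSolver.solve-∀

  normω-conj : ∀ α → normω (conj α) ≡ normω α
  normω-conj (a +ω b ω) = l a b
    where
    l : ∀ a b → (a - b) * (a - b) - (a - b) * (- b) + (- b) * (- b) ≡ a * a - a * b + b * b
    l = ℤSolver.solve-∀

  normω-fromℤ : ∀ m → normω (fromℤ m) ≡ m * m
  normω-fromℤ = l
    where
    l : ∀ m → m * m - m * + 0 + + 0 * + 0 ≡ m * m
    l = ℤSolver.solve-∀

conj-^ : ∀ α n → conj (α ↑ n) ≡ conj α ↑ n
conj-^ α zero = trans (cong conj (↑-zero α)) (trans (conj-fromℤ (+ 1)) (sym (↑-zero _)))
conj-^ α (suc n) = trans (cong conj (↑-suc α n)) (trans (conj-* α (α ↑ n)) (trans (cong (conj α ⊠_) (conj-^ α n)) (sym (↑-suc _ n))))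

module Zωmod (μ : Zω) where
  open Modulo Zω-commutativeRing μ public renaming (≈⇒≋ to ≡⇒≋)

  ≋-refl : ∀ {α} → α ≋ α
  ≋-refl = ≡⇒≋ refl

  opaque
    unfolding _⊞_ ⊟_ _⊠_

    ≋⇒∣ω : ∀ {α β} → α ≋ β → μ ∣ω (α -ω β)
    ≋⇒∣ω (mod κ e) = κ , e

    ∣ω⇒≋ : ∀ {α β} → μ ∣ω (α -ω β) → α ≋ β
    ∣ω⇒≋ (κ , e) = mod κ e

  -ω-0 : ∀ α → α -ω 0ω ≡ α
  -ω-0 α = cong₂ _+ω_ω (ℤₚ.+-identityʳ (re α)) (ℤₚ.+-identityʳ (im α))

  ≋0⇒∣ω : ∀ {α} → α ≋ 0ω → μ ∣ω α
  ≋0⇒∣ω {α} e = subst (μ ∣ω_) (-ω-0 α) (≋⇒∣ω e)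

  ∣ω⇒≋0 : ∀ {α} → μ ∣ω α → α ≋ 0ω
  ∣ω⇒≋0 {α} d = ∣ω⇒≋ (subst (μ ∣ω_) (sym (-ω-0 α)) d)

  ↑-cong-≋ : ∀ {α β} n → α ≋ β → α ↑ n ≋ β ↑ n
  ↑-cong-≋ {α} {β} zero e = ≡⇒≋ (trans (↑-zero α) (sym (↑-zero β)))
  ↑-cong-≋ {α} {β} (suc n) e = ≋-trans (≡⇒≋ (↑-suc α n)) (≋-trans (*-cong-≋ e (↑-cong-≋ n e)) (≡⇒≋ (sym (↑-suc β n))))

  *-congˡ-≋ : ∀ α {β γ} → β ≋ γ → α ⊠ β ≋ α ⊠ γ
  *-congˡ-≋ α e = *-cong-≋ (≋-refl {α}) e

fromℤ∣ω⇒∣ : ∀ {m α} → fromℤ m ∣ω α → m ∣ re α × m ∣ im α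
fromℤ∣ω⇒∣ {m} {α} (κ , e) =
  divides (re κ) (cong re α≡) , divides (im κ) (cong im α≡)
  where
  α≡ : α ≡ (re κ * m) +ω (im κ * m) ω
  α≡ = trans e (trans (sym (⊠≡*ω κ (fromℤ m))) (trans (⊠-comm κ (fromℤ m)) (trans (fromℤ-⊠ m κ) (cong₂ _+ω_ω (ℤₚ.*-comm m _) (ℤₚ.*-comm m _)))))

∣⇒fromℤ∣ω : ∀ {m α} → m ∣ re α → m ∣ im α → fromℤ m ∣ω α
∣⇒fromℤ∣ω {m} {α} (divides k e) (divides l f) = k +ω l ω ,
  trans (cong₂ _+ω_ω (trans e (ℤₚ.*-comm k m)) (trans f (ℤₚ.*-comm l m)))
    (trans (sym (fromℤ-⊠ m (k +ω l ω))) (trans (⊠-comm (fromℤ m) (k +ω l ω)) (⊠≡*ω _ _)))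

module Zωmodℤ (m : ℤ) where
  open Zωmod (fromℤ m) public
  open ℤmod m using () renaming (_≋_ to _≋ᶻ_; mod to modᶻ; ≋⇒∣ to ≋ᶻ⇒∣; ∣⇒≋ to ∣⇒≋ᶻ)

  ≋⇒≋-re : ∀ {α β} → α ≋ β → re α ≋ᶻ re β
  ≋⇒≋-re e = ∣⇒≋ᶻ (proj₁ (fromℤ∣ω⇒∣ (≋⇒∣ω e)))

  ≋⇒≋-im : ∀ {α β} → α ≋ β → im α ≋ᶻ im β
  ≋⇒≋-im e = ∣⇒≋ᶻ (proj₂ (fromℤ∣ω⇒∣ (≋⇒∣ω e)))

  components : ∀ {α β} → re α ≋ᶻ re β → im α ≋ᶻ im β → α ≋ β
  components e f = ∣ω⇒≋ (∣⇒fromℤ∣ω (≋ᶻ⇒∣ e) (≋ᶻ⇒∣ f))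

  fromℤ-cong : ∀ {a b} → a ≋ᶻ b → fromℤ a ≋ fromℤ b
  fromℤ-cong e = components e (ℤmod.≋-refl m)

  conj-cong : ∀ {α β} → α ≋ β → conj α ≋ conj β
  conj-cong {α} {β} (mod κ e) = mod (conj κ) (trans (conj-sub α β)
    (trans (cong conj e) (trans (conj-* κ (fromℤ m)) (cong (conj κ ⊠_) (conj-fromℤ m)))))
    where
    conj-sub : ∀ α β → conj α ⊞ ⊟ conj β ≡ conj (α ⊞ ⊟ β)
    conj-sub α β = trans (cong (conj α ⊞_) (sym (conj-⊟ β))) (sym (conj-⊞ α (⊟ β)))

  infix 4 _≋?_
  _≋?_ : ∀ α β → Dec (α ≋ β)
  α ≋? β with m ∣? (re α - re β) | m ∣? (im α - im β)
  ... | yes d | yes e = yes (∣ω⇒≋ (∣⇒fromℤ∣ω d e))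
  ... | no ¬d | _ = no λ e → ¬d (proj₁ (fromℤ∣ω⇒∣ (≋⇒∣ω e)))
  ... | yes _ | no ¬d = no λ e → ¬d (proj₂ (fromℤ∣ω⇒∣ (≋⇒∣ω e)))

-- `split` and `inert` name the behaviour of a prime q in Z[ω], and a prime in `divisible` is 3. The
-- quotient k is kept because the exponents of Euler's criterion are built from it.
data Class (q : ℕ) : Set where
  divisible : ∀ k → q ≡ 3 ℕ.* k → Class q
  split : ∀ k → q ≡ 1 ℕ.+ 3 ℕ.* k → Class q
  inert : ∀ k → q ≡ 2 ℕ.+ 3 ℕ.* k → Class q

classify : ∀ q → Class q
classify q with q ℕ.% 3 in eq | ℕ/.m≡m%n+[m/n]*n q 3
... | 0 | e = divisible (q ℕ./ 3) (trans e (ℕₚ.*-comm (q ℕ./ 3) 3))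
... | 1 | e = split (q ℕ./ 3) (trans e (cong suc (ℕₚ.*-comm (q ℕ./ 3) 3)))
... | 2 | e = inert (q ℕ./ 3) (trans e (cong (2 ℕ.+_) (ℕₚ.*-comm (q ℕ./ 3) 3)))
... | suc (suc (suc r)) | e = ⊥-elim (ℕₚ.<⇒≱ (ℕ/.m%n<n q 3) (subst (3 ℕ.≤_) (sym eq) (ℕ.s≤s (ℕ.s≤s (ℕ.s≤s ℕ.z≤n)))))

opaque
  unfolding _↑_ _⊠_

  ω↑1 : ω ↑ 1 ≡ ω
  ω↑1 = refl

  ω↑2 : ω ↑ 2 ≡ ω²
  ω↑2 = refl

  ω↑3 : ω ↑ 3 ≡ 1ω
  ω↑3 = refl

ω↑[3k] : ∀ k → ω ↑ (3 ℕ.* k) ≡ 1ω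
ω↑[3k] k = trans (sym (↑-assocʳ ω 3 k)) (trans (cong (_↑ k) ω↑3) (1ω↑ k))

ω↑[1+3k] : ∀ k → ω ↑ (1 ℕ.+ 3 ℕ.* k) ≡ ω
ω↑[1+3k] k = trans (↑-homo-* ω 1 (3 ℕ.* k)) (trans (cong₂ _⊠_ ω↑1 (ω↑[3k] k)) (⊠-identityʳ ω))

ω↑[2+3k] : ∀ k → ω ↑ (2 ℕ.+ 3 ℕ.* k) ≡ ω²
ω↑[2+3k] k = trans (↑-homo-* ω 2 (3 ℕ.* k)) (trans (cong₂ _⊠_ ω↑2 (ω↑[3k] k)) (⊠-identityʳ ω²))

opaque
  unfolding _⊞_ _⊠_ conj

  standard : ∀ α → α ≡ fromℤ (re α) ⊞ fromℤ (im α) ⊠ ω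
  standard (a +ω b ω) = cong₂ _+ω_ω (l₁ a b) (l₂ b)
    where
    l₁ : ∀ a b → a ≡ a + (b * + 0 - + 0 * + 1)
    l₁ = ℤSolver.solve-∀
    l₂ : ∀ b → b ≡ + 0 + (b * + 1 + + 0 * + 0 - + 0 * + 1)
    l₂ = ℤSolver.solve-∀

  conj-standard : ∀ α → fromℤ (re α) ⊞ fromℤ (im α) ⊠ ω² ≡ conj α
  conj-standard (a +ω b ω) = cong₂ _+ω_ω (l₁ a b) (l₂ b)
    where
    l₁ : ∀ a b → a + (b * - + 1 - + 0 * - + 1) ≡ a - b
    l₁ = ℤSolver.solve-∀
    l₂ : ∀ b → + 0 + (b * - + 1 + + 0 * - + 1 - + 0 * - + 1) ≡ - b
    l₂ = ℤSolver.solve-∀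

module FrobeniusZω {q : ℕ} (pr : Prime q) where
  open Zωmodℤ (+ q)
  open PrimeMod pr using (fermat)

  private
    open Algebra.Properties.Semiring.Mult (CommutativeRing.semiring quotientRing) using () renaming (_×_ to _·_)
    open Algebra.Properties.Semiring.Exp (CommutativeRing.semiring quotientRing) using () renaming (_^_ to _^ᴿ_)

    ·≡* : ∀ n α → n · α ≡ fromℤ (+ n) ⊠ α
    ·≡* zero α = sym (⊠-zeroˡ α)
    ·≡* (suc n) α = trans (cong (α ⊞_) (·≡* n α)) (trans (cong (_⊞ (fromℤ (+ n) ⊠ α)) (sym (⊠-identityˡ α))) (trans (sym (⊠-distribʳ-⊞ α 1ω (fromℤ (+ n)))) (cong (_⊠ α) (sym (fromℤ-+ (+ 1) (+ n))))))

  ^ᴿ≡↑ : ∀ α n → α ^ᴿ n ≡ α ↑ n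
  ^ᴿ≡↑ α zero = sym (↑-zero α)
  ^ᴿ≡↑ α (suc n) = trans (cong (α ⊠_) (^ᴿ≡↑ α n)) (sym (↑-suc α n))

  charω : ∀ α → q · α ≋ 0ω
  charω α = ∣ω⇒≋0 (α , trans (·≡* q α) (trans (⊠-comm (fromℤ (+ q)) α) (⊠≡*ω _ _)))

  freshmanω : ∀ α β → (α ⊞ β) ↑ q ≋ (α ↑ q) ⊞ (β ↑ q)
  freshmanω α β = subst₂ _≋_ (^ᴿ≡↑ _ q) (cong₂ _⊞_ (^ᴿ≡↑ α q) (^ᴿ≡↑ β q))
    (Freshman.freshman (CommutativeRing.semiring quotientRing) pr charω α β (≡⇒≋ (⊠-comm α β)))

  private
    -- The q-th power is additive and fixes rational integers modulo q, so only ω^q depends on q.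
    frobeniusω : ∀ α → α ↑ q ≋ fromℤ (re α) ⊞ fromℤ (im α) ⊠ (ω ↑ q)
    frobeniusω α = ≋-trans (≡⇒≋ (cong (_↑ q) (standard α)))
      (≋-trans (freshmanω (fromℤ (re α)) (fromℤ (im α) ⊠ ω))
        (+-cong-≋ (fermatω (re α)) (≋-trans (≡⇒≋ (↑-distrib-⊠ (fromℤ (im α)) ω q)) (*-congʳ-≋ (ω ↑ q) (fermatω (im α))))))
      where
      fermatω : ∀ a → fromℤ a ↑ q ≋ fromℤ a
      fermatω a = ≋-trans (≡⇒≋ (sym (fromℤ-^ a q))) (fromℤ-cong (fermat a))

  frobenius-split : ∀ k → q ≡ 1 ℕ.+ 3 ℕ.* k → ∀ α → α ↑ q ≋ α
  frobenius-split k e α = ≋-trans (frobeniusω α)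
    (≡⇒≋ (trans (cong (λ ε → fromℤ (re α) ⊞ fromℤ (im α) ⊠ ε) (trans (cong (ω ↑_) e) (ω↑[1+3k] k))) (sym (standard α))))

  frobenius-inert : ∀ k → q ≡ 2 ℕ.+ 3 ℕ.* k → ∀ α → α ↑ q ≋ conj α
  frobenius-inert k e α = ≋-trans (frobeniusω α)
    (≡⇒≋ (trans (cong (λ ε → fromℤ (re α) ⊞ fromℤ (im α) ⊠ ε) (trans (cong (ω ↑_) e) (ω↑[2+3k] k))) (conj-standard α)))

-- The cubic residue symbol for rational primes

√-3 : Zω
√-3 = (+ 1) +ω (+ 2) ω

normω-^ : ∀ α n → normω (α ↑ n) ≡ normω α ^ n
normω-^ α zero = cong normω (↑-zero α)
normω-^ α (suc n) = trans (cong normω (↑-suc α n)) (trans (normω-* α (α ↑ n)) (cong (normω α *_) (normω-^ α n)))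

opaque
  unfolding _⊞_ ⊟_ _⊠_ _↑_ conj

  interchange-norm : ∀ ν γ γ̄ α → ν ⊠ γ̄ ⊠ (γ ⊠ α) ≡ γ ⊠ γ̄ ⊠ ν ⊠ α
  interchange-norm = Tactic.RingSolver.solve-∀ Zω-ring

  ↑3 : ∀ y → y ↑ 3 ≡ y ⊠ (y ⊠ (y ⊠ 1ω))
  ↑3 y = refl

  square-regroup : ∀ y z → y ⊠ y ⊠ (y ⊠ z) ≡ y ⊠ (y ⊠ (y ⊠ 1ω)) ⊠ z
  square-regroup = Tactic.RingSolver.solve-∀ Zω-ring

  split-regroup : ∀ α β γ δ → α ⊠ β ⊠ (γ ⊠ δ ⊠ (γ ⊠ δ)) ≡ α ⊠ (γ ⊠ γ) ⊠ (β ⊠ (δ ⊠ δ))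
  split-regroup = Tactic.RingSolver.solve-∀ Zω-ring

  re-square-conj : ∀ y → re (y ⊠ y) - re (conj y) ≡ (re y * re y - im y * im y) - (re y - im y)
  re-square-conj y = refl

  im-square-conj : ∀ y → im (y ⊠ y) - im (conj y) ≡ (re y * im y + im y * re y - im y * im y) - - im y
  im-square-conj y = refl

  √-3² : √-3 ⊠ √-3 ≡ fromℤ (- + 3)
  √-3² = refl

-- The cubic residue symbol (α/q)₃ for a rational prime q ≠ 3. For q = ρ conj(ρ) split,
-- (α/conj ρ)₃ = (conj α/ρ)₃², so (α/q)₃ is the Euler power of α conj(α)², a criterion modulo q itself.
module Residue {q : ℕ} (pr : Prime q) where
  open Zωmodℤ (+ q)
  open FrobeniusZω pr
  private
    module Z = ℤmod (+ q)
  open PrimeMod pr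

  -- The exponent is (q - 1)/3 for split q, and (q² - 1)/3 = (k + 1)(1 + 3k) for inert q = 2 + 3k,
  -- whose norm is q². The clause for q = 3 is a default value: the statements about `euler` assume
  -- that q does not divide 3.
  euler : Class q → Zω → Zω
  euler (divisible k _) α = 1ω
  euler (split k _) α = (α ⊠ (conj α ⊠ conj α)) ↑ k
  euler (inert k _) α = α ↑ (suc k ℕ.* (1 ℕ.+ 3 ℕ.* k))

  -- ζ² is what remains when both tests fail; `res-spec` shows that it is then the right value if q
  -- does not divide the norm of α.
  res : Class q → Zω → μ₃
  res C α with euler C α ≋? 1ω | euler C α ≋? ω
  ... | yes _ | _ = 𝟙
  ... | no _ | yes _ = ζ
  ... | no _ | no _ = ζ²

  -- Any two of 1, ω, ω² differ by 1 or -1 in some coordinate, so they stay distinct modulo every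
  -- prime, 3 included.
  ⟦⟧-injective : ∀ {x y} → ⟦ x ⟧ ≋ ⟦ y ⟧ → x ≡ y
  ⟦⟧-injective {𝟙} {𝟙} e = refl
  ⟦⟧-injective {𝟙} {ζ} e = ⊥-elim (p∤1 (Z.≋⇒∣ (≋⇒≋-re e)))
  ⟦⟧-injective {𝟙} {ζ²} e = ⊥-elim (p∤1 (Z.≋⇒∣ (≋⇒≋-im e)))
  ⟦⟧-injective {ζ} {𝟙} e = ⊥-elim (p∤1 (∣m⇒∣-m (Z.≋⇒∣ (≋⇒≋-re e))))
  ⟦⟧-injective {ζ} {ζ} e = refl
  ⟦⟧-injective {ζ} {ζ²} e = ⊥-elim (p∤1 (Z.≋⇒∣ (≋⇒≋-re e)))
  ⟦⟧-injective {ζ²} {𝟙} e = ⊥-elim (p∤1 (∣m⇒∣-m (Z.≋⇒∣ (≋⇒≋-im e))))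
  ⟦⟧-injective {ζ²} {ζ} e = ⊥-elim (p∤1 (∣m⇒∣-m (Z.≋⇒∣ (≋⇒≋-re e))))
  ⟦⟧-injective {ζ²} {ζ²} e = refl

  -- conj(γ) times an inverse of the norm of γ inverts γ modulo q.
  cancelω : ∀ γ {α β} → ¬ (+ q ∣ normω γ) → γ ⊠ α ≋ γ ⊠ β → α ≋ β
  cancelω γ {α} {β} q∤γ e = ≋-trans (≋-sym (unit α)) (≋-trans (*-congˡ-≋ (fromℤ n⁻¹ ⊠ conj γ) e) (unit β))
    where
    n⁻¹ = proj₁ (inverse (normω γ) q∤γ)
    unit : ∀ α → fromℤ n⁻¹ ⊠ conj γ ⊠ (γ ⊠ α) ≋ α
    unit α = ≋-trans (≡⇒≋ (trans (interchange-norm (fromℤ n⁻¹) γ (conj γ) α)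
      (cong (_⊠ α) (trans (cong (_⊠ fromℤ n⁻¹) (⊠-conj γ)) (sym (fromℤ-* (normω γ) n⁻¹))))))
      (≋-trans (*-congʳ-≋ α (fromℤ-cong (proj₂ (inverse (normω γ) q∤γ)))) (≡⇒≋ (⊠-identityˡ α)))

  -- Frobenius is conjugation, so α^(1+q) ≡ α conj(α) is the norm and vanishes, while α^(q²) ≡ α. As
  -- q² exceeds 1 + q, α vanishes too.
  inert⇒∣norm⇒∣ω : ∀ {k} → q ≡ 2 ℕ.+ 3 ℕ.* k → ∀ α → + q ∣ normω α → fromℤ (+ q) ∣ω α
  inert⇒∣norm⇒∣ω {k} e α d = ≋0⇒∣ω (≋-trans (≋-sym α^qq≋α)
    (≋-trans (≡⇒≋ (trans (cong (α ↑_) qq≡) (↑-homo-* α (suc q) _)))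
      (≋-trans (*-congʳ-≋ _ α^[1+q]≋0) (≡⇒≋ (⊠-zeroˡ (α ↑ (1 ℕ.+ 9 ℕ.* k ℕ.+ 9 ℕ.* (k ℕ.* k))))))))
    where
    α^qq≋α : α ↑ (q ℕ.* q) ≋ α
    α^qq≋α = ≋-trans (≡⇒≋ (sym (↑-assocʳ α q q))) (≋-trans (↑-cong-≋ q (frobenius-inert k e α))
      (≋-trans (frobenius-inert k e (conj α)) (≡⇒≋ (conj-involutive α))))
    α^[1+q]≋0 : α ↑ suc q ≋ 0ω
    α^[1+q]≋0 = ≋-trans (≡⇒≋ (↑-suc α q)) (≋-trans (*-congˡ-≋ α (frobenius-inert k e α)) (≋-trans (≡⇒≋ (⊠-conj α)) (fromℤ-cong (Z.∣⇒≋0 d))))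
    qq≡ : q ℕ.* q ≡ suc q ℕ.+ (1 ℕ.+ 9 ℕ.* k ℕ.+ 9 ℕ.* (k ℕ.* k))
    qq≡ = subst (λ n → n ℕ.* n ≡ suc n ℕ.+ (1 ℕ.+ 9 ℕ.* k ℕ.+ 9 ℕ.* (k ℕ.* k))) (sym e) (l k)
      where
      l : ∀ k → (2 ℕ.+ 3 ℕ.* k) ℕ.* (2 ℕ.+ 3 ℕ.* k) ≡ suc (2 ℕ.+ 3 ℕ.* k) ℕ.+ (1 ℕ.+ 9 ℕ.* k ℕ.+ 9 ℕ.* (k ℕ.* k))
      l = ℕSolver.solve-∀

  square≋conj : ∀ y → y ⊠ conj y ≋ 1ω → y ↑ 3 ≋ 1ω → y ⊠ y ≋ conj y
  square≋conj y yȳ≋1 y³≋1 = ≋-trans (≡⇒≋ (sym (⊠-identityʳ (y ⊠ y)))) (≋-trans (*-congˡ-≋ (y ⊠ y) (≋-sym yȳ≋1))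
    (≋-trans (≡⇒≋ (trans (square-regroup y (conj y)) (cong (_⊠ conj y) (sym (↑3 y))))) (≋-trans (*-congʳ-≋ (conj y) y³≋1) (≡⇒≋ (⊠-identityˡ (conj y))))))

  module _ (q∤3 : ¬ (+ q ∣ + 3)) where

    ¬divisible : ∀ k → ¬ (q ≡ 3 ℕ.* k)
    ¬divisible k e with prime⇒irreducible pr (ℕ∣.divides k (trans e (ℕₚ.*-comm 3 k)))
    ... | inj₂ 3≡q = q∤3 (divides (+ 1) (trans (cong +_ 3≡q) (sym (ℤₚ.*-identityˡ (+ q)))))

    -- For split q the quotient Z[ω]/q is a product of two fields and contains nine cube roots of 1;
    -- the condition y conj(y) ≡ 1 leaves three. Together the conditions give y² ≡ conj(y), which is
    -- solved coordinate by coordinate.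
    cube-roots : ∀ y → y ⊠ conj y ≋ 1ω → y ↑ 3 ≋ 1ω → ∃ λ χ → y ≋ ⟦ χ ⟧
    cube-roots y yȳ≋1 y³≋1 = [ when-q∣v , when-q∣2u-v+1 ]′ (euclid v (+ 2 * u - v + + 1) (subst (+ q ∣_) (l₁ u v) im-diff))
      where
      u = re y
      v = im y
      y²≋ȳ : y ⊠ y ≋ conj y
      y²≋ȳ = square≋conj y yȳ≋1 y³≋1
      y²-ȳ : + q ∣ re (y ⊠ y) - re (conj y) × + q ∣ im (y ⊠ y) - im (conj y)
      y²-ȳ = fromℤ∣ω⇒∣ (≋⇒∣ω y²≋ȳ)
      re-diff : + q ∣ (u * u - v * v) - (u - v)
      re-diff = subst (+ q ∣_) (re-square-conj y) (proj₁ y²-ȳ)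
      im-diff : + q ∣ (u * v + v * u - v * v) - - v
      im-diff = subst (+ q ∣_) (im-square-conj y) (proj₂ y²-ȳ)
      y≋0⇒⊥ : y ≋ 0ω → ⊥
      y≋0⇒⊥ y≋0 = p∤1 (Z.≋0⇒∣ (≋⇒≋-re {1ω} {0ω} (≋-trans (≋-sym yȳ≋1)
        (≋-trans (*-congʳ-≋ (conj y) y≋0) (≡⇒≋ (⊠-zeroˡ (conj y)))))))
      l₁ : ∀ u v → (u * v + v * u - v * v) - - v ≡ v * (+ 2 * u - v + + 1)
      l₁ = ℤSolver.solve-∀
      l₂ : ∀ u v → (u * u - v * v - (u - v)) + v * (v - + 1) ≡ u * (u - + 1)
      l₂ = ℤSolver.solve-∀
      -- Substituting v = 2u + 1 into the first coordinate of y² - conj(y) leaves -3u(u + 1).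
      l₃ : ∀ u v → (+ 2 * u - v + + 1) * (+ 4 * u + + 1 - (+ 2 * u - v + + 1)) - (u * u - v * v - (u - v)) ≡ + 3 * (u * (u + + 1))
      l₃ = ℤSolver.solve-∀
      l₄ : ∀ u v → + 2 * u - (+ 2 * u - v + + 1) ≡ v - + 1
      l₄ = ℤSolver.solve-∀
      l₅ : ∀ u v → + 2 * (u + + 1) - (+ 2 * u - v + + 1) ≡ v + + 1
      l₅ = ℤSolver.solve-∀
      when-q∣v : + q ∣ v → ∃ λ χ → y ≋ ⟦ χ ⟧
      when-q∣v q∣v = [ (λ q∣u → ⊥-elim (y≋0⇒⊥ (components (Z.∣⇒≋0 q∣u) (Z.∣⇒≋0 q∣v))))
                     , (λ q∣u-1 → 𝟙 , components (Z.∣⇒≋ q∣u-1) (Z.∣⇒≋0 q∣v)) ]′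
        (euclid u (u - + 1) (subst (+ q ∣_) (l₂ u v) (∣m∣n⇒∣m+n re-diff (∣m⇒∣m*n (v - + 1) q∣v))))
      when-q∣2u-v+1 : + q ∣ + 2 * u - v + + 1 → ∃ λ χ → y ≋ ⟦ χ ⟧
      when-q∣2u-v+1 d = [ (λ q∣3 → ⊥-elim (q∤3 q∣3))
                        , (λ q∣u[u+1] → [ (λ q∣u → ζ , components (Z.∣⇒≋0 q∣u) (Z.∣⇒≋ (subst (+ q ∣_) (l₄ u v) (∣m∣n⇒∣m-n (∣n⇒∣m*n (+ 2) q∣u) d))))
                                        , (λ q∣u+1 → ζ² , components (Z.∣⇒≋ q∣u+1) (Z.∣⇒≋ (subst (+ q ∣_) (l₅ u v) (∣m∣n⇒∣m-n (∣n⇒∣m*n (+ 2) q∣u+1) d))))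
                                        ]′ (euclid u (u + + 1) q∣u[u+1])) ]′
        (euclid (+ 3) (u * (u + + 1)) (subst (+ q ∣_) (l₃ u v) (∣m∣n⇒∣m-n (∣m⇒∣m*n (+ 4 * u + + 1 - (+ 2 * u - v + + 1)) d) re-diff)))

    -- The norm of the Euler power is a power of N(α)^(q-1): its exponent is 3k = q - 1 in the split
    -- case and (1 + 3k)(k + 1) with 1 + 3k = q - 1 in the inert case.
    euler-conj : ∀ C α → ¬ (+ q ∣ normω α) → euler C α ⊠ conj (euler C α) ≋ 1ω
    euler-conj (divisible k e) α q∤α = ⊥-elim (¬divisible k e)
    euler-conj (split k e) α q∤α = ≋-trans (≡⇒≋ (trans (⊠-conj (γ ↑ k)) (cong fromℤ (trans (normω-^ γ k) (trans (cong (_^ k) Nγ) (ℤₚ.^-*-assoc (normω α) 3 k))))))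
      (fromℤ-cong (fermat-unit (normω α) q∤α e))
      where
      γ = α ⊠ (conj α ⊠ conj α)
      l : ∀ n → n * (n * n) ≡ n * (n * (n * + 1))
      l = ℤSolver.solve-∀
      Nγ : normω γ ≡ normω α ^ 3
      Nγ = trans (normω-* α _) (trans (cong (normω α *_) (trans (normω-* (conj α) (conj α)) (cong₂ _*_ (normω-conj α) (normω-conj α)))) (l (normω α)))
    euler-conj (inert k e) α q∤α = ≋-trans (≡⇒≋ (trans (⊠-conj (α ↑ _)) (cong fromℤ (trans (normω-^ α (suc k ℕ.* (1 ℕ.+ 3 ℕ.* k)))
        (trans (cong (normω α ^_) (ℕₚ.*-comm (suc k) (1 ℕ.+ 3 ℕ.* k))) (sym (ℤₚ.^-*-assoc (normω α) (1 ℕ.+ 3 ℕ.* k) (suc k))))))))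
      (fromℤ-cong (Z.≋-trans (Z.^-cong-≋ (suc k) (fermat-unit (normω α) q∤α e)) (Z.≡⇒≋ (ℤₚ.^-zeroˡ (suc k)))))

    -- The cube is γ^(q-1) in the split case and α^(q²-1) in the inert case. Frobenius, applied once
    -- or twice, returns the base, which then cancels.
    euler-cube : ∀ C α → ¬ (+ q ∣ normω α) → euler C α ↑ 3 ≋ 1ω
    euler-cube (divisible k e) α q∤α = ⊥-elim (¬divisible k e)
    euler-cube (split k e) α q∤α = ≋-trans (≡⇒≋ (trans (↑-assocʳ γ k 3) (cong (γ ↑_) (ℕₚ.*-comm k 3))))
      (cancelω γ q∤γ (≋-trans (≡⇒≋ (trans (sym (↑-suc γ (3 ℕ.* k))) (cong (γ ↑_) (sym e)))) (≋-trans (frobenius-split k e γ) (≡⇒≋ (sym (⊠-identityʳ γ))))))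
      where
      γ = α ⊠ (conj α ⊠ conj α)
      q∤γ : ¬ (+ q ∣ normω γ)
      q∤γ d = ∤-* q∤α (∤-* q∤ᾱ q∤ᾱ) (subst (+ q ∣_) (trans (normω-* α _) (cong (normω α *_) (normω-* (conj α) (conj α)))) d)
        where
        q∤ᾱ : ¬ (+ q ∣ normω (conj α))
        q∤ᾱ d = q∤α (subst (+ q ∣_) (normω-conj α) d)
    euler-cube (inert k e) α q∤α = ≋-trans (≡⇒≋ (↑-assocʳ α _ 3))
      (cancelω α q∤α (≋-trans (≡⇒≋ (trans (sym (↑-suc α _)) (trans (cong (α ↑_) qq) (sym (↑-assocʳ α q q)))))
        (≋-trans (↑-cong-≋ q (frobenius-inert k e α)) (≋-trans (frobenius-inert k e (conj α))
          (≡⇒≋ (trans (conj-involutive α) (sym (⊠-identityʳ α))))))))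
      where
      qq : suc (suc k ℕ.* (1 ℕ.+ 3 ℕ.* k) ℕ.* 3) ≡ q ℕ.* q
      qq = trans (l k) (cong₂ ℕ._*_ (sym e) (sym e))
        where
        l : ∀ k → suc (suc k ℕ.* (1 ℕ.+ 3 ℕ.* k) ℕ.* 3) ≡ (2 ℕ.+ 3 ℕ.* k) ℕ.* (2 ℕ.+ 3 ℕ.* k)
        l = ℕSolver.solve-∀

    res-spec : ∀ C α → ¬ (+ q ∣ normω α) → euler C α ≋ ⟦ res C α ⟧
    res-spec C α q∤α with euler C α ≋? 1ω | euler C α ≋? ω
    ... | yes e | _ = e
    ... | no _ | yes e = e
    ... | no ¬𝟙 | no ¬ζ = third (cube-roots (euler C α) (euler-conj C α q∤α) (euler-cube C α q∤α))
      where
      third : (∃ λ χ → euler C α ≋ ⟦ χ ⟧) → euler C α ≋ ω²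
      third (𝟙 , e) = ⊥-elim (¬𝟙 e)
      third (ζ , e) = ⊥-elim (¬ζ e)
      third (ζ² , e) = e

    res-unique : ∀ C α {χ} → ¬ (+ q ∣ normω α) → euler C α ≋ ⟦ χ ⟧ → res C α ≡ χ
    res-unique C α q∤α e = ⟦⟧-injective (≋-trans (≋-sym (res-spec C α q∤α)) e)

    euler-* : ∀ C α β → euler C (α ⊠ β) ≡ euler C α ⊠ euler C β
    euler-* (divisible k e) α β = sym (⊠-identityˡ 1ω)
    euler-* (split k e) α β = trans (cong (_↑ k) (trans (cong (λ γ → α ⊠ β ⊠ (γ ⊠ γ)) (conj-* α β)) (split-regroup α β (conj α) (conj β))))
      (↑-distrib-⊠ _ _ k)
    euler-* (inert k e) α β = ↑-distrib-⊠ α β _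

    res-* : ∀ C α β → ¬ (+ q ∣ normω α) → ¬ (+ q ∣ normω β) → res C (α ⊠ β) ≡ res C α ∙ res C β
    res-* C α β q∤α q∤β = res-unique C (α ⊠ β) (λ d → ∤-* q∤α q∤β (subst (+ q ∣_) (normω-* α β) d))
      (≋-trans (≡⇒≋ (euler-* C α β)) (≋-trans (*-cong-≋ (res-spec C α q∤α) (res-spec C β q∤β)) (≡⇒≋ (sym (⟦⟧-∙ _ _)))))

    euler-cong : ∀ C {α β} → α ≋ β → euler C α ≋ euler C β
    euler-cong (divisible k e) α≋β = ≋-refl
    euler-cong (split k e) α≋β = ↑-cong-≋ k (*-cong-≋ α≋β (*-cong-≋ (conj-cong α≋β) (conj-cong α≋β)))
    euler-cong (inert k e) α≋β = ↑-cong-≋ (suc k ℕ.* (1 ℕ.+ 3 ℕ.* k)) α≋β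

    normω-cong : ∀ {α β} → α ≋ β → normω α Z.≋ normω β
    normω-cong {α} {β} e = ≋⇒≋-re (≋-trans (≡⇒≋ (sym (⊠-conj α))) (≋-trans (*-cong-≋ e (conj-cong e)) (≡⇒≋ (⊠-conj β))))

    res-cong : ∀ C {α β} → ¬ (+ q ∣ normω α) → α ≋ β → res C α ≡ res C β
    res-cong C {α} {β} q∤α e = res-unique C α q∤α (≋-trans (euler-cong C e)
      (res-spec C β λ d → q∤α (Z.∣-resp-≋ (Z.≋-sym (normω-cong e)) d)))

    ∤norm-fromℤ : ∀ {m} → ¬ (+ q ∣ m) → ¬ (+ q ∣ normω (fromℤ m))
    ∤norm-fromℤ {m} q∤m d = ∤-* q∤m q∤m (subst (+ q ∣_) (normω-fromℤ m) d)

    -- For rational m the Euler power is m^(3k) or a power of m^(1+3k), in both cases a power of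
    -- m^(q-1).
    res-fromℤ : ∀ C m → ¬ (+ q ∣ m) → res C (fromℤ m) ≡ 𝟙
    res-fromℤ C m q∤m = res-unique C (fromℤ m) (∤norm-fromℤ q∤m) (go C)
      where
      l : ∀ m → m * (m * m) ≡ m * (m * (m * + 1))
      l = ℤSolver.solve-∀
      go : ∀ C → euler C (fromℤ m) ≋ 1ω
      go (divisible k e) = ≋-refl
      go (split k e) = ≋-trans (≡⇒≋ (trans (cong (_↑ k) (trans (cong₂ (λ β γ → fromℤ m ⊠ (β ⊠ γ)) (conj-fromℤ m) (conj-fromℤ m))
          (trans (cong (fromℤ m ⊠_) (sym (fromℤ-* m m))) (sym (fromℤ-* m (m * m)))))) (trans (sym (fromℤ-^ (m * (m * m)) k))
            (cong fromℤ (trans (cong (_^ k) (l m)) (ℤₚ.^-*-assoc m 3 k))))))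
        (fromℤ-cong (fermat-unit m q∤m e))
      go (inert k e) = ≋-trans (≡⇒≋ (trans (sym (fromℤ-^ m _)) (cong fromℤ
          (trans (cong (m ^_) (ℕₚ.*-comm (suc k) (1 ℕ.+ 3 ℕ.* k))) (sym (ℤₚ.^-*-assoc m (1 ℕ.+ 3 ℕ.* k) (suc k)))))))
        (fromℤ-cong (Z.≋-trans (Z.^-cong-≋ (suc k) (fermat-unit m q∤m e)) (Z.≡⇒≋ (ℤₚ.^-zeroˡ (suc k)))))

    q∤-3 : ¬ (+ q ∣ - + 3)
    q∤-3 d = q∤3 (∣m⇒∣-m d)

    res-√-3 : ∀ C → res C √-3 ≡ 𝟙
    res-√-3 C = square≡𝟙⇒≡𝟙 _ (trans (sym (res-* C √-3 √-3 q∤3 q∤3)) (trans (cong (res C) √-3²) (res-fromℤ C (- + 3) q∤-3)))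

    res-scale : ∀ C m α → ¬ (+ q ∣ m) → ¬ (+ q ∣ normω α) → res C (fromℤ m ⊠ α) ≡ res C α
    res-scale C m α q∤m q∤α = trans (res-* C (fromℤ m) α (∤norm-fromℤ q∤m) q∤α) (cong (_∙ res C α) (res-fromℤ C m q∤m))

    res-√-3* : ∀ C α → ¬ (+ q ∣ normω α) → res C (√-3 ⊠ α) ≡ res C α
    res-√-3* C α q∤α = trans (res-* C √-3 α q∤3 q∤α) (cong (_∙ res C α) (res-√-3 C))

-- Power sums modulo p

Δ : (ℤ → ℤ) → ℤ → ℤ
Δ f x = f (x + + 1) - f x

-- Degree is measured by the vanishing of iterated differences, so that plain functions can stand
-- for polynomials and no coefficients are carried.
DegreeBelow : ℕ → (ℤ → ℤ) → Set
DegreeBelow zero f = ∀ x → f x ≡ + 0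
DegreeBelow (suc n) f = DegreeBelow n (Δ f)

degree-cong : ∀ n {f g} → (∀ x → f x ≡ g x) → DegreeBelow n f → DegreeBelow n g
degree-cong zero e d x = trans (sym (e x)) (d x)
degree-cong (suc n) e d = degree-cong n (λ x → cong₂ _-_ (e (x + + 1)) (e x)) d

degree-+ : ∀ n {f g} → DegreeBelow n f → DegreeBelow n g → DegreeBelow n (λ x → f x + g x)
degree-+ zero d e x = cong₂ _+_ (d x) (e x)
degree-+ (suc n) {f} {g} d e = degree-cong n (λ x → l (f (x + + 1)) (f x) (g (x + + 1)) (g x)) (degree-+ n d e)
  where
  l : ∀ a b c d → (a - b) + (c - d) ≡ (a + c) - (b + d)
  l = ℤSolver.solve-∀

degree-suc : ∀ n {f} → DegreeBelow n f → DegreeBelow (suc n) f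
degree-suc zero d x = cong₂ _-_ (d (x + + 1)) (d x)
degree-suc (suc n) d = degree-suc n d

degree-≤ : ∀ {m n f} → m ℕ.≤ n → DegreeBelow m f → DegreeBelow n f
degree-≤ {m} {n} {f} m≤n d = subst (λ k → DegreeBelow k f) (ℕₚ.m∸n+n≡m m≤n) (go (n ℕ.∸ m))
  where
  go : ∀ k → DegreeBelow (k ℕ.+ m) f
  go zero = d
  go (suc k) = degree-suc (k ℕ.+ m) (go k)

-- Product rule for differences: Δ((x + c)f) = (x + c)Δf + Δf + f.
degree-linear : ∀ n c {f} → DegreeBelow n f → DegreeBelow (suc n) (λ x → (x + c) * f x)
degree-linear zero c {f} d x = trans (cong₂ (λ u v → (x + + 1 + c) * u - (x + c) * v) (d (x + + 1)) (d x)) (l (x + + 1 + c) (x + c))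
  where
  l : ∀ a b → a * + 0 - b * + 0 ≡ + 0
  l = ℤSolver.solve-∀
degree-linear (suc n) c {f} d = degree-cong (suc n) {λ x → (x + c) * Δ f x + (Δ f x + f x)} (λ x → l x c (f (x + + 1)) (f x))
  (degree-+ (suc n) {λ x → (x + c) * Δ f x} {λ x → Δ f x + f x} (degree-linear n c d) (degree-+ (suc n) {Δ f} {f} (degree-suc n d) d))
  where
  l : ∀ x c a b → (x + c) * (a - b) + ((a - b) + b) ≡ (x + + 1 + c) * a - (x + c) * b
  l = ℤSolver.solve-∀

degree-x^k : ∀ k → DegreeBelow (suc k) (λ x → x ^ k)
degree-x^k zero x = refl
degree-x^k (suc k) = degree-cong (suc (suc k)) (λ x → cong (_* x ^ k) (ℤₚ.+-identityʳ x)) (degree-linear (suc k) (+ 0) (degree-x^k k))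

degree-x^k[x+1]^j : ∀ k j → DegreeBelow (suc (j ℕ.+ k)) (λ x → (x + + 1) ^ j * x ^ k)
degree-x^k[x+1]^j k zero = degree-cong (suc k) (λ x → sym (ℤₚ.*-identityˡ (x ^ k))) (degree-x^k k)
degree-x^k[x+1]^j k (suc j) = degree-cong (suc (suc (j ℕ.+ k))) (λ x → sym (ℤₚ.*-assoc (x + + 1) ((x + + 1) ^ j) (x ^ k)))
  (degree-linear (suc (j ℕ.+ k)) (+ 1) (degree-x^k[x+1]^j k j))

partialSum : (ℤ → ℤ) → ℕ → ℤ
partialSum g zero = + 0
partialSum g (suc n) = partialSum g n + g (+ n)

module PowerSums {p : ℕ} (pr : Prime p) where
  open ℤmod (+ p)
  open PrimeMod pr
  private
    module Op = Operators quotientRing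
    open Op using (app; T; _+ₒ_; _∘ₒ_; _≈ₒ_; pointwise; at; 1ₒ; _^ₒ_)

    Δₒ : Op.Operator
    Δₒ = record
      { app = Δ
      ; app-cong = λ e x → +-cong-≋ (e (x + + 1)) (-‿cong-≋ (e x))
      ; app-+ = λ f g x → ≡⇒≋ (l (f (x + + 1)) (f x) (g (x + + 1)) (g x))
      ; app-0 = λ x → ≋-refl }
      where
      l : ∀ a b c d → (a + c) - (b + d) ≡ (a - b) + (c - d)
      l = ℤSolver.solve-∀

    E≈1+Δ : T (+ 1) (+ 1) ≈ₒ (1ₒ +ₒ Δₒ)
    E≈1+Δ = pointwise λ f x → ≡⇒≋ (l (f (x + + 1)) (f x))
      where
      l : ∀ a b → + 1 * a ≡ b + (a - b)
      l = ℤSolver.solve-∀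

    module S = CommutativeRing quotientRing
    open Algebra.Properties.Semiring.Mult S.semiring using () renaming (_×_ to _·_)
    open Algebra.Properties.Semiring.Exp S.semiring using () renaming (_^_ to _^ᴿ_)
    module Sₒ = Algebra.Bundles.Semiring Op.operatorSemiring

    1ₒ^ : ∀ n → (1ₒ ^ₒ n) ≈ₒ 1ₒ
    1ₒ^ zero = Sₒ.refl
    1ₒ^ (suc n) = Sₒ.trans (Sₒ.*-identityˡ (1ₒ ^ₒ n)) (1ₒ^ n)

    -- The shift by 1 is 1 + Δ, and its p-th power is the shift by p; the freshman's dream removes
    -- the mixed terms modulo p.
    E^p≈1+Δ^p : T ((+ 1) ^ᴿ p) (+ p * + 1) ≈ₒ (1ₒ +ₒ (Δₒ ^ₒ p))
    E^p≈1+Δ^p = begin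
      T ((+ 1) ^ᴿ p) (+ p * + 1)   ≈⟨ Op.T-^ (+ 1) (+ 1) p ⟨
      T (+ 1) (+ 1) ^ₒ p           ≈⟨ Algebra.Properties.Semiring.Exp.^-congˡ Op.operatorSemiring p {T (+ 1) (+ 1)} {1ₒ +ₒ Δₒ} E≈1+Δ ⟩
      (1ₒ +ₒ Δₒ) ^ₒ p              ≈⟨ Op.freshmanₒ pr char-p 1ₒ Δₒ (Sₒ.trans (Sₒ.*-identityˡ Δₒ) (Sₒ.sym (Sₒ.*-identityʳ Δₒ))) ⟩
      (1ₒ ^ₒ p) +ₒ (Δₒ ^ₒ p)       ≈⟨ Sₒ.+-congʳ {Δₒ ^ₒ p} (1ₒ^ p) ⟩
      1ₒ +ₒ (Δₒ ^ₒ p)              ∎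
      where open Relation.Binary.Reasoning.Setoid Sₒ.setoid

    f[p]≋f[0]+Δ^p : ∀ f → f (+ p) ≋ f (+ 0) + app (Δₒ ^ₒ p) f (+ 0)
    f[p]≋f[0]+Δ^p f = ≋-trans (≋-sym (≋-trans (*-congʳ-≋ _ (ModuloFermat.1^ quotientRing pr p))
      (≡⇒≋ (trans (ℤₚ.*-identityˡ _) (cong f (trans (ℤₚ.+-identityˡ _) (ℤₚ.*-identityʳ (+ p)))))))) (at E^p≈1+Δ^p f (+ 0))

    -- Differences at a natural number only look to its right. The indefinite sum in `powerSum≋0`
    -- has the prescribed differences only there.
    Δ-local : ∀ n f g → (∀ m → f (+ m) ≡ g (+ m)) → ∀ m → app (Δₒ ^ₒ n) f (+ m) ≡ app (Δₒ ^ₒ n) g (+ m)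
    Δ-local zero f g e m = e m
    Δ-local (suc n) f g e m = cong₂ _-_ (Δ-local n f g e (m ℕ.+ 1)) (Δ-local n f g e m)

    Δ^-suc : ∀ n f x → app (Δₒ ^ₒ suc n) f x ≡ app (Δₒ ^ₒ n) (Δ f) x
    Δ^-suc zero f x = refl
    Δ^-suc (suc n) f x = cong₂ _-_ (Δ^-suc n f (x + + 1)) (Δ^-suc n f x)

    degree⇒Δ^≡0 : ∀ n f → DegreeBelow n f → ∀ x → app (Δₒ ^ₒ n) f x ≡ + 0
    degree⇒Δ^≡0 zero f d x = d x
    degree⇒Δ^≡0 (suc n) f d x = trans (Δ^-suc n f x) (degree⇒Δ^≡0 n (Δ f) d x)

  0^k : ∀ k → 0 ℕ.< k → (+ 0) ^ k ≡ + 0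
  0^k (suc k) _ = ℤₚ.*-zeroˡ ((+ 0) ^ k)

  -- With f the indefinite sum of g, the power sum is f(p) ≡ f(0) + (Δᵖf)(0), and Δᵖf = Δᵖ⁻¹g
  -- vanishes because the degree of g is below p - 1.
  powerSum≋0 : ∀ g n → DegreeBelow n g → n ℕ.< p → partialSum g p ≋ + 0
  powerSum≋0 g n d n<p = go p refl
    where
    f : ℤ → ℤ
    f x = partialSum g ℤ.∣ x ∣
    Δf≡g : ∀ m → Δ f (+ m) ≡ g (+ m)
    Δf≡g m = trans (cong (λ k → partialSum g k - partialSum g m) (ℕₚ.+-comm m 1)) (l (partialSum g m) (g (+ m)))
      where
      l : ∀ a b → a + b - a ≡ b
      l = ℤSolver.solve-∀
    go : ∀ p′ → p ≡ p′ → partialSum g p ≋ + 0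
    go zero e = ⊥-elim (ℕ.≢-nonZero⁻¹ p {{prime⇒nonZero pr}} e)
    go (suc p′) e = ≋-trans (f[p]≋f[0]+Δ^p f) (≡⇒≋ (trans (cong (λ k → + 0 + app (Δₒ ^ₒ k) f (+ 0)) e)
      (trans (ℤₚ.+-identityˡ _) (trans (Δ^-suc p′ f (+ 0)) (trans (Δ-local p′ (Δ f) g Δf≡g 0)
        (degree⇒Δ^≡0 p′ g (degree-≤ (ℕₚ.≤-pred (subst (n ℕ.<_) e n<p)) d) (+ 0)))))))

  ∣⇒<p⇒≡0 : ∀ m → m ℕ.< p → + p ∣ + m → m ≡ 0
  ∣⇒<p⇒≡0 zero _ _ = refl
  ∣⇒<p⇒≡0 (suc m) m<p d = ⊥-elim (ℕₚ.<⇒≱ m<p (ℕ∣.∣⇒≤ (∣⇒∣ᵤ d)))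

  -- If c^k ≡ 1 for every unit c, the sum of all x^k would be p - 1 ≡ -1, whereas a power sum of so
  -- small a degree vanishes.
  nonresidue : ∀ k → 0 ℕ.< k → suc k ℕ.< p → ∃ λ c → ¬ (+ p ∣ c) × ¬ (c ^ k ≋ + 1)
  nonresidue k 0<k k<p with Finₚ.any? {p} (λ i → Relation.Nullary.¬? (+ p ∣? + toℕ i) Relation.Nullary.×-dec Relation.Nullary.¬? (+ p ∣? (+ toℕ i) ^ k - + 1))
  ... | yes (i , p∤i , i^k≢1) = + toℕ i , p∤i , λ e → i^k≢1 (≋⇒∣ e)
  ... | no none = ⊥-elim (p∤1 (≋0⇒∣ (≋-trans (≋-sym p-1≋-1) (-‿cong-≋ (≋-trans (≋-sym (sum≋p-1 p refl)) (powerSum≋0 (_^ k) (suc k) (degree-x^k k) k<p)))))) 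
    where
    power≋1 : ∀ m → 0 ℕ.< m → m ℕ.< p → (+ m) ^ k ≋ + 1
    power≋1 m 0<m m<p with + p ∣? (+ m) ^ k - + 1
    ... | yes d = ∣⇒≋ d
    ... | no ¬d = ⊥-elim (none (fromℕ< m<p , subst (λ j → ¬ (+ p ∣ + j)) (sym (Finₚ.toℕ-fromℕ< m<p)) (λ d → ℕₚ.<-irrefl (sym (∣⇒<p⇒≡0 m m<p d)) 0<m)
                               , subst (λ j → ¬ (+ p ∣ (+ j) ^ k - + 1)) (sym (Finₚ.toℕ-fromℕ< m<p)) ¬d))
    partial : ∀ m → m ℕ.< p → partialSum (_^ k) (suc m) ≋ + m
    partial zero _ = ≡⇒≋ (trans (ℤₚ.+-identityˡ _) (0^k k 0<k))
    partial (suc m) m<p = ≋-trans (+-cong-≋ (partial m (ℕₚ.<-trans (ℕₚ.n<1+n m) m<p)) (power≋1 (suc m) (ℕ.s≤s ℕ.z≤n) m<p)) (≡⇒≋ (cong +_ (ℕₚ.+-comm m 1)))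
    sum≋p-1 : ∀ p′ → p ≡ p′ → partialSum (_^ k) p ≋ + p - + 1
    sum≋p-1 zero e = ⊥-elim (ℕ.≢-nonZero⁻¹ p {{prime⇒nonZero pr}} e)
    sum≋p-1 (suc m) e = ≋-trans (≡⇒≋ (cong (partialSum (_^ k)) e)) (≋-trans (partial m (subst (m ℕ.<_) (sym e) (ℕₚ.n<1+n m))) (≡⇒≋ (cong (λ n → + n - + 1) (sym e))))
    p-1≋-1 : - (+ p - + 1) ≋ + 1
    p-1≋-1 = ∣⇒≋ (divides (- + 1) (l (+ p)))
      where
      l : ∀ p → - (p - + 1) - + 1 ≡ - + 1 * p
      l = ℤSolver.solve-∀

  0<k : ∀ k → p ≡ 1 ℕ.+ 3 ℕ.* k → 0 ℕ.< k
  0<k zero e = ⊥-elim (p∤1 (divides (+ 1) (subst (λ n → + 1 ≡ + 1 * + n) (sym e) refl)))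
  0<k (suc k) _ = ℕ.s≤s ℕ.z≤n

  1+k<p : ∀ k → p ≡ 1 ℕ.+ 3 ℕ.* k → suc k ℕ.< p
  1+k<p k e = subst (suc k ℕ.<_) (sym e) (ℕ.s≤s (ℕₚ.m<m+n k (ℕₚ.<-≤-trans (0<k k e) (ℕₚ.m≤n*m k 2))))

  -- h is c^k for a c with c^k not congruent to 1. Its cube is c^(p-1) ≡ 1, so h is a root of the
  -- other factor of x³ - 1.
  cubeRoot : ∀ k → p ≡ 1 ℕ.+ 3 ℕ.* k → ∃ λ h → + p ∣ h * h + h + + 1
  cubeRoot k e = root (nonresidue k (0<k k e) (1+k<p k e))
    where
    l : ∀ x → x * (x * (x * + 1)) - + 1 ≡ (x - + 1) * (x * x + x + + 1)
    l = ℤSolver.solve-∀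
    root : (∃ λ c → ¬ (+ p ∣ c) × ¬ (c ^ k ≋ + 1)) → ∃ λ h → + p ∣ h * h + h + + 1
    root (c , p∤c , c^k≢1) = c ^ k , [ (λ d → ⊥-elim (c^k≢1 (∣⇒≋ d))) , (λ d → d) ]′
      (euclid (c ^ k - + 1) _ (subst (+ p ∣_) (l (c ^ k)) (≋⇒∣ (≋-trans (≡⇒≋ (trans (ℤₚ.^-*-assoc c k 3) (cong (c ^_) (ℕₚ.*-comm k 3)))) (fermat-unit c p∤c e)))))

-- Cubic characters

opaque
  unfolding _⊞_ ⊟_ _⊠_ conj

  re-⊞ : ∀ α β → re (α ⊞ β) ≡ re α + re β
  re-⊞ α β = refl

  im-⊞ : ∀ α β → im (α ⊞ β) ≡ im α + im β
  im-⊞ α β = refl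

  re-⊟ : ∀ α → re (⊟ α) ≡ - re α
  re-⊟ α = refl

  im-⊟ : ∀ α → im (⊟ α) ≡ - im α
  im-⊟ α = refl

  re-⊠ : ∀ α β → re (α ⊠ β) ≡ re α * re β - im α * im β
  re-⊠ α β = refl

  im-⊠ : ∀ α β → im (α ⊠ β) ≡ re α * im β + im α * re β - im α * im β
  im-⊠ α β = refl

  re-conj : ∀ α → re (conj α) ≡ re α - im α
  re-conj α = refl

  im-conj : ∀ α → im (conj α) ≡ - im α
  im-conj α = refl

⟦⟧-unit : ∀ x → ⟦ x ⟧ ⊠ conj ⟦ x ⟧ ≡ 1ω
⟦⟧-unit x = trans (cong (⟦ x ⟧ ⊠_) (⟦⟧-conj x)) (trans (sym (⟦⟧-∙ x (x ⁻¹))) (cong ⟦_⟧ (inverseʳ x)))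
  where
  inverseʳ : ∀ x → x ∙ x ⁻¹ ≡ 𝟙
  inverseʳ 𝟙 = refl
  inverseʳ ζ = refl
  inverseʳ ζ² = refl

∙-cancelˡ : ∀ x {y z} → x ∙ y ≡ x ∙ z → y ≡ z
∙-cancelˡ x {y} {z} e = trans (sym (unit y)) (trans (cong (λ w → (x ∙ x) ∙ w) e) (unit z))
  where
  unit : ∀ y → (x ∙ x) ∙ (x ∙ y) ≡ y
  unit y = trans (sym (∙-assoc (x ∙ x) x y)) (cong (_∙ y) (trans (∙-comm (x ∙ x) x) (cube≡𝟙 x)))

-- Reduction Z[ω] → ℤ/p along ω ↦ h, for a primitive cube root of unity h modulo p.
module Evaluation {p : ℕ} (pr : Prime p) (h : ℤ) (root : + p ∣ h * h + h + + 1) (p∤3 : ¬ (+ p ∣ + 3)) where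
  open ℤmod (+ p)
  open PrimeMod pr
  private module ω = Zωmodℤ (+ p)

  ev : Zω → ℤ
  ev α = re α + h * im α

  ev-⊞ : ∀ α β → ev (α ⊞ β) ≡ ev α + ev β
  ev-⊞ α β = trans (cong₂ (λ a b → a + h * b) (re-⊞ α β) (im-⊞ α β)) (l (re α) (im α) (re β) (im β) h)
    where
    l : ∀ a b c d h → a + c + h * (b + d) ≡ a + h * b + (c + h * d)
    l = ℤSolver.solve-∀

  ev-⊠ : ∀ α β → ev (α ⊠ β) ≋ ev α * ev β
  ev-⊠ α β = ≋-sym (≋-trans (∣⇒≋ (∣-trans root (divides (im α * im β) (l (re α) (im α) (re β) (im β) h))))
    (≡⇒≋ (sym (cong₂ (λ a b → a + h * b) (re-⊠ α β) (im-⊠ α β)))))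
    where
    l : ∀ a b c d h → (a + h * b) * (c + h * d) - (a * c - b * d + h * (a * d + b * c - b * d)) ≡ b * d * (h * h + h + + 1)
    l = ℤSolver.solve-∀

  ev-fromℤ : ∀ m → ev (fromℤ m) ≡ m
  ev-fromℤ m = trans (cong (λ x → m + x) (ℤₚ.*-zeroʳ h)) (ℤₚ.+-identityʳ m)

  ev-↑ : ∀ α n → ev (α ↑ n) ≋ ev α ^ n
  ev-↑ α zero = ≡⇒≋ (trans (cong ev (↑-zero α)) (ev-fromℤ (+ 1)))
  ev-↑ α (suc n) = ≋-trans (≡⇒≋ (cong ev (↑-suc α n))) (≋-trans (ev-⊠ α (α ↑ n)) (*-congˡ-≋ (ev α) (ev-↑ α n)))

  ev-cong : ∀ {α β} → α ω.≋ β → ev α ≋ ev β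
  ev-cong e = +-cong-≋ (ω.≋⇒≋-re e) (*-congˡ-≋ h (ω.≋⇒≋-im e))

  ∤1+2h : ¬ (+ p ∣ + 1 + + 2 * h)
  ∤1+2h d = p∤3 (subst (+ p ∣_) (l h) (∣m∣n⇒∣m-n (∣n⇒∣m*n (+ 4) root) (∣m⇒∣m*n (+ 1 + + 2 * h) d)))
    where
    l : ∀ h → + 4 * (h * h + h + + 1) - (+ 1 + + 2 * h) * (+ 1 + + 2 * h) ≡ + 3
    l = ℤSolver.solve-∀

  -- `ev` and `ev` after conjugation are the reductions at the two places above p. They differ by (1
  -- + 2h) im(α), where 1 + 2h is a square root of -3 and hence a unit.
  ev≋0⇒≋0 : ∀ α → ev α ≋ + 0 → ev (conj α) ≋ + 0 → α ω.≋ 0ω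
  ev≋0⇒≋0 α e ē = ω.components a≋0 b≋0
    where
    b≋0 : im α ≋ + 0
    b≋0 = [ (λ d → ⊥-elim (∤1+2h d)) , ∣⇒≋0 ]′ (euclid (+ 1 + + 2 * h) (im α)
      (subst (+ p ∣_) (trans (cong₂ (λ a b → ev α - (a + h * b)) (re-conj α) (im-conj α)) (l (re α) (im α) h)) (∣m∣n⇒∣m-n (≋0⇒∣ e) (≋0⇒∣ ē))))
      where
      l : ∀ a b h → a + h * b - (a - b + h * - b) ≡ (+ 1 + + 2 * h) * b
      l = ℤSolver.solve-∀
    a≋0 : re α ≋ + 0
    a≋0 = ∣⇒≋0 (subst (+ p ∣_) (l (re α) (h * im α)) (∣m∣n⇒∣m-n (≋0⇒∣ e) (∣n⇒∣m*n h (≋0⇒∣ b≋0))))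
      where
      l : ∀ a b → a + b - b ≡ a
      l = ℤSolver.solve-∀

  p∤1-h : ¬ (+ p ∣ + 1 - h)
  p∤1-h d = p∤3 (subst (+ p ∣_) (l h) (∣m∣n⇒∣m+n root (∣m⇒∣m*n (h + + 2) d)))
    where
    l : ∀ h → h * h + h + + 1 + (+ 1 - h) * (h + + 2) ≡ + 3
    l = ℤSolver.solve-∀

  p∤2+h : ¬ (+ p ∣ + 2 + h)
  p∤2+h d = p∤3 (subst (+ p ∣_) (l h) (∣m∣n⇒∣m-n root (∣m⇒∣m*n (h - + 1) d)))
    where
    l : ∀ h → h * h + h + + 1 - (+ 2 + h) * (h - + 1) ≡ + 3
    l = ℤSolver.solve-∀

  private
    l₁ : ∀ h → + 1 + h * + 0 - (+ 0 + h * + 1) ≡ + 1 - h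
    l₁ = ℤSolver.solve-∀
    l₂ : ∀ h → + 1 + h * + 0 - (- + 1 + h * - + 1) ≡ + 2 + h
    l₂ = ℤSolver.solve-∀
    l₃ : ∀ h → + 0 + h * + 1 - (- + 1 + h * - + 1) ≡ + 1 + + 2 * h
    l₃ = ℤSolver.solve-∀

  ev⟦⟧-injective : ∀ {x y} → ev ⟦ x ⟧ ≋ ev ⟦ y ⟧ → x ≡ y
  ev⟦⟧-injective {𝟙} {𝟙} e = refl
  ev⟦⟧-injective {𝟙} {ζ} e = ⊥-elim (p∤1-h (subst (+ p ∣_) (l₁ h) (≋⇒∣ e)))
  ev⟦⟧-injective {𝟙} {ζ²} e = ⊥-elim (p∤2+h (subst (+ p ∣_) (l₂ h) (≋⇒∣ e)))
  ev⟦⟧-injective {ζ} {𝟙} e = ⊥-elim (p∤1-h (subst (+ p ∣_) (l₁ h) (≋⇒∣ (≋-sym e))))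
  ev⟦⟧-injective {ζ} {ζ} e = refl
  ev⟦⟧-injective {ζ} {ζ²} e = ⊥-elim (∤1+2h (subst (+ p ∣_) (l₃ h) (≋⇒∣ e)))
  ev⟦⟧-injective {ζ²} {𝟙} e = ⊥-elim (p∤2+h (subst (+ p ∣_) (l₂ h) (≋⇒∣ (≋-sym e))))
  ev⟦⟧-injective {ζ²} {ζ} e = ⊥-elim (∤1+2h (subst (+ p ∣_) (l₃ h) (≋⇒∣ (≋-sym e))))
  ev⟦⟧-injective {ζ²} {ζ²} e = refl

  module Character (k : ℕ) (p≡1+3k : p ≡ 1 ℕ.+ 3 ℕ.* k) where

    -- The logarithm of a^((p-1)/3) to the base h. Multiples of p fall into the last clause; `χ`
    -- replaces the value there by 0.
    index : ℤ → μ₃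
    index a with + p ∣? a ^ k - ev 1ω | + p ∣? a ^ k - ev ω
    ... | yes _ | _ = 𝟙
    ... | no _ | yes _ = ζ
    ... | no _ | no _ = ζ²

    power-cases : ∀ a → ¬ (+ p ∣ a) → ¬ (+ p ∣ a ^ k - ev 1ω) → ¬ (+ p ∣ a ^ k - ev ω) → + p ∣ a ^ k - ev ω²
    power-cases a p∤a ≢1 ≢h = [ (λ d → ⊥-elim (≢1 (subst (λ o → + p ∣ a ^ k - o) (sym (ev-fromℤ (+ 1))) d)))
      , (λ d → [ (λ d′ → ⊥-elim (≢h (subst (λ o → + p ∣ a ^ k - o) (sym (l₄ h)) d′))) , subst (+ p ∣_) (l₅ (a ^ k) h) ]′ (euclid (a ^ k - h) (a ^ k + + 1 + h)
            (subst (+ p ∣_) (l₆ (a ^ k) h) (∣m∣n⇒∣m-n d root)))) ]′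
      (euclid (a ^ k - + 1) (a ^ k * a ^ k + a ^ k + + 1) (subst (+ p ∣_) (l₇ (a ^ k)) (≋⇒∣ x³≋1)))
      where
      x³≋1 : (a ^ k) ^ 3 ≋ + 1
      x³≋1 = ≋-trans (≡⇒≋ (trans (ℤₚ.^-*-assoc a k 3) (cong (a ^_) (ℕₚ.*-comm k 3)))) (fermat-unit a p∤a p≡1+3k)
      l₄ : ∀ h → + 0 + h * + 1 ≡ h
      l₄ = ℤSolver.solve-∀
      l₅ : ∀ x h → x + + 1 + h ≡ x - (- + 1 + h * - + 1)
      l₅ = ℤSolver.solve-∀
      l₆ : ∀ x h → x * x + x + + 1 - (h * h + h + + 1) ≡ (x - h) * (x + + 1 + h)
      l₆ = ℤSolver.solve-∀
      l₇ : ∀ x → x * (x * (x * + 1)) - + 1 ≡ (x - + 1) * (x * x + x + + 1)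
      l₇ = ℤSolver.solve-∀

    index-spec : ∀ a → ¬ (+ p ∣ a) → a ^ k ≋ ev ⟦ index a ⟧
    index-spec a p∤a with + p ∣? a ^ k - ev 1ω | + p ∣? a ^ k - ev ω
    ... | yes d | _ = ∣⇒≋ d
    ... | no _ | yes d = ∣⇒≋ d
    ... | no ¬d | no ¬d′ = ∣⇒≋ (power-cases a p∤a ¬d ¬d′)

    index-unique : ∀ a {x} → ¬ (+ p ∣ a) → a ^ k ≋ ev ⟦ x ⟧ → index a ≡ x
    index-unique a p∤a e = ev⟦⟧-injective (≋-trans (≋-sym (index-spec a p∤a)) e)

    index-* : ∀ a b → ¬ (+ p ∣ a) → ¬ (+ p ∣ b) → index (a * b) ≡ index a ∙ index b
    index-* a b p∤a p∤b = index-unique (a * b) (∤-* p∤a p∤b)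
      (≋-trans (≡⇒≋ (^-distribʳ-* a b k)) (≋-trans (*-cong-≋ (index-spec a p∤a) (index-spec b p∤b))
        (≋-trans (≋-sym (ev-⊠ ⟦ index a ⟧ ⟦ index b ⟧)) (≡⇒≋ (cong ev (sym (⟦⟧-∙ (index a) (index b))))))))

    index-cong : ∀ {a b} → ¬ (+ p ∣ a) → a ≋ b → index a ≡ index b
    index-cong {a} {b} p∤a e = index-unique a p∤a (≋-trans (^-cong-≋ k e) (index-spec b λ d → p∤a (∣-resp-≋ (≋-sym e) d)))

    opaque
      χ : ℤ → Zω
      χ a with + p ∣? a
      ... | yes _ = 0ω
      ... | no _ = ⟦ index a ⟧

      χ-0 : ∀ {a} → + p ∣ a → χ a ≡ 0ω
      χ-0 {a} d with + p ∣? a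
      ... | yes _ = refl
      ... | no ¬d = ⊥-elim (¬d d)

      χ-unit : ∀ {a} → ¬ (+ p ∣ a) → χ a ≡ ⟦ index a ⟧
      χ-unit {a} p∤a with + p ∣? a
      ... | yes d = ⊥-elim (p∤a d)
      ... | no _ = refl

    χ-* : ∀ a b → χ (a * b) ≡ χ a ⊠ χ b
    χ-* a b with + p ∣? a | + p ∣? b
    ... | yes d | _ = trans (χ-0 (∣m⇒∣m*n b d)) (sym (trans (cong (_⊠ χ b) (χ-0 d)) (⊠-zeroˡ (χ b))))
    ... | no _ | yes d = trans (χ-0 (∣n⇒∣m*n a d)) (sym (trans (cong (χ a ⊠_) (χ-0 d)) (⊠-zeroʳ (χ a))))
    ... | no p∤a | no p∤b = trans (χ-unit (∤-* p∤a p∤b)) (trans (cong ⟦_⟧ (index-* a b p∤a p∤b))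
      (trans (⟦⟧-∙ (index a) (index b)) (sym (cong₂ _⊠_ (χ-unit p∤a) (χ-unit p∤b)))))

    χ-cong : ∀ {a b} → a ≋ b → χ a ≡ χ b
    χ-cong {a} {b} e with + p ∣? a
    ... | yes d = trans (χ-0 d) (sym (χ-0 (∣-resp-≋ e d)))
    ... | no p∤a = trans (χ-unit p∤a) (trans (cong ⟦_⟧ (index-cong p∤a e)) (sym (χ-unit λ d → p∤a (∣-resp-≋ (≋-sym e) d))))

    χ⊠χ̄ : ∀ {a} → ¬ (+ p ∣ a) → χ a ⊠ conj (χ a) ≡ 1ω
    χ⊠χ̄ {a} p∤a = trans (cong (λ x → x ⊠ conj x) (χ-unit p∤a)) (⟦⟧-unit (index a))

    χ² : ∀ a → χ a ⊠ χ a ≡ conj (χ a)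
    χ² a with + p ∣? a
    ... | yes d = trans (cong (λ x → x ⊠ x) (χ-0 d)) (trans (⊠-zeroˡ 0ω) (sym (trans (cong conj (χ-0 d)) (conj-fromℤ (+ 0)))))
    ... | no p∤a = trans (cong (λ x → x ⊠ x) (χ-unit p∤a)) (trans (square (index a)) (sym (cong conj (χ-unit p∤a))))
      where
      square : ∀ x → ⟦ x ⟧ ⊠ ⟦ x ⟧ ≡ conj ⟦ x ⟧
      square x = trans (sym (⟦⟧-∙ x x)) (trans (cong ⟦_⟧ (square≡⁻¹ x)) (sym (⟦⟧-conj x)))

    p∤-1 : ¬ (+ p ∣ - + 1)
    p∤-1 d = p∤1 (∣m⇒∣-m d)

    index-1 : index (+ 1) ≡ 𝟙
    index-1 = index-unique (+ 1) p∤1 (≡⇒≋ (trans (ℤₚ.^-zeroˡ k) (sym (ev-fromℤ (+ 1)))))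

    index-neg : ∀ a → ¬ (+ p ∣ a) → index (- a) ≡ index a
    index-neg a p∤a = trans (cong index (sym (ℤₚ.-1*i≡-i a))) (trans (index-* (- + 1) a p∤-1 p∤a) (cong (_∙ index a) index-neg1))
      where
      index-neg1 : index (- + 1) ≡ 𝟙
      index-neg1 = square≡𝟙⇒≡𝟙 _ (trans (sym (index-* (- + 1) (- + 1) p∤-1 p∤-1)) index-1)

    χ-1 : χ (+ 1) ≡ 1ω
    χ-1 = trans (χ-unit p∤1) (cong ⟦_⟧ index-1)

    χ-neg : ∀ a → χ (- a) ≡ χ a
    χ-neg a with + p ∣? a
    ... | yes d = trans (χ-0 (∣m⇒∣-m d)) (sym (χ-0 d))
    ... | no p∤a = trans (χ-unit λ d → p∤a (subst (+ p ∣_) (ℤₚ.neg-involutive a) (∣m⇒∣-m d))) (trans (cong ⟦_⟧ (index-neg a p∤a)) (sym (χ-unit p∤a)))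

    ev-χ : ∀ a → ev (χ a) ≋ a ^ k
    ev-χ a with + p ∣? a
    ... | yes d = ≋-trans (≡⇒≋ (trans (cong ev (χ-0 d)) (ev-fromℤ (+ 0)))) (≋-sym (≋-trans (^-cong-≋ k (∣⇒≋0 d)) (≡⇒≋ (PowerSums.0^k pr k (PowerSums.0<k pr k p≡1+3k)))))
    ... | no p∤a = ≋-trans (≡⇒≋ (cong ev (χ-unit p∤a))) (≋-sym (index-spec a p∤a))

    nontrivial : ∃ λ c → ¬ (+ p ∣ c) × ¬ (index c ≡ 𝟙)
    nontrivial = found (PowerSums.nonresidue pr k (PowerSums.0<k pr k p≡1+3k) (PowerSums.1+k<p pr k p≡1+3k))
      where
      found : (∃ λ c → ¬ (+ p ∣ c) × ¬ (c ^ k ≋ + 1)) → ∃ λ c → ¬ (+ p ∣ c) × ¬ (index c ≡ 𝟙)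
      found (c , p∤c , c^k≢1) = c , p∤c , λ e → c^k≢1 (≋-trans (index-spec c p∤c) (≡⇒≋ (trans (cong (λ x → ev ⟦ x ⟧) e) (ev-fromℤ (+ 1)))))

-- Jacobi sums

⊠-interchange : ∀ α β γ δ → (α ⊠ β) ⊠ (γ ⊠ δ) ≡ (α ⊠ γ) ⊠ (β ⊠ δ)
⊠-interchange = Algebra.Properties.CommutativeSemigroup.interchange (CommutativeRing.*-commutativeSemigroup Zω-commutativeRing)

⊠-swapˡ : ∀ α β γ → α ⊠ (β ⊠ γ) ≡ β ⊠ (α ⊠ γ)
⊠-swapˡ = Algebra.Properties.CommutativeSemigroup.x∙yz≈y∙xz (CommutativeRing.*-commutativeSemigroup Zω-commutativeRing)

fromℤ-cancel : ∀ m {α} → m ≢ + 0 → fromℤ m ⊠ α ≡ 0ω → α ≡ 0ω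
fromℤ-cancel m {α} m≢0 e = cong₂ _+ω_ω (zero-factor (re α) (cong re e′)) (zero-factor (im α) (cong im e′))
  where
  e′ : (m * re α) +ω (m * im α) ω ≡ 0ω
  e′ = trans (sym (fromℤ-⊠ m α)) e
  zero-factor : ∀ a → m * a ≡ + 0 → a ≡ + 0
  zero-factor a ma≡0 = [ (λ m≡0 → ⊥-elim (m≢0 m≡0)) , (λ a≡0 → a≡0) ]′ (ℤₚ.i*j≡0⇒i≡0∨j≡0 m ma≡0)

-- 1 - ω has norm 3, so the two coordinates of (1 - ω)s = 0 combine to 3s = 0. The case of ω²
-- follows on multiplying by ω.
⟦⟧-fixed⇒0 : ∀ x s → x ≢ 𝟙 → ⟦ x ⟧ ⊠ s ≡ s → s ≡ 0ω
⟦⟧-fixed⇒0 𝟙 s x≢𝟙 _ = ⊥-elim (x≢𝟙 refl)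
⟦⟧-fixed⇒0 ζ s _ e = fromℤ-cancel (+ 3) (λ ()) (trans (fromℤ-⊠ (+ 3) s) (cong₂ _+ω_ω 3a≡0 3b≡0))
  where
  a = re s
  b = im s
  e₁ : + 0 * a - + 1 * b ≡ a
  e₁ = trans (sym (re-⊠ ω s)) (cong re e)
  e₂ : + 0 * b + + 1 * a - + 1 * b ≡ b
  e₂ = trans (sym (im-⊠ ω s)) (cong im e)
  l₁ : ∀ a b → + 3 * a ≡ + 2 * (a - (+ 0 * a - + 1 * b)) - (b - (+ 0 * b + + 1 * a - + 1 * b))
  l₁ = ℤSolver.solve-∀
  l₂ : ∀ a b → + 3 * b ≡ (a - (+ 0 * a - + 1 * b)) + (b - (+ 0 * b + + 1 * a - + 1 * b))
  l₂ = ℤSolver.solve-∀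
  3a≡0 : + 3 * a ≡ + 0
  3a≡0 = trans (l₁ a b) (cong₂ (λ u v → + 2 * u - v) (trans (cong (λ u → a - u) e₁) (ℤₚ.i≡j⇒i-j≡0 {a} refl)) (trans (cong (λ u → b - u) e₂) (ℤₚ.i≡j⇒i-j≡0 {b} refl)))
  3b≡0 : + 3 * b ≡ + 0
  3b≡0 = trans (l₂ a b) (cong₂ _+_ (trans (cong (λ u → a - u) e₁) (ℤₚ.i≡j⇒i-j≡0 {a} refl)) (trans (cong (λ u → b - u) e₂) (ℤₚ.i≡j⇒i-j≡0 {b} refl)))
⟦⟧-fixed⇒0 ζ² s _ e = ⟦⟧-fixed⇒0 ζ s (λ ()) (sym (trans (sym (trans (sym (⊠-assoc ω ω² s)) (trans (cong (_⊠ s) (sym (⟦⟧-∙ ζ ζ²))) (⊠-identityˡ s)))) (cong (ω ⊠_) e)))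

⟦⟧↑3 : ∀ x n → ⟦ x ⟧ ↑ (3 ℕ.* n) ≡ 1ω
⟦⟧↑3 x n = trans (sym (↑-assocʳ ⟦ x ⟧ 3 n)) (trans (cong (_↑ n) cube) (1ω↑ n))
  where
  cube : ⟦ x ⟧ ↑ 3 ≡ 1ω
  cube = trans (↑3 ⟦ x ⟧) (trans (cong (λ α → ⟦ x ⟧ ⊠ (⟦ x ⟧ ⊠ α)) (⊠-identityʳ ⟦ x ⟧))
    (trans (cong (⟦ x ⟧ ⊠_) (sym (⟦⟧-∙ x x))) (trans (sym (⟦⟧-∙ x (x ∙ x))) (cong ⟦_⟧ (cube≡𝟙 x)))))

⟦⟧↑[1+3n] : ∀ x n → ⟦ x ⟧ ↑ (1 ℕ.+ 3 ℕ.* n) ≡ ⟦ x ⟧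
⟦⟧↑[1+3n] x n = trans (↑-suc ⟦ x ⟧ (3 ℕ.* n)) (trans (cong (⟦ x ⟧ ⊠_) (⟦⟧↑3 x n)) (⊠-identityʳ ⟦ x ⟧))

⟦⟧↑[2+3n] : ∀ x n → ⟦ x ⟧ ↑ (2 ℕ.+ 3 ℕ.* n) ≡ ⟦ x ∙ x ⟧
⟦⟧↑[2+3n] x n = trans (↑-suc ⟦ x ⟧ (1 ℕ.+ 3 ℕ.* n)) (trans (cong (⟦ x ⟧ ⊠_) (⟦⟧↑[1+3n] x n)) (sym (⟦⟧-∙ x x)))

module PeriodicSum {p : ℕ} (pr : Prime p) where
  open ℤmod (+ p)
  open PrimeMod pr
  private module Σ = Algebra.Properties.Semiring.Sum (CommutativeRing.semiring Zω-commutativeRing)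

  Periodic : (ℤ → Zω) → Set
  Periodic f = ∀ {a b} → a ≋ b → f a ≡ f b

  S[_] : ℕ → (ℤ → Zω) → Zω
  S[ n ] f = Σ.sum {n} (λ i → f (+ toℕ i))

  S : (ℤ → Zω) → Zω
  S = S[ p ]

  private
    sum-ext : ∀ n {u v : Fin n → Zω} → (∀ i → u i ≡ v i) → Σ.sum u ≡ Σ.sum v
    sum-ext n = Σ.sum-cong-≗ {n}

  S-cong : ∀ {f g} → (∀ a → f a ≡ g a) → S f ≡ S g
  S-cong e = sum-ext p λ i → e (+ toℕ i)

  S-⊞ : ∀ f g → S (λ a → f a ⊞ g a) ≡ S f ⊞ S g
  S-⊞ f g = Σ.∑-distrib-+ {p} (λ i → f (+ toℕ i)) (λ i → g (+ toℕ i))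

  S-⊠ : ∀ α f → S (λ a → α ⊠ f a) ≡ α ⊠ S f
  S-⊠ α f = sym (Σ.*-distribˡ-sum {p} α (λ i → f (+ toℕ i)))

  S-comm : ∀ (f : ℤ → ℤ → Zω) → S (λ a → S (f a)) ≡ S (λ b → S (λ a → f a b))
  S-comm f = Σ.∑-comm {p} {p} (λ i j → f (+ toℕ i) (+ toℕ j))

  S[suc] : ∀ n f → S[ suc n ] f ≡ S[ n ] f ⊞ f (+ n)
  S[suc] n f = trans (Σ.sum-init-last {n} (λ i → f (+ toℕ i)))
    (cong₂ _⊞_ (sum-ext n λ i → cong (λ m → f (+ m)) (Finₚ.toℕ-inject₁ i)) (cong (λ m → f (+ m)) (Finₚ.toℕ-fromℕ n)))

  S-const : ∀ α → S (λ _ → α) ≡ fromℤ (+ p) ⊠ α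
  S-const α = go p
    where
    go : ∀ n → S[ n ] (λ _ → α) ≡ fromℤ (+ n) ⊠ α
    go zero = sym (⊠-zeroˡ α)
    go (suc n) = trans (cong₂ _⊞_ (sym (⊠-identityˡ α)) (go n)) (trans (sym (⊠-distribʳ-⊞ α 1ω (fromℤ (+ n)))) (cong (_⊠ α) (sym (fromℤ-+ (+ 1) (+ n)))))

  S-conj : ∀ f → S (λ a → conj (f a)) ≡ conj (S f)
  S-conj f = go p
    where
    go : ∀ n → S[ n ] (λ a → conj (f a)) ≡ conj (S[ n ] f)
    go zero = sym (conj-fromℤ (+ 0))
    go (suc n) = trans (S[suc] n (λ a → conj (f a))) (trans (cong (_⊞ conj (f (+ n))) (go n)) (trans (sym (conj-⊞ _ _)) (cong conj (sym (S[suc] n f)))))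

  S-swap : ∀ (u v : ℤ → Zω) (w : ℤ → ℤ → Zω) → S (λ a → u a ⊠ S (λ b → v b ⊠ w a b)) ≡ S (λ b → v b ⊠ S (λ a → u a ⊠ w a b))
  S-swap u v w = trans (S-cong λ a → sym (S-⊠ (u a) (λ b → v b ⊠ w a b)))
    (trans (S-comm (λ a b → u a ⊠ (v b ⊠ w a b)))
      (S-cong λ b → trans (S-cong λ a → ⊠-swapˡ (u a) (v b) (w a b)) (S-⊠ (v b) (λ a → u a ⊠ w a b))))

  private
    ≥⇒≡ : ∀ {m n} → m ℕ.< p → n ℕ.≤ m → + m ≋ + n → m ≡ n
    ≥⇒≡ {m} {n} m<p n≤m e = ℕₚ.≤-antisym (ℕₚ.m∸n≡0⇒m≤n (PowerSums.∣⇒<p⇒≡0 pr (m ℕ.∸ n) (ℕₚ.≤-<-trans (ℕₚ.m∸n≤m m n) m<p)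
      (subst (+ p ∣_) (trans (ℤₚ.m-n≡m⊖n m n) (ℤₚ.⊖-≥ n≤m)) (≋⇒∣ e)))) n≤m

  residue-unique : ∀ {m n} → m ℕ.< p → n ℕ.< p → + m ≋ + n → m ≡ n
  residue-unique {m} {n} m<p n<p e = [ (λ m≤n → sym (≥⇒≡ n<p m≤n (≋-sym e))) , (λ n≤m → ≥⇒≡ m<p n≤m e) ]′ (ℕₚ.≤-total m n)

  -- σ and τ need to be inverse only modulo p: their reductions form a permutation of `Fin p`.
  S-reindex : ∀ (σ τ : ℤ → ℤ) → (∀ {a b} → a ≋ b → σ a ≋ σ b) → (∀ {a b} → a ≋ b → τ a ≋ τ b) →
    (∀ a → σ (τ a) ≋ a) → (∀ a → τ (σ a) ≋ a) → ∀ f → Periodic f → S (λ a → f (σ a)) ≡ S f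
  S-reindex σ τ σ-cong τ-cong στ τσ f periodic = sym (trans (Σ.sum-permute {p} {p} (λ i → f (+ toℕ i)) π) (sum-ext p λ i → periodic (lift-≋ σ i)))
    where
    lift : (ℤ → ℤ) → Fin p → Fin p
    lift σ i = fromℕ< (residue<p (σ (+ toℕ i)))
    lift-≋ : ∀ σ i → + toℕ (lift σ i) ≋ σ (+ toℕ i)
    lift-≋ σ i = ≋-trans (≡⇒≋ (cong +_ (Finₚ.toℕ-fromℕ< (residue<p (σ (+ toℕ i)))))) (≋-sym (≋-residue (σ (+ toℕ i))))
    inv : ∀ σ τ → (∀ {a b} → a ≋ b → σ a ≋ σ b) → (∀ a → σ (τ a) ≋ a) → ∀ i → lift σ (lift τ i) ≡ i
    inv σ τ σ-cong στ i = Finₚ.toℕ-injective (residue-unique (Finₚ.toℕ<n _) (Finₚ.toℕ<n i)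
      (≋-trans (lift-≋ σ (lift τ i)) (≋-trans (σ-cong (lift-≋ τ i)) (στ (+ toℕ i)))))
    π : Perm.Permutation p p
    π = Perm.permutation (lift σ) (lift τ) (inv σ τ σ-cong στ) (inv τ σ τ-cong τσ)

  S-scale : ∀ x → ¬ (+ p ∣ x) → ∀ f → Periodic f → S (λ a → f (x * a)) ≡ S f
  S-scale x p∤x = S-reindex (x *_) (y *_) (*-congˡ-≋ x) (*-congˡ-≋ y)
    (λ a → ≋-trans (≡⇒≋ (sym (ℤₚ.*-assoc x y a))) (unit xy≋1 a))
    (λ a → ≋-trans (≡⇒≋ (sym (ℤₚ.*-assoc y x a))) (unit (≋-trans (≡⇒≋ (ℤₚ.*-comm y x)) xy≋1) a))
    where
    y = proj₁ (inverse x p∤x)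
    xy≋1 = proj₂ (inverse x p∤x)
    unit : ∀ {z} → z ≋ + 1 → ∀ a → z * a ≋ a
    unit e a = ≋-trans (*-congʳ-≋ a e) (≡⇒≋ (ℤₚ.*-identityˡ a))

  S-shift : ∀ c f → Periodic f → S (λ a → f (c + a)) ≡ S f
  S-shift c = S-reindex (λ a → c + a) (λ a → - c + a) (+-cong-≋ (≋-refl {c})) (+-cong-≋ (≋-refl { - c})) (λ a → ≡⇒≋ (l c a)) (λ a → ≡⇒≋ (l′ c a))
    where
    l : ∀ c a → c + (- c + a) ≡ a
    l = ℤSolver.solve-∀
    l′ : ∀ c a → - c + (c + a) ≡ a
    l′ = ℤSolver.solve-∀

  opaque
    -- The indicator of the multiples of p. An element of the group ring of ℤ/p is recovered from
    -- its action on this function.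
    δ : ℤ → Zω
    δ a with + p ∣? a
    ... | yes _ = 1ω
    ... | no _ = 0ω

    δ-1 : ∀ {a} → + p ∣ a → δ a ≡ 1ω
    δ-1 {a} d with + p ∣? a
    ... | yes _ = refl
    ... | no ¬d = ⊥-elim (¬d d)

    δ-0 : ∀ {a} → ¬ (+ p ∣ a) → δ a ≡ 0ω
    δ-0 {a} p∤a with + p ∣? a
    ... | yes d = ⊥-elim (p∤a d)
    ... | no _ = refl

  δ-cong : ∀ {a b} → (+ p ∣ a → + p ∣ b) → (+ p ∣ b → + p ∣ a) → δ a ≡ δ b
  δ-cong {a} f g with + p ∣? a
  ... | yes d = trans (δ-1 d) (sym (δ-1 (f d)))
  ... | no ¬d = trans (δ-0 ¬d) (sym (δ-0 λ d → ¬d (g d)))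

  δ-periodic : Periodic δ
  δ-periodic e = δ-cong (∣-resp-≋ e) (∣-resp-≋ (≋-sym e))

  S-δ : ∀ f → Periodic f → ∀ c → S (λ a → f a ⊠ δ (a - c)) ≡ f c
  S-δ f periodic c = trans (sym (S-shift c _ F-periodic)) (trans (S-cong λ a → cong (λ b → f (c + a) ⊠ δ b) (l c a)) (go p refl))
    where
    F-periodic : Periodic (λ a → f a ⊠ δ (a - c))
    F-periodic e = cong₂ _⊠_ (periodic e) (δ-periodic (+-cong-≋ e ≋-refl))
    l : ∀ c a → c + a - c ≡ a
    l = ℤSolver.solve-∀
    tail≡0 : ∀ n → n ℕ.≤ p → ∀ {m} → n ≡ suc m → Σ.sum {m} (λ i → f (c + + suc (toℕ i)) ⊠ δ (+ suc (toℕ i))) ≡ 0ω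
    tail≡0 n n≤p {m} refl = trans (sum-ext m λ i → trans (cong (f (c + + suc (toℕ i)) ⊠_) (δ-0 (λ d → ℕₚ.1+n≢0 (PowerSums.∣⇒<p⇒≡0 pr _ (ℕₚ.<-≤-trans (ℕ.s≤s (Finₚ.toℕ<n i)) n≤p) d)))) (⊠-zeroʳ _))
      (Σ.sum-replicate-zero m)
    go : ∀ n → n ≡ p → S[ n ] (λ a → f (c + a) ⊠ δ a) ≡ f c
    go zero e = ⊥-elim (ℕ.≢-nonZero⁻¹ p {{prime⇒nonZero pr}} (sym e))
    go (suc n) e = trans (cong₂ _⊞_ (trans (cong₂ _⊠_ (cong f (ℤₚ.+-identityʳ c)) (δ-1 (divides (+ 0) (sym (ℤₚ.*-zeroˡ (+ p)))))) (⊠-identityʳ (f c)))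
      (tail≡0 (suc n) (ℕₚ.≤-reflexive e) refl)) (CommutativeRing.+-identityʳ Zω-commutativeRing (f c))

  Sδ≡1 : S δ ≡ 1ω
  Sδ≡1 = trans (S-cong λ a → trans (cong δ (sym (ℤₚ.+-identityʳ a))) (sym (⊠-identityˡ _))) (S-δ (λ _ → 1ω) (λ _ → refl) (+ 0))

module JacobiSum {p : ℕ} (pr : Prime p) (h : ℤ) (root : + p ∣ h * h + h + + 1) (p∤3 : ¬ (+ p ∣ + 3))
                 (k : ℕ) (p≡1+3k : p ≡ 1 ℕ.+ 3 ℕ.* k) where
  open ℤmod (+ p)
  open PrimeMod pr
  open PeriodicSum pr
  open Evaluation pr h root p∤3
  open Character k p≡1+3k
  open CommutativeRing Zω-commutativeRing using () renaming (+-identityˡ to ⊞-0ˡ; +-identityʳ to ⊞-0ʳ; -‿inverseʳ to ⊞-inverseʳ)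

  P : Zω
  P = fromℤ (+ p)

  -- The usual sum of χ(a)χ(1 - a) after the substitution of -a for a, since χ(-1) = 1.
  J : Zω
  J = S (λ a → χ a ⊠ χ (+ 1 + a))

  χ̄ : ℤ → Zω
  χ̄ a = conj (χ a)

  χ̄-cong : Periodic χ̄
  χ̄-cong e = cong conj (χ-cong e)

  δ-conj : ∀ a → conj (δ a) ≡ δ a
  δ-conj a with + p ∣? a
  ... | yes d = trans (cong conj (δ-1 d)) (trans (conj-fromℤ (+ 1)) (sym (δ-1 d)))
  ... | no ¬d = trans (cong conj (δ-0 ¬d)) (trans (conj-fromℤ (+ 0)) (sym (δ-0 ¬d)))

  Sχ≡0 : S χ ≡ 0ω
  Sχ≡0 = go nontrivial
    where
    go : (∃ λ c → ¬ (+ p ∣ c) × ¬ (index c ≡ 𝟙)) → S χ ≡ 0ω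
    go (c , p∤c , index≢𝟙) = ⟦⟧-fixed⇒0 (index c) (S χ) index≢𝟙
      (trans (cong (_⊠ S χ) (sym (χ-unit p∤c))) (trans (sym (S-⊠ (χ c) χ)) (trans (S-cong λ a → sym (χ-* c a)) (S-scale c p∤c χ χ-cong))))

  Sχ̄≡0 : S χ̄ ≡ 0ω
  Sχ̄≡0 = trans (S-conj χ) (trans (cong conj Sχ≡0) (conj-fromℤ (+ 0)))

  S-χ-shift : ∀ x → S (λ a → χ̄ (a + x)) ≡ 0ω
  S-χ-shift x = trans (S-cong λ a → cong χ̄ (ℤₚ.+-comm a x)) (trans (S-shift x χ̄ χ̄-cong) Sχ̄≡0)

  -- The correlation of χ with its conjugate; orthogonality in the form `A≡D` evaluates it.
  A : ℤ → Zω
  A x = S (λ a → χ a ⊠ χ̄ (x + a))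

  A-0 : ∀ {x} → + p ∣ x → A x ≡ P ⊞ ⊟ 1ω
  A-0 {x} d = trans (S-cong term) (trans (S-⊞ (λ _ → 1ω) (λ a → ⊟ δ a)) (cong₂ _⊞_ (trans (S-const 1ω) (⊠-identityʳ P))
    (trans (S-cong λ a → sym (-1⊠ (δ a))) (trans (S-⊠ (⊟ 1ω) δ) (trans (cong (⊟ 1ω ⊠_) Sδ≡1) (⊠-identityʳ (⊟ 1ω)))))))
    where
    -1⊠ : ∀ α → ⊟ 1ω ⊠ α ≡ ⊟ α
    -1⊠ = Algebra.Properties.Ring.-1*x≈-x (CommutativeRing.ring Zω-commutativeRing)
    term : ∀ a → χ a ⊠ χ̄ (x + a) ≡ 1ω ⊞ ⊟ δ a
    term a = trans (cong (χ a ⊠_) (χ̄-cong (≋-trans (+-cong-≋ (∣⇒≋0 d) (≋-refl {a})) (≡⇒≋ (ℤₚ.+-identityˡ a))))) (cases (+ p ∣? a))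
      where
      cases : Dec (+ p ∣ a) → χ a ⊠ χ̄ a ≡ 1ω ⊞ ⊟ δ a
      cases (yes d) = trans (cong (_⊠ χ̄ a) (χ-0 d)) (trans (⊠-zeroˡ (χ̄ a)) (sym (trans (cong (λ β → 1ω ⊞ ⊟ β) (δ-1 d)) (⊞-inverseʳ 1ω))))
      cases (no p∤a) = trans (χ⊠χ̄ p∤a) (sym (trans (cong (λ β → 1ω ⊞ ⊟ β) (δ-0 p∤a)) (trans (cong (1ω ⊞_) ⊟0) (⊞-0ʳ 1ω))))
        where
        ⊟0 : ⊟ 0ω ≡ 0ω
        ⊟0 = Algebra.Properties.Ring.-0#≈0# (CommutativeRing.ring Zω-commutativeRing)

  A-scale : ∀ {x} → ¬ (+ p ∣ x) → A x ≡ A (+ 1)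
  A-scale {x} p∤x = trans (sym (S-scale x p∤x _ λ e → cong₂ _⊠_ (χ-cong e) (χ̄-cong (+-cong-≋ (≋-refl {x}) e)))) (S-cong term)
    where
    term : ∀ a → χ (x * a) ⊠ χ̄ (x + x * a) ≡ χ a ⊠ χ̄ (+ 1 + a)
    term a = trans (cong₂ (λ α β → α ⊠ conj β) (χ-* x a) (trans (cong χ (l x a)) (χ-* x (+ 1 + a))))
      (trans (cong ((χ x ⊠ χ a) ⊠_) (conj-* (χ x) (χ (+ 1 + a)))) (trans (⊠-interchange _ _ _ _)
        (trans (cong (_⊠ (χ a ⊠ χ̄ (+ 1 + a))) (χ⊠χ̄ p∤x)) (⊠-identityˡ _))))
      where
      l : ∀ x a → x + x * a ≡ x * (+ 1 + a)
      l = ℤSolver.solve-∀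

  SA≡0 : S A ≡ 0ω
  SA≡0 = trans (S-comm λ x a → χ a ⊠ χ̄ (x + a)) (trans (S-cong λ a → trans (S-⊠ (χ a) (λ x → χ̄ (x + a))) (trans (cong (χ a ⊠_) (S-χ-shift a)) (⊠-zeroʳ (χ a))))
    (trans (S-const 0ω) (⊠-zeroʳ P)))

  opaque
    unfolding _⊞_ ⊟_ _⊠_

    collect : ∀ π κ → π ⊠ κ ⊞ (π ⊞ ⊟ 1ω ⊞ ⊟ κ) ≡ (π ⊞ ⊟ 1ω) ⊠ (κ ⊞ 1ω)
    collect = Tactic.RingSolver.solve-∀ Zω-ring

    split-off : ∀ π κ → κ ⊞ (π ⊞ ⊟ 1ω ⊞ ⊟ κ) ≡ π ⊞ ⊟ 1ω
    split-off = Tactic.RingSolver.solve-∀ Zω-ring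

    drop-1 : ∀ κ → κ ≡ κ ⊞ 1ω ⊞ ⊟ 1ω
    drop-1 = Tactic.RingSolver.solve-∀ Zω-ring

    P-1 : P ⊞ ⊟ 1ω ≡ fromℤ (+ p - + 1)
    P-1 = refl

  -- A is p - 1 at the multiples of p, constant elsewhere, and sums to 0 over all residues; hence (p
  -- - 1)(A(1) + 1) = 0.
  A-1 : A (+ 1) ≡ ⊟ 1ω
  A-1 = trans (drop-1 (A (+ 1))) (trans (cong (_⊞ ⊟ 1ω) (fromℤ-cancel (+ p - + 1) p-1≢0
    (trans (cong (_⊠ (A (+ 1) ⊞ 1ω)) (sym P-1)) (trans (sym (collect P (A (+ 1)))) (trans (sym SA≡) SA≡0))))) (⊞-0ˡ (⊟ 1ω)))
    where
    p-1≢0 : + p - + 1 ≢ + 0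
    p-1≢0 e = p∤1 (divides (+ 1) (sym (trans (ℤₚ.*-identityˡ (+ p)) (ℤₚ.i-j≡0⇒i≡j (+ p) (+ 1) e))))
    E : Zω
    E = P ⊞ ⊟ 1ω ⊞ ⊟ A (+ 1)
    A-cases : ∀ x → A x ≡ A (+ 1) ⊞ E ⊠ δ x
    A-cases x with + p ∣? x
    ... | yes d = trans (A-0 d) (sym (trans (cong (A (+ 1) ⊞_) (trans (cong (E ⊠_) (δ-1 d)) (⊠-identityʳ E))) (split-off P (A (+ 1)))))
    ... | no p∤x = trans (A-scale p∤x) (sym (trans (cong (A (+ 1) ⊞_) (trans (cong (E ⊠_) (δ-0 p∤x)) (⊠-zeroʳ E))) (⊞-0ʳ (A (+ 1)))))
    SA≡ : S A ≡ P ⊠ A (+ 1) ⊞ E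
    SA≡ = trans (S-cong A-cases) (trans (S-⊞ (λ _ → A (+ 1)) (λ x → E ⊠ δ x)) (cong₂ _⊞_ (S-const (A (+ 1))) (trans (S-⊠ E δ) (trans (cong (E ⊠_) Sδ≡1) (⊠-identityʳ E)))))

  D : ℤ → Zω
  D x = P ⊠ δ x ⊞ ⊟ 1ω

  A≡D : ∀ x → A x ≡ D x
  A≡D x with + p ∣? x
  ... | yes d = trans (A-0 d) (cong (_⊞ ⊟ 1ω) (sym (trans (cong (P ⊠_) (δ-1 d)) (⊠-identityʳ P))))
  ... | no p∤x = trans (A-scale p∤x) (trans A-1 (sym (trans (cong (_⊞ ⊟ 1ω) (trans (cong (P ⊠_) (δ-0 p∤x)) (⊠-zeroʳ P))) (⊞-0ˡ (⊟ 1ω)))))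

  B : ℤ → Zω
  B x = S (λ a → χ a ⊠ χ (x + a))

  B≡ : ∀ x → B x ≡ J ⊠ χ̄ x
  B≡ x = cases (+ p ∣? x)
    where
    term : ∀ a → χ (x * a) ⊠ χ (x + x * a) ≡ χ̄ x ⊠ (χ a ⊠ χ (+ 1 + a))
    term a = trans (cong₂ _⊠_ (χ-* x a) (trans (cong χ (l x a)) (χ-* x (+ 1 + a)))) (trans (⊠-interchange _ _ _ _) (cong (_⊠ (χ a ⊠ χ (+ 1 + a))) (χ² x)))
      where
      l : ∀ x a → x + x * a ≡ x * (+ 1 + a)
      l = ℤSolver.solve-∀
    cases : Dec (+ p ∣ x) → B x ≡ J ⊠ χ̄ x
    cases (yes d) = trans (S-cong λ a → trans (cong (χ a ⊠_) (χ-cong (≋-trans (+-cong-≋ (∣⇒≋0 d) (≋-refl {a})) (≡⇒≋ (ℤₚ.+-identityˡ a))))) (χ² a))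
      (trans Sχ̄≡0 (sym (trans (cong (J ⊠_) (trans (cong conj (χ-0 d)) (conj-fromℤ (+ 0)))) (⊠-zeroʳ J))))
    cases (no p∤x) = trans (sym (S-scale x p∤x _ λ e → cong₂ _⊠_ (χ-cong e) (χ-cong (+-cong-≋ (≋-refl {x}) e))))
      (trans (S-cong term) (trans (S-⊠ (χ̄ x) (λ a → χ a ⊠ χ (+ 1 + a))) (⊠-comm (χ̄ x) J)))

  S-χ-δ : ∀ x → S (λ a → χ a ⊠ δ (x + a)) ≡ χ x
  S-χ-δ x = trans (S-cong λ a → cong (λ b → χ a ⊠ δ b) (l x a)) (trans (S-δ χ χ-cong (- x)) (χ-neg x))
    where
    l : ∀ x a → x + a ≡ a - - x
    l = ℤSolver.solve-∀

  -- D is pδ - 1. The constant contributes nothing because χ sums to 0, so convolution with D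
  -- multiplies χ by p.
  S-χ-D : ∀ x → S (λ a → χ a ⊠ D (x + a)) ≡ P ⊠ χ x
  S-χ-D x = trans (S-cong λ a → trans (⊠-distribˡ-⊞ (χ a) _ _) (cong₂ _⊞_ (⊠-swapˡ (χ a) P (δ (x + a))) (⊠-comm (χ a) (⊟ 1ω))))
    (trans (S-⊞ (λ a → P ⊠ (χ a ⊠ δ (x + a))) (λ a → ⊟ 1ω ⊠ χ a)) (trans (cong₂ _⊞_ (trans (S-⊠ P (λ a → χ a ⊠ δ (x + a))) (cong (P ⊠_) (S-χ-δ x)))
      (trans (S-⊠ (⊟ 1ω) χ) (trans (cong (⊟ 1ω ⊠_) Sχ≡0) (⊠-zeroʳ (⊟ 1ω))))) (⊞-0ʳ _)))

  conj-D : ∀ x → conj (D x) ≡ D x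
  conj-D x = trans (conj-⊞ _ _) (cong₂ _⊞_ (trans (conj-* P (δ x)) (cong₂ _⊠_ (conj-fromℤ (+ p)) (δ-conj x))) (trans (conj-⊟ 1ω) (cong ⊟_ (conj-fromℤ (+ 1)))))

  -- The double sum of conj(χ(a)) χ(b) χ(1 + a + b) is evaluated in both orders. Summing over b
  -- first gives J times conj(χ(1 + a)), hence J conj(J); summing over a first gives D(1 + b), hence
  -- p χ(1).
  J⊠J̄ : J ⊠ conj J ≡ P
  J⊠J̄ = trans (sym C≡JJ̄) C≡P
    where
    C : Zω
    C = S (λ a → χ̄ a ⊠ S (λ b → χ b ⊠ χ (+ 1 + a + b)))
    C≡JJ̄ : C ≡ J ⊠ conj J
    C≡JJ̄ = trans (S-cong λ a → trans (cong (χ̄ a ⊠_) (B≡ (+ 1 + a))) (⊠-swapˡ (χ̄ a) J _))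
      (trans (S-⊠ J (λ a → χ̄ a ⊠ χ̄ (+ 1 + a))) (cong (J ⊠_) (trans (S-cong λ a → sym (conj-* (χ a) (χ (+ 1 + a)))) (S-conj (λ a → χ a ⊠ χ (+ 1 + a))))))
    Ā : ∀ y → S (λ a → χ̄ a ⊠ χ (y + a)) ≡ D y
    Ā y = trans (S-cong λ a → trans (cong (χ̄ a ⊠_) (sym (conj-involutive (χ (y + a))))) (sym (conj-* (χ a) (χ̄ (y + a)))))
      (trans (S-conj (λ a → χ a ⊠ χ̄ (y + a))) (trans (cong conj (A≡D y)) (conj-D y)))
    C≡P : C ≡ P
    C≡P = trans (S-swap χ̄ χ (λ a b → χ (+ 1 + a + b)))
      (trans (S-cong λ b → cong (χ b ⊠_) (trans (S-cong λ a → cong (λ y → χ̄ a ⊠ χ y) (l a b)) (Ā (+ 1 + b))))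
        (trans (S-χ-D (+ 1)) (trans (cong (P ⊠_) χ-1) (⊠-identityʳ P))))
      where
      l : ∀ a b → + 1 + a + b ≡ + 1 + b + a
      l = ℤSolver.solve-∀

  norm-J : normω J ≡ + p
  norm-J = cong re (trans (sym (⊠-conj J)) J⊠J̄)

  -- At the place ω ↦ h the character becomes a^k, so J becomes the sum of a^k (a + 1)^k, of degree
  -- 2k < p - 1.
  ev-J : ev J ≋ + 0
  ev-J = ≋-trans (ev-S p) (PowerSums.powerSum≋0 pr g (suc (k ℕ.+ k)) (degree-x^k[x+1]^j k k) 2k<p)
    where
    g : ℤ → ℤ
    g x = (x + + 1) ^ k * x ^ k
    f : ℤ → Zω
    f a = χ a ⊠ χ (+ 1 + a)
    ev-f : ∀ a → ev (f a) ≋ g a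
    ev-f a = ≋-trans (ev-⊠ (χ a) (χ (+ 1 + a))) (≋-trans (*-cong-≋ (ev-χ a) (ev-χ (+ 1 + a)))
      (≡⇒≋ (trans (ℤₚ.*-comm (a ^ k) _) (cong (λ b → b ^ k * a ^ k) (ℤₚ.+-comm (+ 1) a)))))
    ev-S : ∀ n → ev (S[ n ] f) ≋ partialSum g n
    ev-S zero = ≡⇒≋ (ev-fromℤ (+ 0))
    ev-S (suc n) = ≋-trans (≡⇒≋ (trans (cong ev (S[suc] n f)) (ev-⊞ _ _))) (+-cong-≋ (ev-S n) (ev-f (+ n)))
    2k<p : suc (k ℕ.+ k) ℕ.< p
    2k<p = subst (suc (k ℕ.+ k) ℕ.<_) (sym p≡1+3k) (ℕ.s≤s (ℕₚ.+-monoʳ-< k (ℕₚ.m<m+n k (subst (0 ℕ.<_) (sym (ℕₚ.+-identityʳ k)) (PowerSums.0<k pr k p≡1+3k)))))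

  -- The powers of the Gauss sum g = Σ χ(a) Tₐ, applied to δ and reduced modulo the prime q.
  module GaussSum {q : ℕ} (qr : Prime q) (p∤q : ¬ (+ p ∣ + q)) where
    private
      module ω = Zωmodℤ (+ q)
      module F = FrobeniusZω qr
      module Op = Operators ω.quotientRing
      open Op using (app; T; _^ₒ_; sumₒ; sumₒ-app; frobenius; at)

    g : Op.Operator
    g = sumₒ {p} (λ i → T (χ (+ toℕ i)) (+ toℕ i))

    app-g : ∀ f x → app g f x ≡ S (λ a → χ a ⊠ f (x + a))
    app-g f x = sumₒ-app {p} (λ i → T (χ (+ toℕ i)) (+ toℕ i)) f x

    -- 1 + 3n, in a form that unfolds by three applications of g.
    exponent : ℕ → ℕ
    exponent zero = 1
    exponent (suc n) = 3 ℕ.+ exponent n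

    exponent≡ : ∀ n → exponent n ≡ 1 ℕ.+ 3 ℕ.* n
    exponent≡ zero = refl
    exponent≡ (suc n) = trans (cong (3 ℕ.+_) (exponent≡ n)) (cong suc (sym (ℕₚ.*-suc 3 n)))

    g[cδ] : ∀ (f : ℤ → Zω) → (∀ x → f x ≡ δ x) → ∀ x → app g f x ≡ χ x
    g[cδ] f e x = trans (app-g f x) (trans (S-cong λ a → cong (χ a ⊠_) (e (x + a))) (S-χ-δ x))

    g[cχ] : ∀ α (f : ℤ → Zω) → (∀ x → f x ≡ α ⊠ χ x) → ∀ x → app g f x ≡ α ⊠ (J ⊠ χ̄ x)
    g[cχ] α f e x = trans (app-g f x) (trans (S-cong λ a → trans (cong (χ a ⊠_) (e (x + a))) (⊠-swapˡ (χ a) α _)) (trans (S-⊠ α (λ a → χ a ⊠ χ (x + a))) (cong (α ⊠_) (B≡ x))))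

    g[cχ̄] : ∀ α (f : ℤ → Zω) → (∀ x → f x ≡ α ⊠ χ̄ x) → ∀ x → app g f x ≡ α ⊠ D x
    g[cχ̄] α f e x = trans (app-g f x) (trans (S-cong λ a → trans (cong (χ a ⊠_) (e (x + a))) (⊠-swapˡ (χ a) α _)) (trans (S-⊠ α (λ a → χ a ⊠ χ̄ (x + a))) (cong (α ⊠_) (A≡D x))))

    g[cD] : ∀ α (f : ℤ → Zω) → (∀ x → f x ≡ α ⊠ D x) → ∀ x → app g f x ≡ α ⊠ (P ⊠ χ x)
    g[cD] α f e x = trans (app-g f x) (trans (S-cong λ a → trans (cong (χ a ⊠_) (e (x + a))) (⊠-swapˡ (χ a) α _)) (trans (S-⊠ α (λ a → χ a ⊠ D (x + a))) (cong (α ⊠_) (S-χ-D x))))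

    -- Applying g takes δ to χ, χ to J conj(χ), conj(χ) to D, and D to pχ. From χ on, three
    -- applications multiply by pJ, which is the relation g³ = pJ.
    g^[1+3n] : ∀ n x → app (g ^ₒ exponent n) δ x ≡ ((P ⊠ J) ↑ n) ⊠ χ x
    g^[2+3n] : ∀ n x → app (g ^ₒ suc (exponent n)) δ x ≡ ((P ⊠ J) ↑ n) ⊠ J ⊠ χ̄ x
    g^[3+3n] : ∀ n x → app (g ^ₒ (2 ℕ.+ exponent n)) δ x ≡ ((P ⊠ J) ↑ n) ⊠ J ⊠ D x
    g^[1+3n] zero x = trans (g[cδ] δ (λ _ → refl) x) (sym (trans (cong (_⊠ χ x) (↑-zero (P ⊠ J))) (⊠-identityˡ (χ x))))
    g^[1+3n] (suc n) x = trans (g[cD] (((P ⊠ J) ↑ n) ⊠ J) _ (g^[3+3n] n) x) (trans (sym (⊠-assoc _ P (χ x))) (cong (_⊠ χ x)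
      (trans (⊠-assoc _ J P) (trans (⊠-comm _ (J ⊠ P)) (trans (cong (_⊠ ((P ⊠ J) ↑ n)) (⊠-comm J P)) (sym (↑-suc (P ⊠ J) n)))))))
    g^[2+3n] n x = trans (g[cχ] ((P ⊠ J) ↑ n) _ (g^[1+3n] n) x) (sym (⊠-assoc _ J (χ̄ x)))
    g^[3+3n] n x = g[cχ̄] (((P ⊠ J) ↑ n) ⊠ J) _ (g^[2+3n] n) x

    G : ℕ → Zω
    G n = app (g ^ₒ n) δ (+ 1)

    v : ℤ
    v = proj₁ (inverse (+ q) p∤q)

    qv≋1 : + q * v ≋ + 1
    qv≋1 = proj₂ (inverse (+ q) p∤q)

    p∤v : ¬ (+ p ∣ v)
    p∤v d = p∤1 (∣-resp-≋ qv≋1 (∣n⇒∣m*n (+ q) d))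

    δ[1+qa] : ∀ a → δ (+ 1 + + q * a) ≡ δ (a - - v)
    δ[1+qa] a = δ-cong (λ d → ∣-resp-≋ (≋-trans (≡⇒≋ (l₁ v (+ q) a)) (≋-trans (+-cong-≋ (≋-refl {v}) (*-congʳ-≋ a qv≋1)) (≡⇒≋ (l₃ v a)))) (∣n⇒∣m*n v d))
      (λ d → ∣-resp-≋ (≋-trans (≡⇒≋ (l₂ v (+ q) a)) (+-cong-≋ qv≋1 (≋-refl {+ q * a}))) (∣n⇒∣m*n (+ q) d))
      where
      l₁ : ∀ v q a → v * (+ 1 + q * a) ≡ v + q * v * a
      l₁ = ℤSolver.solve-∀
      l₂ : ∀ v q a → q * (a - - v) ≡ q * v + q * a
      l₂ = ℤSolver.solve-∀
      l₃ : ∀ v a → v + + 1 * a ≡ a - - v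
      l₃ = ℤSolver.solve-∀

    -- Modulo q the power g^q is the sum of χ(a)^q T_(qa). Evaluated on δ at 1 it retains the term
    -- with qa ≡ -1, that is a ≡ -v, and χ(-v) = χ(v).
    g^q : G q ω.≋ ⟦ index v ⟧ ↑ q
    g^q = ω.≋-trans (at (frobenius qr F.charω {p} (λ i → χ (+ toℕ i)) (λ i → + toℕ i)) δ (+ 1))
      (ω.≡⇒≋ (trans (sumₒ-app {p} _ δ (+ 1)) (trans (S-cong {λ a → _ ⊠ δ (+ 1 + + q * a)} λ a → cong₂ _⊠_ (F.^ᴿ≡↑ (χ a) q) (δ[1+qa] a))
        (trans (S-δ (λ a → χ a ↑ q) (λ e → cong (_↑ q) (χ-cong e)) (- v)) (cong (_↑ q) (trans (χ-neg v) (χ-unit p∤v)))))))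

prime-3 : Prime 3
prime-3 = Relation.Nullary.Decidable.from-yes (prime? 3)

prime∣prime : ∀ {p q} → Prime p → Prime q → + p ∣ + q → p ≡ q
prime∣prime {p} {q} pr qr d = [ (λ p≡1 → ⊥-elim (PrimeMod.p∤1 pr (subst (λ n → + n ∣ + 1) (sym p≡1) ∣-refl))) , (λ e → e) ]′ (prime⇒irreducible qr (∣⇒∣ᵤ d))

module JacobiSymbol {p : ℕ} (pr : Prime p) (h : ℤ) (root : + p ∣ h * h + h + + 1) (p∤3 : ¬ (+ p ∣ + 3))
                    (k : ℕ) (p≡1+3k : p ≡ 1 ℕ.+ 3 ℕ.* k) where
  open JacobiSum pr h root p∤3 k p≡1+3k
  open Evaluation pr h root p∤3
  open Character k p≡1+3k
  open PrimeMod pr using (∤-*)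
  open PeriodicSum pr using (δ; δ-0)

  -- Take q = 3: the value of g³δ at 1 is J D(1) = -J, while Frobenius makes it the cube of a cube
  -- root of unity.
  J≋-1 : Modulo._≋_ Zω-commutativeRing (fromℤ (+ 3)) J (⊟ 1ω)
  J≋-1 = ≋-trans (≡⇒≋ (sym (⊟-⊟1 J))) (≋-trans (*-congʳ-≋ (⊟ 1ω) (≋-trans (≡⇒≋ (sym F₃)) (≋-trans g^q (≡⇒≋ (⟦⟧↑3 (index v) 1))))) (≡⇒≋ (⊠-identityˡ (⊟ 1ω))))
    where
    open GaussSum prime-3 p∤3
    open Zωmodℤ (+ 3)
    D1 : D (+ 1) ≡ ⊟ 1ω
    D1 = trans (cong (λ α → P ⊠ α ⊞ ⊟ 1ω) (δ-0 (PrimeMod.p∤1 pr))) (trans (cong (_⊞ ⊟ 1ω) (⊠-zeroʳ P)) (⊞-identityˡ (⊟ 1ω)))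
    F₃ : G 3 ≡ J ⊠ ⊟ 1ω
    F₃ = trans (g^[3+3n] 0 (+ 1)) (cong₂ _⊠_ (trans (cong (_⊠ J) (↑-zero (P ⊠ J))) (⊠-identityˡ J)) D1)
    ⊟-⊟1 : ∀ α → α ⊠ ⊟ 1ω ⊠ ⊟ 1ω ≡ α
    ⊟-⊟1 α = trans (⊠-assoc α (⊟ 1ω) (⊟ 1ω)) (trans (cong (α ⊠_) -1²) (⊠-identityʳ α))
      where
      opaque
        unfolding ⊟_ _⊠_
        -1² : ⊟ 1ω ⊠ ⊟ 1ω ≡ 1ω
        -1² = refl

  module _ {q : ℕ} (qr : Prime q) (q∤3 : ¬ (+ q ∣ + 3)) (p∤q : ¬ (+ p ∣ + q)) where
    open GaussSum qr p∤q
    open Zωmodℤ (+ q)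
    open Residue qr
    private
      module Z = ℤmod (+ q)

      q∤p : ¬ (+ q ∣ + p)
      q∤p d = p∤q (subst (λ n → + n ∣ + q) (prime∣prime qr pr d) ∣-refl)

      q∤norm-J : ¬ (+ q ∣ normω J)
      q∤norm-J d = q∤p (subst (+ q ∣_) norm-J d)

      q∤norm-PJ : ¬ (+ q ∣ normω (P ⊠ J))
      q∤norm-PJ d = PrimeMod.∤-* qr (∤norm-fromℤ q∤3 q∤p) q∤norm-J (subst (+ q ∣_) (normω-* P J) d)

      index-inverse : index (+ q) ∙ index v ≡ 𝟙
      index-inverse = trans (sym (index-* (+ q) v p∤q p∤v)) (trans (index-cong (∤-* p∤q p∤v) qv≋1) index-1)

      conj-index : conj ⟦ index v ⟧ ≡ ⟦ index (+ q) ⟧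
      conj-index = trans (⟦⟧-conj (index v)) (cong ⟦_⟧ (inv (index (+ q)) (index v) index-inverse))
        where
        inv : ∀ x y → x ∙ y ≡ 𝟙 → y ⁻¹ ≡ x
        inv 𝟙 𝟙 _ = refl
        inv ζ ζ² _ = refl
        inv ζ² ζ _ = refl

      index² : index v ∙ index v ≡ index (+ q)
      index² = inv (index (+ q)) (index v) index-inverse
        where
        inv : ∀ x y → x ∙ y ≡ 𝟙 → y ∙ y ≡ x
        inv 𝟙 𝟙 _ = refl
        inv ζ ζ² _ = refl
        inv ζ² ζ _ = refl

      χ̄1 : χ̄ (+ 1) ≡ 1ω
      χ̄1 = trans (cong conj χ-1) (conj-fromℤ (+ 1))

    -- pJ appears instead of J because g³ = pJ. For q = 1 + 3n the value of g^q is (pJ)^n ≡ χ(v),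
    -- and χ(v) times the square of its conjugate is χ(q). For q = 2 + 3n it is (pJ)^n J ≡ χ(v)² =
    -- χ(q); multiplying by p and raising to the power q - 1 removes p by Fermat and fixes χ(q).
    euler-PJ : ∀ C → euler C (P ⊠ J) ≋ ⟦ index (+ q) ⟧
    euler-PJ (divisible n e) = ⊥-elim (¬divisible q∤3 n e)
    euler-PJ (split n e) = ≋-trans (≡⇒≋ (trans (↑-distrib-⊠ α (conj α ⊠ conj α) n) (cong ((α ↑ n) ⊠_) (trans (↑-distrib-⊠ (conj α) (conj α) n) (cong (λ β → β ⊠ β) (sym (conj-^ α n)))))))
      (≋-trans (*-cong-≋ α^n≋ (*-cong-≋ (conj-cong α^n≋) (conj-cong α^n≋)))
        (≡⇒≋ (trans (cong (λ β → ⟦ index v ⟧ ⊠ (β ⊠ β)) conj-index) (trans (cong (⟦ index v ⟧ ⊠_) (sym (⟦⟧-∙ iq iq))) (trans (sym (⟦⟧-∙ (index v) (iq ∙ iq)))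
          (cong ⟦_⟧ (trans (sym (∙-assoc (index v) iq iq)) (cong (_∙ iq) (trans (∙-comm (index v) iq) index-inverse)))))))))
      where
      α = P ⊠ J
      iq = index (+ q)
      α^n≋ : α ↑ n ≋ ⟦ index v ⟧
      α^n≋ = ≋-trans (≡⇒≋ (sym (trans (cong G (trans e (sym (exponent≡ n)))) (trans (g^[1+3n] n (+ 1)) (trans (cong ((α ↑ n) ⊠_) χ-1) (⊠-identityʳ _))))))
        (≋-trans g^q (≡⇒≋ (trans (cong (⟦ index v ⟧ ↑_) e) (⟦⟧↑[1+3n] (index v) n))))
    euler-PJ (inert n e) = ≋-trans (≡⇒≋ (sym (↑-assocʳ α (suc n) (1 ℕ.+ 3 ℕ.* n))))
      (≋-trans (↑-cong-≋ (1 ℕ.+ 3 ℕ.* n) α^[1+n]≋)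
        (≋-trans (≡⇒≋ (↑-distrib-⊠ P ⟦ iq ⟧ (1 ℕ.+ 3 ℕ.* n)))
          (≋-trans (*-cong-≋ (≋-trans (≡⇒≋ (sym (fromℤ-^ (+ p) (1 ℕ.+ 3 ℕ.* n)))) (fromℤ-cong (PrimeMod.fermat-unit qr (+ p) q∤p e))) (≡⇒≋ (⟦⟧↑[1+3n] iq n)))
            (≡⇒≋ (⊠-identityˡ ⟦ iq ⟧)))))
      where
      α = P ⊠ J
      iq = index (+ q)
      α^nJ≋ : (α ↑ n) ⊠ J ≋ ⟦ iq ⟧
      α^nJ≋ = ≋-trans (≡⇒≋ (sym (trans (cong G (trans e (cong suc (sym (exponent≡ n))))) (trans (g^[2+3n] n (+ 1)) (trans (cong (((α ↑ n) ⊠ J) ⊠_) χ̄1) (⊠-identityʳ _))))))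
        (≋-trans g^q (≡⇒≋ (trans (cong (⟦ index v ⟧ ↑_) e) (trans (⟦⟧↑[2+3n] (index v) n) (cong ⟦_⟧ index²)))))
      α^[1+n]≋ : α ↑ suc n ≋ P ⊠ ⟦ iq ⟧
      α^[1+n]≋ = ≋-trans (≡⇒≋ (trans (↑-suc α n) (trans (⊠-assoc P J (α ↑ n)) (cong (P ⊠_) (⊠-comm J (α ↑ n)))))) (*-congˡ-≋ P α^nJ≋)

    res-J : ∀ C → res C J ≡ index (+ q)
    res-J C = trans (sym (res-scale q∤3 C (+ p) J q∤p q∤norm-J)) (res-unique q∤3 C (P ⊠ J) q∤norm-PJ (euler-PJ C))

-- Reciprocity

fromℤ-cancelˡ : ∀ m .{{_ : ℤ.NonZero m}} {α β} → fromℤ m ⊠ α ≡ fromℤ m ⊠ β → α ≡ β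
fromℤ-cancelˡ m {{nz}} {α} {β} e = cong₂ _+ω_ω (ℤₚ.*-cancelˡ-≡ m (re α) (re β) {{nz}} (cong re e′)) (ℤₚ.*-cancelˡ-≡ m (im α) (im β) {{nz}} (cong im e′))
  where
  e′ : (m * re α) +ω (m * im α) ω ≡ (m * re β) +ω (m * im β) ω
  e′ = trans (sym (fromℤ-⊠ m α)) (trans e (fromℤ-⊠ m β))

infix 4 _⟂_
-- Coprimality is phrased through primes since both its proofs and its uses go prime by prime.
_⟂_ : ℤ → ℤ → Set
a ⟂ b = ∀ ℓ → Prime ℓ → + ℓ ∣ a → ¬ (+ ℓ ∣ b)

⟂-*ˡ : ∀ {a b c} → a ⟂ c → b ⟂ c → a * b ⟂ c
⟂-*ˡ {a} {b} a⟂c b⟂c ℓ lr d = [ a⟂c ℓ lr , b⟂c ℓ lr ]′ (PrimeMod.euclid lr a b d)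

⟂-factorˡ : ∀ {a b c} → a ∣ b → b ⟂ c → a ⟂ c
⟂-factorˡ a∣b b⟂c ℓ lr d = b⟂c ℓ lr (∣-trans d a∣b)

⟂-factorʳ : ∀ {a b c} → b ∣ c → a ⟂ c → a ⟂ b
⟂-factorʳ b∣c a⟂c ℓ lr d e = a⟂c ℓ lr d (∣-trans e b∣c)

⟂-sym : ∀ {a b} → a ⟂ b → b ⟂ a
⟂-sym a⟂b ℓ lr d e = a⟂b ℓ lr e d

prime⟂ : ∀ {q a} → Prime q → ¬ (+ q ∣ a) → + q ⟂ a
prime⟂ {q} {a} qr q∤a ℓ lr d e = q∤a (subst (λ n → + n ∣ a) (prime∣prime lr qr d) e)

-- M is the cubic residue character modulo r on rational integers prime to the norm of r, and M-res is the reciprocity law.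
record SymbolCharacter (r : Zω) : Set where
  field
    M : ℤ → μ₃
    M-* : ∀ a b → a ⟂ normω r → b ⟂ normω r → M (a * b) ≡ M a ∙ M b
    M-cong : ∀ {a b} → a ⟂ normω r → normω r ∣ a - b → M a ≡ M b
    M-res : ∀ {q} (qr : Prime q) (C : Class q) → ¬ (+ q ∣ + 3) → ¬ (+ q ∣ normω r) → M (+ q) ≡ Residue.res qr C r

Primary : Zω → Set
Primary r = ¬ (+ 3 ∣ re r) × + 3 ∣ im r

primary⇒3∤norm : ∀ r → Primary r → ¬ (+ 3 ∣ normω r)
primary⇒3∤norm r (3∤a , 3∣b) d = PrimeMod.∤-* prime-3 3∤a 3∤a (subst (+ 3 ∣_) (l (re r) (im r)) (∣m∣n⇒∣m-n d (∣n⇒∣m*n (im r - re r) 3∣b)))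
  where
  l : ∀ a b → a * a - a * b + b * b - (b - a) * b ≡ a * a
  l = ℤSolver.solve-∀

x²≡∣x∣² : ∀ x → x * x ≡ + (ℤ.∣ x ∣ ℕ.* ℤ.∣ x ∣)
x²≡∣x∣² (+ n) = sym (ℤₚ.pos-* n n)
x²≡∣x∣² ℤ.-[1+ n ] = refl

-- Completing the square. The right side is a natural number, so that its terms can be bounded or
-- shown to vanish.
4normω : ∀ α → + 4 * normω α ≡ + (ℤ.∣ + 2 * re α - im α ∣ ℕ.* ℤ.∣ + 2 * re α - im α ∣ ℕ.+ 3 ℕ.* (ℤ.∣ im α ∣ ℕ.* ℤ.∣ im α ∣))
4normω α = trans (l (re α) (im α)) (trans (cong₂ (λ u v → u + + 3 * v) (x²≡∣x∣² (+ 2 * re α - im α)) (x²≡∣x∣² (im α)))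
  (cong (λ u → + (c ℕ.* c) + u) (sym (ℤₚ.pos-* 3 (ℤ.∣ im α ∣ ℕ.* ℤ.∣ im α ∣)))))
  where
  c = ℤ.∣ + 2 * re α - im α ∣
  l : ∀ a b → + 4 * (a * a - a * b + b * b) ≡ (+ 2 * a - b) * (+ 2 * a - b) + + 3 * (b * b)
  l = ℤSolver.solve-∀

-- 4 = (2a - b)² + 3b² with 3 dividing b leaves only b = 0, as 27 exceeds 4.
primary-unit⇒rational : ∀ r → Primary r → ℤ.∣ normω r ∣ ≡ 1 → im r ≡ + 0
primary-unit⇒rational r (3∤a , divides m b≡m3) N≡1 = go m b≡m3
  where
  a = re r
  c = ℤ.∣ + 2 * a - im r ∣
  4N≡ : 4 ≡ c ℕ.* c ℕ.+ 3 ℕ.* (ℤ.∣ im r ∣ ℕ.* ℤ.∣ im r ∣)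
  4N≡ = trans (trans (cong (4 ℕ.*_) (sym N≡1)) (sym (ℤₚ.abs-* (+ 4) (normω r))))
    (cong ℤ.∣_∣ (4normω r))
  bound : ∀ {k} → ℤ.∣ im r ∣ ≡ 3 ℕ.+ k → ⊥
  bound {k} e = ℕₚ.<⇒≱ (ℕₚ.≤-trans (ℕ.s≤s (ℕ.s≤s (ℕ.s≤s (ℕ.s≤s (ℕ.s≤s ℕ.z≤n))))) (ℕₚ.≤-trans (ℕₚ.*-monoʳ-≤ 3 (ℕₚ.*-mono-≤ {3} {3 ℕ.+ k} {3} {3 ℕ.+ k} (ℕₚ.m≤m+n 3 k) (ℕₚ.m≤m+n 3 k))) (ℕₚ.m≤n+m _ (c ℕ.* c))))
    (ℕₚ.≤-reflexive (sym (trans 4N≡ (cong (λ x → c ℕ.* c ℕ.+ 3 ℕ.* (x ℕ.* x)) e))))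
  go : ∀ m → im r ≡ m * + 3 → im r ≡ + 0
  go (+ 0) e = e
  go ℤ.+[1+ n ] e = ⊥-elim (bound (cong ℤ.∣_∣ e))
  go ℤ.-[1+ n ] e = ⊥-elim (bound (cong ℤ.∣_∣ e))

prime-divisor : ∀ n → 1 ℕ.< n → ∃ λ p → Prime p × p ℕ∣.∣ n
prime-divisor n 1<n = go (factorise n {{ℕ.>-nonZero (ℕₚ.<-trans (ℕ.s≤s ℕ.z≤n) 1<n)}})
  where
  go : PrimeFactorisation n → ∃ λ p → Prime p × p ℕ∣.∣ n
  go record { factors = [] ; isFactorisation = e } = ⊥-elim (ℕₚ.<-irrefl (sym e) 1<n)
  go record { factors = p ∷ ps ; isFactorisation = e ; factorsPrime = pr ∷ _ } = p , pr , ℕ∣.divides (product ps) (trans e (ℕₚ.*-comm p (product ps)))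

trivialCharacter : ∀ r → im r ≡ + 0 → ℤ.∣ normω r ∣ ≡ 1 → SymbolCharacter r
trivialCharacter r b≡0 N≡1 = record
  { M = λ _ → 𝟙
  ; M-* = λ _ _ _ _ → refl
  ; M-cong = λ _ _ → refl
  ; M-res = λ qr C q∤3 q∤N → sym (trans (cong (Residue.res qr C) r≡) (Residue.res-fromℤ qr q∤3 C (re r)
      λ d → q∤N (subst (+ _ ∣_) (sym (trans (cong normω r≡) (normω-fromℤ (re r)))) (∣m⇒∣m*n (re r) d)))) }
  where
  r≡ : r ≡ fromℤ (re r)
  r≡ = cong (re r +ω_ω) b≡0

-- A rational factor does not change symbols at rational primes; it only excludes further primes.
module ScaleCharacter {p : ℕ} (pr : Prime p) (r′ : Zω) (S′ : SymbolCharacter r′) where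
  open SymbolCharacter S′

  scaled : SymbolCharacter (fromℤ (+ p) ⊠ r′)
  scaled = record
    { M = M
    ; M-* = λ a b a⟂ b⟂ → M-* a b (⟂-factorʳ N∣ a⟂) (⟂-factorʳ N∣ b⟂)
    ; M-cong = λ a⟂ d → M-cong (⟂-factorʳ N∣ a⟂) (∣-trans N∣ d)
    ; M-res = λ qr C q∤3 q∤N → trans (M-res qr C q∤3 (λ d → q∤N (∣-trans d N∣)))
        (sym (Residue.res-scale qr q∤3 C (+ p) r′ (λ d → q∤N (∣-trans d p∣)) λ d → q∤N (∣-trans d N∣))) }
    where
    N≡ : normω (fromℤ (+ p) ⊠ r′) ≡ + p * + p * normω r′
    N≡ = trans (normω-* (fromℤ (+ p)) r′) (cong (_* normω r′) (normω-fromℤ (+ p)))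
    N∣ : normω r′ ∣ normω (fromℤ (+ p) ⊠ r′)
    N∣ = divides (+ p * + p) N≡
    p∣ : + p ∣ normω (fromℤ (+ p) ⊠ r′)
    p∣ = subst (+ p ∣_) (sym N≡) (∣m⇒∣m*n (normω r′) (∣m⇒∣m*n (+ p) ∣-refl))

-- A factor J multiplies M by the cubic character modulo p; reciprocity for this factor is `res-J`.
module TwistCharacter {p : ℕ} (pr : Prime p) (h : ℤ) (root : + p ∣ h * h + h + + 1) (p∤3 : ¬ (+ p ∣ + 3))
                      (k : ℕ) (p≡1+3k : p ≡ 1 ℕ.+ 3 ℕ.* k) (κ : Zω) (Sκ : SymbolCharacter κ) where
  open JacobiSum pr h root p∤3 k p≡1+3k using (J; norm-J)
  open Evaluation.Character pr h root p∤3 k p≡1+3k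
  open SymbolCharacter Sκ

  twisted : SymbolCharacter (J ⊠ κ)
  twisted = record
    { M = λ a → index a ∙ M a
    ; M-* = λ a b a⟂ b⟂ → trans (cong₂ _∙_ (index-* a b (p∤ a⟂) (p∤ b⟂)) (M-* a b (⟂-factorʳ N∣ a⟂) (⟂-factorʳ N∣ b⟂)))
        (interchange (index a) (index b) (M a) (M b))
    ; M-cong = λ a⟂ d → cong₂ _∙_ (index-cong (p∤ a⟂) (ℤmod.∣⇒≋ (+ p) (∣-trans p∣ d))) (M-cong (⟂-factorʳ N∣ a⟂) (∣-trans N∣ d))
    ; M-res = λ {q} qr C q∤3 q∤N → trans (cong₂ _∙_ (sym (JacobiSymbol.res-J pr h root p∤3 k p≡1+3k qr q∤3 (λ d → p∤q qr q∤N d) C)) (M-res qr C q∤3 (λ d → q∤N (∣-trans d N∣))))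
        (sym (Residue.res-* qr q∤3 C J κ (λ d → q∤N (∣-trans (subst (+ q ∣_) norm-J d) p∣)) λ d → q∤N (∣-trans d N∣))) }
    where
    N≡ : normω (J ⊠ κ) ≡ + p * normω κ
    N≡ = trans (normω-* J κ) (cong (_* normω κ) norm-J)
    N∣ : normω κ ∣ normω (J ⊠ κ)
    N∣ = divides (+ p) N≡
    p∣ : + p ∣ normω (J ⊠ κ)
    p∣ = subst (+ p ∣_) (sym N≡) (∣m⇒∣m*n (normω κ) ∣-refl)
    p∤ : ∀ {a} → a ⟂ normω (J ⊠ κ) → ¬ (+ p ∣ a)
    p∤ a⟂ d = a⟂ p pr d p∣
    p∤q : ∀ {q} → Prime q → ¬ (+ q ∣ normω (J ⊠ κ)) → ¬ (+ p ∣ + q)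
    p∤q qr q∤N d = q∤N (subst (λ n → + n ∣ normω (J ⊠ κ)) (prime∣prime pr qr d) p∣)
    interchange : ∀ w x y z → (w ∙ x) ∙ (y ∙ z) ≡ (w ∙ y) ∙ (x ∙ z)
    interchange w x y z = trans (∙-assoc w x (y ∙ z)) (trans (cong (w ∙_) (trans (sym (∙-assoc x y z)) (trans (cong (_∙ z) (∙-comm x y)) (∙-assoc y x z)))) (sym (∙-assoc w y (x ∙ z))))

-- J divides α as soon as α vanishes at the place above p where J does: α conj(J) then vanishes at both places,
-- hence is divisible by p = J conj(J).
module JacobiDivisibility {p : ℕ} (pr : Prime p) (h : ℤ) (root : + p ∣ h * h + h + + 1) (p∤3 : ¬ (+ p ∣ + 3))
                          (k : ℕ) (p≡1+3k : p ≡ 1 ℕ.+ 3 ℕ.* k) where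
  open JacobiSum pr h root p∤3 k p≡1+3k using (J; J⊠J̄; ev-J)
  open Evaluation pr h root p∤3
  open ℤmod (+ p)
  private module ω = Zωmodℤ (+ p)

  private
    ≋0 : ∀ x {y} → y ≋ + 0 → x * y ≋ + 0
    ≋0 x e = ≋-trans (*-congˡ-≋ x e) (≡⇒≋ (ℤₚ.*-zeroʳ x))

  ∣ω⇒ev≋0 : ∀ {α} → J ∣ω α → ev α ≋ + 0
  ∣ω⇒ev≋0 {α} d = go (∣ω⇒ d)
    where
    go : (∃ λ κ → α ≡ κ ⊠ J) → ev α ≋ + 0
    go (κ , e) = ≋-trans (≡⇒≋ (cong ev e)) (≋-trans (ev-⊠ κ J) (≋0 (ev κ) ev-J))

  ev≋0⇒∣ω : ∀ α → ev α ≋ + 0 → J ∣ω α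
  ev≋0⇒∣ω α e = go (∣ω⇒ (ω.≋0⇒∣ω ρ≋0))
    where
    ρ = conj J ⊠ α
    ρ≋0 : ρ ω.≋ 0ω
    ρ≋0 = ev≋0⇒≋0 ρ (≋-trans (ev-⊠ (conj J) α) (≋0 (ev (conj J)) e))
      (≋-trans (≡⇒≋ (cong ev (trans (conj-* (conj J) α) (trans (cong (_⊠ conj α) (conj-involutive J)) (⊠-comm J (conj α))))))
        (≋-trans (ev-⊠ (conj α) J) (≋0 (ev (conj α)) ev-J)))
    go : (∃ λ κ → ρ ≡ κ ⊠ fromℤ (+ p)) → J ∣ω α
    go (κ , f) = ⇒∣ω κ (fromℤ-cancelˡ (+ p) {{prime⇒nonZero pr}} (begin
      fromℤ (+ p) ⊠ α       ≡⟨ cong (_⊠ α) J⊠J̄ ⟨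
      J ⊠ conj J ⊠ α        ≡⟨ ⊠-assoc J (conj J) α ⟩
      J ⊠ ρ                 ≡⟨ cong (J ⊠_) f ⟩
      J ⊠ (κ ⊠ fromℤ (+ p)) ≡⟨ ⊠-assoc J κ _ ⟨
      J ⊠ κ ⊠ fromℤ (+ p)   ≡⟨ ⊠-comm (J ⊠ κ) _ ⟩
      fromℤ (+ p) ⊠ (J ⊠ κ) ≡⟨ cong (fromℤ (+ p) ⊠_) (⊠-comm J κ) ⟩
      fromℤ (+ p) ⊠ (κ ⊠ J) ∎))
      where open ≡-Reasoning

module DivideByJacobi {p : ℕ} (pr : Prime p) (p∤3 : ¬ (+ p ∣ + 3)) (k : ℕ) (p≡1+3k : p ≡ 1 ℕ.+ 3 ℕ.* k)
                      (r : Zω) (p∣N : + p ∣ normω r) (p∤b : ¬ (+ p ∣ im r)) where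
  open PrimeMod pr
  open ℤmod (+ p)
  private
    a = re r
    b = im r
    b⁻¹ = proj₁ (inverse b p∤b)
    bb⁻¹≋1 = proj₂ (inverse b p∤b)

  -- ω ↦ -a/b is the place at which r = a + bω vanishes, and h² + h + 1 is N(r)/b².
  h : ℤ
  h = - (a * b⁻¹)

  root : + p ∣ h * h + h + + 1
  root = subst (+ p ∣_) (sym (l a b b⁻¹)) (∣m∣n⇒∣m+n (∣n⇒∣m*n (b⁻¹ * b⁻¹) p∣N) (∣m⇒∣m*n (a * b⁻¹ - + 1 - b * b⁻¹) (≋⇒∣ bb⁻¹≋1)))
    where
    l : ∀ a b c → - (a * c) * - (a * c) + - (a * c) + + 1 ≡ c * c * (a * a - a * b + b * b) + (b * c - + 1) * (a * c - + 1 - b * c)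
    l = ℤSolver.solve-∀

  open JacobiSum pr h root p∤3 k p≡1+3k using (J; norm-J)
  open Evaluation pr h root p∤3

  ev-r : ev r ≋ + 0
  ev-r = ∣⇒≋0 (subst (+ p ∣_) (l a b b⁻¹) (∣n⇒∣m*n a (≋⇒∣ (≋-sym bb⁻¹≋1))))
    where
    l : ∀ a b c → a * (+ 1 - b * c) ≡ a + - (a * c) * b
    l = ℤSolver.solve-∀

  private
    J∣r : ∃ λ κ → r ≡ κ ⊠ J
    J∣r = ∣ω⇒ (JacobiDivisibility.ev≋0⇒∣ω pr h root p∤3 k p≡1+3k r ev-r)

  κ : Zω
  κ = proj₁ J∣r

  r≡Jκ : r ≡ J ⊠ κ
  r≡Jκ = trans (proj₂ J∣r) (⊠-comm κ J)

  -- J ≡ -1 modulo 3, so κ ≡ -r.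
  κ-primary : Primary r → Primary κ
  κ-primary (3∤a , 3∣b) = (λ d → 3∤a (Z₃.∣-resp-≋ (Z₃.≋-sym re-r) (∣m⇒∣-m d)))
    , subst (+ 3 ∣_) (ℤₚ.neg-involutive (im κ)) (∣m⇒∣-m (Z₃.∣-resp-≋ im-r 3∣b))
    where
    module Z₃ = ℤmod (+ 3)
    module ω₃ = Zωmodℤ (+ 3)
    r≋-κ : r ω₃.≋ ⊟ κ
    r≋-κ = ω₃.≋-trans (ω₃.≡⇒≋ r≡Jκ) (ω₃.≋-trans (ω₃.*-congʳ-≋ κ (JacobiSymbol.J≋-1 pr h root p∤3 k p≡1+3k))
      (ω₃.≡⇒≋ (Algebra.Properties.Ring.-1*x≈-x (CommutativeRing.ring Zω-commutativeRing) κ)))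
    re-r : re r Z₃.≋ - re κ
    re-r = Z₃.≋-trans (ω₃.≋⇒≋-re r≋-κ) (Z₃.≡⇒≋ (re-⊟ κ))
    im-r : im r Z₃.≋ - im κ
    im-r = Z₃.≋-trans (ω₃.≋⇒≋-im r≋-κ) (Z₃.≡⇒≋ (im-⊟ κ))

  norm-κ : normω r ≡ + p * normω κ
  norm-κ = trans (cong normω r≡Jκ) (trans (normω-* J κ) (cong (_* normω κ) norm-J))

module DivideByRational {p : ℕ} (pr : Prime p) (p∤3 : ¬ (+ p ∣ + 3)) (r : Zω) (p∣r : fromℤ (+ p) ∣ω r) where
  κ : Zω
  κ = proj₁ p∣r

  r≡pκ : r ≡ fromℤ (+ p) ⊠ κ
  r≡pκ = trans (proj₂ p∣r) (trans (sym (⊠≡*ω κ _)) (⊠-comm κ _))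

  κ-primary : Primary r → Primary κ
  κ-primary (3∤a , 3∣b) = (λ d → 3∤a (subst (+ 3 ∣_) (sym (cong re r≡)) (∣n⇒∣m*n (+ p) d)))
    , [ (λ d → ⊥-elim (p∤3 (subst (λ n → + p ∣ + n) (sym (prime∣prime prime-3 pr d)) ∣-refl))) , (λ d → d) ]′ (PrimeMod.euclid prime-3 (+ p) (im κ) (subst (+ 3 ∣_) (cong im r≡) 3∣b))
    where
    r≡ : r ≡ (+ p * re κ) +ω (+ p * im κ) ω
    r≡ = trans r≡pκ (fromℤ-⊠ (+ p) κ)

  norm-κ : normω r ≡ + p * (+ p * normω κ)
  norm-κ = trans (cong normω r≡pκ) (trans (normω-* (fromℤ (+ p)) κ) (trans (cong (_* normω κ) (normω-fromℤ (+ p))) (ℤₚ.*-assoc (+ p) (+ p) (normω κ))))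

private
  smaller : ∀ {p x y} → Prime p → ℤ.∣ x ∣ ≢ 0 → x ≡ + p * y → ℤ.∣ y ∣ ℕ.< ℤ.∣ x ∣
  smaller {p} {x} {y} pr x≢0 e = subst (ℤ.∣ y ∣ ℕ.<_) (sym ∣x∣≡) (ℕₚ.m<m*n ℤ.∣ y ∣ p {{ℕ.≢-nonZero y≢0}} (ℕ.nonTrivial⇒n>1 p {{prime⇒nonTrivial pr}}))
    where
    ∣x∣≡ : ℤ.∣ x ∣ ≡ ℤ.∣ y ∣ ℕ.* p
    ∣x∣≡ = trans (cong ℤ.∣_∣ e) (trans (ℤₚ.abs-* (+ p) y) (ℕₚ.*-comm p ℤ.∣ y ∣))
    y≢0 : ℤ.∣ y ∣ ≢ 0
    y≢0 y≡0 = x≢0 (trans ∣x∣≡ (cong (ℕ._* p) y≡0))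

-- Descent on the norm. All quotients remain primary, so p = 3 never occurs; and an inert p that
-- divides the norm divides r, so when p does not divide r it splits and a Jacobi sum can be
-- removed.
reciprocity : ∀ r → Primary r → SymbolCharacter r
reciprocity r r-primary = go r r-primary (<-wellFounded _)
  where
  go : ∀ r → Primary r → Acc ℕ._<_ ℤ.∣ normω r ∣ → SymbolCharacter r
  go r r-primary (acc rec) = byNorm ℤ.∣ normω r ∣ refl
    where
    N≢0 : ℤ.∣ normω r ∣ ≢ 0
    N≢0 e = primary⇒3∤norm r r-primary (subst (+ 3 ∣_) (sym (ℤₚ.∣i∣≡0⇒i≡0 e)) (divides (+ 0) refl))
    byPrime : (∃ λ p → Prime p × p ℕ∣.∣ ℤ.∣ normω r ∣) → SymbolCharacter r
    byPrime (p , pr , d) = byContent (fromℤ∣ω?)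
      where
      p∣N : + p ∣ normω r
      p∣N = ∣ᵤ⇒∣ d
      p∤3 : ¬ (+ p ∣ + 3)
      p∤3 e = primary⇒3∤norm r r-primary (subst (λ n → + n ∣ normω r) (prime∣prime pr prime-3 e) p∣N)
      fromℤ∣ω? : Dec (fromℤ (+ p) ∣ω r)
      fromℤ∣ω? = Relation.Nullary.Decidable.map′ (Zωmodℤ.≋0⇒∣ω (+ p)) (Zωmodℤ.∣ω⇒≋0 (+ p)) (Zωmodℤ._≋?_ (+ p) r 0ω)
      byContent : Dec (fromℤ (+ p) ∣ω r) → SymbolCharacter r
      byContent (yes p∣r) = subst SymbolCharacter (sym r≡pκ) (ScaleCharacter.scaled pr κ
        (go κ (κ-primary r-primary) (rec (ℕₚ.≤-<-trans (≤-scale) (smaller pr N≢0 norm-κ)))))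
        where
        open DivideByRational pr p∤3 r p∣r
        ≤-scale : ℤ.∣ normω κ ∣ ℕ.≤ ℤ.∣ + p * normω κ ∣
        ≤-scale = subst (ℤ.∣ normω κ ∣ ℕ.≤_) (sym (ℤₚ.abs-* (+ p) (normω κ))) (ℕₚ.m≤n*m ℤ.∣ normω κ ∣ p {{prime⇒nonZero pr}})
      byContent (no p∤r) = byClass (classify p)
        where
        p∤im : ¬ (+ p ∣ im r)
        p∤im p∣b = p∤r (∣⇒fromℤ∣ω p∣a p∣b)
          where
          l : ∀ a b → a * a - a * b + b * b - (b - a) * b ≡ a * a
          l = ℤSolver.solve-∀
          p∣a : + p ∣ re r
          p∣a = [ (λ x → x) , (λ x → x) ]′ (PrimeMod.euclid pr (re r) (re r) (subst (+ p ∣_) (l (re r) (im r)) (∣m∣n⇒∣m-n p∣N (∣n⇒∣m*n (im r - re r) p∣b))))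
        byClass : Class p → SymbolCharacter r
        byClass (divisible k e) = ⊥-elim (Residue.¬divisible pr p∤3 k e)
        byClass (inert k e) = ⊥-elim (p∤r (Residue.inert⇒∣norm⇒∣ω pr {k} e r p∣N))
        byClass (split k e) = subst SymbolCharacter (sym r≡Jκ) (TwistCharacter.twisted pr h root p∤3 k e κ
          (go κ (κ-primary r-primary) (rec (smaller pr N≢0 norm-κ))))
          where open DivideByJacobi pr p∤3 k e r p∣N p∤im
    byNorm : ∀ n → ℤ.∣ normω r ∣ ≡ n → SymbolCharacter r
    byNorm 0 e = ⊥-elim (N≢0 e)
    byNorm 1 e = trivialCharacter r (primary-unit⇒rational r r-primary e) e
    byNorm (suc (suc n)) e = byPrime (prime-divisor _ (subst (1 ℕ.<_) (sym e) (ℕ.s≤s (ℕ.s≤s ℕ.z≤n))))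

-- Values of the character at divisors of 2XY

gcd-reduce′ : ∀ X Y → (X ≡ + 0 → Y ≢ + 0) → ∃ λ g → ∃ λ X′ → ∃ λ Y′ → X ≡ + g * X′ × Y ≡ + g * Y′ × X′ ⟂ Y′
gcd-reduce′ X Y ≢0 = g , _∣_.quotient g∣X , _∣_.quotient g∣Y , X≡ , Y≡ , coprime
  where
  g = ℕG.gcd ℤ.∣ X ∣ ℤ.∣ Y ∣
  g∣X : + g ∣ X
  g∣X = ∣ᵤ⇒∣ (ℕG.gcd[m,n]∣m ℤ.∣ X ∣ ℤ.∣ Y ∣)
  g∣Y : + g ∣ Y
  g∣Y = ∣ᵤ⇒∣ (ℕG.gcd[m,n]∣n ℤ.∣ X ∣ ℤ.∣ Y ∣)
  X≡ : X ≡ + g * _∣_.quotient g∣X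
  X≡ = trans (_∣_.equality g∣X) (ℤₚ.*-comm _ (+ g))
  Y≡ : Y ≡ + g * _∣_.quotient g∣Y
  Y≡ = trans (_∣_.equality g∣Y) (ℤₚ.*-comm _ (+ g))
  g≢0 : g ≢ 0
  g≢0 g≡0 = ≢0 (vanish X≡) (vanish Y≡)
    where
    vanish : ∀ {Z Z′} → Z ≡ + g * Z′ → Z ≡ + 0
    vanish {Z′ = Z′} e = trans e (trans (cong (λ n → + n * Z′) g≡0) (ℤₚ.*-zeroˡ Z′))
  coprime : _∣_.quotient g∣X ⟂ _∣_.quotient g∣Y
  coprime ℓ lr d e = ℕₚ.<⇒≱ (ℕₚ.m<m*n g ℓ {{ℕ.≢-nonZero g≢0}} (ℕ.nonTrivial⇒n>1 ℓ {{prime⇒nonTrivial lr}}))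
    (ℕ∣.∣⇒≤ {{ℕ.≢-nonZero g≢0}} (ℕG.gcd-greatest (multiple X≡ d) (multiple Y≡ e)))
    where
    multiple : ∀ {Z Z′} → Z ≡ + g * Z′ → + ℓ ∣ Z′ → g ℕ.* ℓ ℕ∣.∣ ℤ.∣ Z ∣
    multiple {Z} {Z′} e (divides k f) = ∣⇒∣ᵤ {+ (g ℕ.* ℓ)} (divides k (trans e (trans (cong (+ g *_) f) (trans (l (+ g) k (+ ℓ)) (cong (k *_) (sym (ℤₚ.pos-* g ℓ)))))))
      where
      l : ∀ g k x → g * (k * x) ≡ k * (g * x)
      l = ℤSolver.solve-∀

gcd-reduce : ∀ X Y → X ≢ + 0 → ∃ λ g → ∃ λ X′ → ∃ λ Y′ → X ≡ + g * X′ × Y ≡ + g * Y′ × X′ ⟂ Y′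
gcd-reduce X Y X≢0 = gcd-reduce′ X Y λ e → ⊥-elim (X≢0 e)

∏ : (ℕ → μ₃) → List ℕ → μ₃
∏ f [] = 𝟙
∏ f (q ∷ qs) = f q ∙ ∏ f qs

∏-∙ : ∀ f g qs → ∏ (λ q → f q ∙ g q) qs ≡ ∏ f qs ∙ ∏ g qs
∏-∙ f g [] = refl
∏-∙ f g (q ∷ qs) = trans (cong (f q ∙ g q ∙_) (∏-∙ f g qs))
  (trans (∙-assoc (f q) (g q) _) (trans (cong (f q ∙_) (trans (sym (∙-assoc (g q) (∏ f qs) (∏ g qs))) (trans (cong (_∙ ∏ g qs) (∙-comm (g q) (∏ f qs))) (∙-assoc (∏ f qs) (g q) (∏ g qs)))))
    (sym (∙-assoc (f q) (∏ f qs) _))))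

∏-cong : ∀ {f g} qs → All (λ q → f q ≡ g q) qs → ∏ f qs ≡ ∏ g qs
∏-cong [] [] = refl
∏-cong (q ∷ qs) (e ∷ es) = cong₂ _∙_ e (∏-cong qs es)

∏-𝟙 : ∀ {f} qs → All (λ q → f q ≡ 𝟙) qs → ∏ f qs ≡ 𝟙
∏-𝟙 [] [] = refl
∏-𝟙 (q ∷ qs) (e ∷ es) = cong₂ _∙_ e (∏-𝟙 qs es)

IsPrimeFactor : ℤ → ℕ → Set
IsPrimeFactor a q = Prime q × + q ∣ a

primeFactors : ∀ {n qs} → n ≡ product qs → All Prime qs → All (IsPrimeFactor (+ n)) qs
primeFactors {n} {[]} e [] = []
primeFactors {n} {q ∷ qs} e (qr ∷ qrs) = (qr , divides (+ product qs) (trans (cong +_ e) (trans (ℤₚ.pos-* q (product qs)) (ℤₚ.*-comm (+ q) _))))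
  ∷ All.map (λ (lr , d) → lr , ∣-trans d (divides (+ q) (trans (cong +_ e) (ℤₚ.pos-* q (product qs))))) (primeFactors refl qrs)

module CharacterProperties {r : Zω} (𝐒 : SymbolCharacter r) where
  open SymbolCharacter 𝐒
  private N = normω r

  1⟂ : + 1 ⟂ N
  1⟂ ℓ lr d _ = PrimeMod.p∤1 lr d

  M-1 : M (+ 1) ≡ 𝟙
  M-1 = ∙-cancelˡ (M (+ 1)) (trans (sym (M-* (+ 1) (+ 1) 1⟂ 1⟂)) (sym (∙-identityʳ (M (+ 1)))))

  -1⟂ : - + 1 ⟂ N
  -1⟂ ℓ lr d _ = PrimeMod.p∤1 lr (∣m⇒∣-m d)

  M-neg : ∀ a → a ⟂ N → M (- a) ≡ M a
  M-neg a a⟂ = trans (cong M (sym (ℤₚ.-1*i≡-i a))) (trans (M-* (- + 1) a -1⟂ a⟂)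
    (cong (_∙ M a) (square≡𝟙⇒≡𝟙 _ (trans (sym (M-* (- + 1) (- + 1) -1⟂ -1⟂)) M-1))))

  M-∣∣ : ∀ a → a ⟂ N → M (+ ℤ.∣ a ∣) ≡ M a
  M-∣∣ (+ n) a⟂ = refl
  M-∣∣ ℤ.-[1+ n ] a⟂ = M-neg ℤ.-[1+ n ] a⟂

  M-product : ∀ qs → All Prime qs → + product qs ⟂ N → M (+ product qs) ≡ ∏ (λ q → M (+ q)) qs
  M-product [] [] _ = M-1
  M-product (q ∷ qs) (qr ∷ qrs) ⟂N = trans (cong M (ℤₚ.pos-* q (product qs))) (trans (M-* (+ q) (+ product qs) q⟂ qs⟂) (cong (M (+ q) ∙_) (M-product qs qrs qs⟂)))
    where
    q⟂ : + q ⟂ N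
    q⟂ = ⟂-factorˡ (divides (+ product qs) (trans (ℤₚ.pos-* q (product qs)) (ℤₚ.*-comm (+ q) _))) ⟂N
    qs⟂ : + product qs ⟂ N
    qs⟂ = ⟂-factorˡ (divides (+ q) (ℤₚ.pos-* q (product qs))) ⟂N

  M≡𝟙 : ∀ a → a ≢ + 0 → a ⟂ N → (∀ q → Prime q → + q ∣ a → M (+ q) ≡ 𝟙) → M a ≡ 𝟙
  M≡𝟙 a a≢0 a⟂ trivial = trans (sym (M-∣∣ a a⟂)) (go (factorise ℤ.∣ a ∣ {{ℕ.≢-nonZero λ e → a≢0 (ℤₚ.∣i∣≡0⇒i≡0 e)}}))
    where
    go : PrimeFactorisation ℤ.∣ a ∣ → M (+ ℤ.∣ a ∣) ≡ 𝟙
    go F = trans (cong (λ n → M (+ n)) n≡) (trans (M-product qs qrs (subst (λ n → + n ⟂ N) n≡ (⟂-factorˡ (∣ᵤ⇒∣ ℕ∣.∣-refl) a⟂)))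
      (∏-𝟙 qs (All.map (λ {q} (qr , d) → trivial q qr (∣ᵤ⇒∣ (∣⇒∣ᵤ d))) (primeFactors n≡ qrs))))
      where
      qs = PrimeFactorisation.factors F
      n≡ = PrimeFactorisation.isFactorisation F
      qrs = PrimeFactorisation.factorsPrime F

-- X + 3Y√-3
element : ℤ → ℤ → Zω
element X Y = (X + + 3 * Y) +ω (+ 6 * Y) ω

form : ℤ → ℤ → ℤ
form X Y = X * X + + 27 * (Y * Y)

norm-element : ∀ X Y → normω (element X Y) ≡ form X Y
norm-element = l
  where
  l : ∀ X Y → (X + + 3 * Y) * (X + + 3 * Y) - (X + + 3 * Y) * (+ 6 * Y) + + 6 * Y * (+ 6 * Y) ≡ X * X + + 27 * (Y * Y)
  l = ℤSolver.solve-∀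

element-primary : ∀ X Y → ¬ (+ 3 ∣ X) → Primary (element X Y)
element-primary X Y 3∤X = (λ d → 3∤X (subst (+ 3 ∣_) (l X Y) (∣m∣n⇒∣m-n d (∣m⇒∣m*n Y ∣-refl)))) , divides (+ 2 * Y) (l′ Y)
  where
  l : ∀ X Y → X + + 3 * Y - + 3 * Y ≡ X
  l = ℤSolver.solve-∀
  l′ : ∀ Y → + 6 * Y ≡ + 2 * Y * + 3
  l′ = ℤSolver.solve-∀

element≡ : ∀ X Y → element X Y ≡ fromℤ X ⊞ fromℤ (+ 3 * Y) ⊠ √-3
element≡ X Y = sym (cong₂ _+ω_ω (trans (re-⊞ _ _) (trans (cong (λ α → X + re α) (fromℤ-⊠ (+ 3 * Y) √-3)) (l₁ X Y))) (trans (im-⊞ _ _) (trans (cong (λ α → + 0 + im α) (fromℤ-⊠ (+ 3 * Y) √-3)) (l₂ Y))))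
  where
  l₁ : ∀ X Y → X + + 3 * Y * + 1 ≡ X + + 3 * Y
  l₁ = ℤSolver.solve-∀
  l₂ : ∀ Y → + 0 + + 3 * Y * + 2 ≡ + 6 * Y
  l₂ = ℤSolver.solve-∀

module _ {q : ℕ} (qr : Prime q) (q∤3 : ¬ (+ q ∣ + 3)) (C : Class q) where
  open Residue qr
  open Zωmodℤ (+ q)
  private module Z = ℤmod (+ q)
  open PrimeMod qr using (∤-*; euclid)

  res-element-∣Y : ∀ X Y → ¬ (+ q ∣ form X Y) → + q ∣ Y → res C (element X Y) ≡ 𝟙
  res-element-∣Y X Y q∤N q∣Y = trans (sym (res-cong q∤3 C (∤norm-fromℤ q∤3 q∤X) (components
      (Z.≋-sym (Z.≋-trans (Z.+-cong-≋ (Z.≋-refl {X}) (Z.∣⇒≋0 (∣n⇒∣m*n (+ 3) q∣Y))) (Z.≡⇒≋ (ℤₚ.+-identityʳ X)))) (Z.≋-sym (Z.∣⇒≋0 (∣n⇒∣m*n (+ 6) q∣Y))))))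
    (res-fromℤ q∤3 C X q∤X)
    where
    q∤X : ¬ (+ q ∣ X)
    q∤X d = q∤N (∣m∣n⇒∣m+n (∣m⇒∣m*n X d) (∣n⇒∣m*n (+ 27) (∣m⇒∣m*n Y q∣Y)))

  res-element-∣X : ∀ X Y → ¬ (+ q ∣ form X Y) → + q ∣ X → res C (element X Y) ≡ 𝟙
  res-element-∣X X Y q∤N q∣X = trans (sym (res-cong q∤3 C q∤ (≋-trans (≡⇒≋ (sym (⊞-identityˡ _))) (≋-trans (+-cong-≋ (≋-sym (fromℤ-cong (Z.∣⇒≋0 q∣X))) ≋-refl) (≡⇒≋ (sym (element≡ X Y)))))))
    (trans (res-scale q∤3 C (+ 3 * Y) √-3 q∤3Y q∤3) (res-√-3 q∤3 C))
    where
    q∤Y : ¬ (+ q ∣ Y)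
    q∤Y d = q∤N (∣m∣n⇒∣m+n (∣m⇒∣m*n X q∣X) (∣n⇒∣m*n (+ 27) (∣m⇒∣m*n Y d)))
    q∤3Y : ¬ (+ q ∣ + 3 * Y)
    q∤3Y = ∤-* q∤3 q∤Y
    q∤ : ¬ (+ q ∣ normω (fromℤ (+ 3 * Y) ⊠ √-3))
    q∤ d = ∤-* (∤norm-fromℤ q∤3 q∤3Y) q∤3 (subst (+ q ∣_) (normω-* (fromℤ (+ 3 * Y)) √-3) d)

  -- The ω-coordinate 6Y vanishes modulo 2, so the element is rational there.
  res-element-∣2 : ∀ X Y → ¬ (+ q ∣ form X Y) → + q ∣ + 2 → res C (element X Y) ≡ 𝟙
  res-element-∣2 X Y q∤N q∣2 = trans (sym (res-cong q∤3 C (∤norm-fromℤ q∤3 q∤X+3Y) (components Z.≋-refl (Z.≋-sym (Z.∣⇒≋0 (∣m⇒∣m*n Y (∣-trans q∣2 (divides (+ 3) refl))))))))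
    (res-fromℤ q∤3 C (X + + 3 * Y) q∤X+3Y)
    where
    l : ∀ X Y → (X + + 3 * Y) * (X + + 3 * Y) + + 2 * (+ 9 * (Y * Y) - + 3 * (X * Y)) ≡ X * X + + 27 * (Y * Y)
    l = ℤSolver.solve-∀
    q∤X+3Y : ¬ (+ q ∣ X + + 3 * Y)
    q∤X+3Y d = q∤N (subst (+ q ∣_) (l X Y) (∣m∣n⇒∣m+n (∣m⇒∣m*n (X + + 3 * Y) d) (∣m⇒∣m*n (+ 9 * (Y * Y) - + 3 * (X * Y)) q∣2)))

  res-element-∣2XY : ∀ X Y → ¬ (+ q ∣ form X Y) → + q ∣ + 2 * (X * Y) → res C (element X Y) ≡ 𝟙
  res-element-∣2XY X Y q∤N d = [ res-element-∣2 X Y q∤N , (λ e → [ res-element-∣X X Y q∤N , res-element-∣Y X Y q∤N ]′ (euclid X Y e)) ]′ (euclid (+ 2) (X * Y) d)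

module ElementCharacter (X Y : ℤ) (3∤X : ¬ (+ 3 ∣ X)) (X⟂Y : X ⟂ Y) (𝐒 : SymbolCharacter (element X Y)) where
  open SymbolCharacter 𝐒
  open CharacterProperties 𝐒
  private N = normω (element X Y)

  ∣N⇒∣form : ∀ {ℓ} → + ℓ ∣ N → + ℓ ∣ form X Y
  ∣N⇒∣form {ℓ} = subst (+ ℓ ∣_) (norm-element X Y)

  ∣form⇒∣N : ∀ {ℓ} → + ℓ ∣ form X Y → + ℓ ∣ N
  ∣form⇒∣N {ℓ} = subst (+ ℓ ∣_) (sym (norm-element X Y))

  3∤N : ¬ (+ 3 ∣ N)
  3∤N = primary⇒3∤norm (element X Y) (element-primary X Y 3∤X)

  3⟂N : + 3 ⟂ N
  3⟂N = prime⟂ prime-3 3∤N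

  X≢0 : X ≢ + 0
  X≢0 e = 3∤X (divides (+ 0) e)

  X⟂N : X ⟂ N
  X⟂N ℓ lr d e = [ (λ ℓ∣27 → 3∤X (subst (λ n → + n ∣ X) (prime∣prime lr prime-3 (PrimeMod.∣-^ lr (+ 3) 3 ℓ∣27)) d))
    , (λ ℓ∣YY → [ X⟂Y ℓ lr d , X⟂Y ℓ lr d ]′ (PrimeMod.euclid lr Y Y ℓ∣YY)) ]′
    (PrimeMod.euclid lr (+ 27) (Y * Y) (subst (+ ℓ ∣_) (l (X * X) (+ 27 * (Y * Y))) (∣m∣n⇒∣m-n (∣N⇒∣form e) (∣m⇒∣m*n X d))))
    where
    l : ∀ a b → a + b - a ≡ b
    l = ℤSolver.solve-∀

  Y⟂N : Y ⟂ N
  Y⟂N ℓ lr d e = [ (λ f → X⟂Y ℓ lr f d) , (λ f → X⟂Y ℓ lr f d) ]′ (PrimeMod.euclid lr X X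
    (subst (+ ℓ ∣_) (l (X * X) (+ 27 * (Y * Y))) (∣m∣n⇒∣m-n (∣N⇒∣form e) (∣n⇒∣m*n (+ 27) (∣m⇒∣m*n Y d)))))
    where
    l : ∀ a b → a + b - b ≡ a
    l = ℤSolver.solve-∀

  M-prime∣2XY : ∀ q → Prime q → ¬ (+ q ∣ + 3) → ¬ (+ q ∣ N) → + q ∣ + 2 * (X * Y) → M (+ q) ≡ 𝟙
  M-prime∣2XY q qr q∤3 q∤N d = trans (M-res qr (classify q) q∤3 q∤N) (res-element-∣2XY qr q∤3 (classify q) X Y (λ e → q∤N (∣form⇒∣N e)) d)

  -- X² ≡ -27Y² modulo the norm, where only the 3-part of Y contributes.
  M-3-exact : + 3 ∣ Y → ¬ (+ 9 ∣ Y) → M (+ 3) ≡ 𝟙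
  M-3-exact (divides Y′ Y≡) 9∤Y = fifth (M (+ 3)) (trans (sym M[243Y′²]) (trans (sym (M-cong (⟂-*ˡ X⟂N X⟂N) N∣)) (trans (M-* X X X⟂N X⟂N) (cong₂ _∙_ MX≡𝟙 MX≡𝟙))))
    where
    -- With Y = 3Y′ the number 27Y² is 3⁵Y′², and the exponent 5 is prime to 3.
    fifth : ∀ m → m ∙ (m ∙ (m ∙ (m ∙ (m ∙ 𝟙)))) ≡ 𝟙 → m ≡ 𝟙
    fifth 𝟙 _ = refl
    3∤Y′ : ¬ (+ 3 ∣ Y′)
    3∤Y′ (divides Z Y′≡) = 9∤Y (divides Z (trans Y≡ (trans (cong (_* + 3) Y′≡) (l Z))))
      where
      l : ∀ Z → Z * + 3 * + 3 ≡ Z * + 9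
      l = ℤSolver.solve-∀
    Y′⟂N : Y′ ⟂ N
    Y′⟂N = ⟂-factorˡ (divides (+ 3) (trans Y≡ (ℤₚ.*-comm Y′ (+ 3)))) Y⟂N
    MX≡𝟙 : M X ≡ 𝟙
    MX≡𝟙 = M≡𝟙 X X≢0 X⟂N λ q qr d → M-prime∣2XY q qr (λ e → 3∤X (subst (λ n → + n ∣ X) (prime∣prime qr prime-3 e) d)) (X⟂N q qr d) (∣n⇒∣m*n (+ 2) (∣m⇒∣m*n Y d))
    MY′≡𝟙 : M Y′ ≡ 𝟙
    MY′≡𝟙 = M≡𝟙 Y′ (λ e → 3∤Y′ (divides (+ 0) e)) Y′⟂N λ q qr d → M-prime∣2XY q qr (λ e → 3∤Y′ (subst (λ n → + n ∣ Y′) (prime∣prime qr prime-3 e) d)) (Y′⟂N q qr d)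
      (∣n⇒∣m*n (+ 2) (∣n⇒∣m*n X (subst (+ q ∣_) (sym Y≡) (∣m⇒∣m*n (+ 3) d))))
    3* : ∀ {a} → a ⟂ N → + 3 * a ⟂ N
    3* = ⟂-*ˡ 3⟂N
    Y′Y′ = ⟂-*ˡ Y′⟂N Y′⟂N
    target = - (+ 3 * (+ 3 * (+ 3 * (+ 3 * (+ 3 * (Y′ * Y′))))))
    M[243Y′²] : M target ≡ M (+ 3) ∙ (M (+ 3) ∙ (M (+ 3) ∙ (M (+ 3) ∙ (M (+ 3) ∙ 𝟙))))
    M[243Y′²] = trans (M-neg _ (3* (3* (3* (3* (3* Y′Y′))))))
      (step (3* (3* (3* (3* Y′Y′)))) (step (3* (3* (3* Y′Y′))) (step (3* (3* Y′Y′)) (step (3* Y′Y′) (step Y′Y′ (trans (M-* Y′ Y′ Y′⟂N Y′⟂N) (cong₂ _∙_ MY′≡𝟙 MY′≡𝟙)))))))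
      where
      step : ∀ {a x} → a ⟂ N → M a ≡ x → M (+ 3 * a) ≡ M (+ 3) ∙ x
      step {a} a⟂ e = trans (M-* (+ 3) a 3⟂N a⟂) (cong (M (+ 3) ∙_) e)
    N∣ : N ∣ X * X - target
    N∣ = divides (+ 1) (trans (l X Y′) (sym (trans (ℤₚ.*-identityˡ N) (trans (norm-element X Y) (cong (form X) Y≡)))))
      where
      l : ∀ X Y → X * X - - (+ 3 * (+ 3 * (+ 3 * (+ 3 * (+ 3 * (Y * Y)))))) ≡ X * X + + 27 * (Y * + 3 * (Y * + 3))
      l = ℤSolver.solve-∀

-- If 9 ∣ Y, the previous argument may only see a power M(3)^{3j}; multiplying by 1 + 9√-3 brings the exponent back to 1.
module Supplement (X Y : ℤ) (3∤X : ¬ (+ 3 ∣ X)) (X⟂Y : X ⟂ Y) (𝐒 : SymbolCharacter (element X Y)) (9∣Y : + 9 ∣ Y) where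
  open SymbolCharacter 𝐒
  private
    r = element X Y
    r₀ = element (+ 1) (+ 3)
    -- (X + 3Y√-3)(1 + 9√-3) = X₁ + 3Y₁√-3. As 9 divides Y but 3 does not divide X, Y₁ is divisible
    -- by 3 and not by 9.
    X₁ = X - + 81 * Y
    Y₁ = + 3 * X + Y

    3∤1 : ¬ (+ 3 ∣ + 1)
    3∤1 = PrimeMod.p∤1 prime-3

    3∣Y : + 3 ∣ Y
    3∣Y = ∣-trans (divides (+ 3) refl) 9∣Y

    𝐒₀ = reciprocity r₀ (element-primary (+ 1) (+ 3) 3∤1)
    module S₀ = SymbolCharacter 𝐒₀
    module E₀ = ElementCharacter (+ 1) (+ 3) 3∤1 (λ ℓ lr d _ → PrimeMod.p∤1 lr d) 𝐒₀
    module E = ElementCharacter X Y 3∤X X⟂Y 𝐒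

    9∤3 : ¬ (+ 9 ∣ + 3)
    9∤3 d = ℕₚ.<⇒≱ (ℕ.s≤s (ℕ.s≤s (ℕ.s≤s (ℕ.s≤s ℕ.z≤n)))) (ℕ∣.∣⇒≤ (∣⇒∣ᵤ d))

    3∤X₁ : ¬ (+ 3 ∣ X₁)
    3∤X₁ d = 3∤X (subst (+ 3 ∣_) (l X Y) (∣m∣n⇒∣m+n d (∣n⇒∣m*n (+ 81) 3∣Y)))
      where
      l : ∀ X Y → X - + 81 * Y + + 81 * Y ≡ X
      l = ℤSolver.solve-∀

    3∣Y₁ : + 3 ∣ Y₁
    3∣Y₁ = ∣m∣n⇒∣m+n (∣m⇒∣m*n X ∣-refl) 3∣Y

    9∤Y₁ : ¬ (+ 9 ∣ Y₁)
    9∤Y₁ d = 3∤X (third (subst (+ 9 ∣_) (l X Y) (∣m∣n⇒∣m-n d 9∣Y)))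
      where
      l : ∀ X Y → + 3 * X + Y - Y ≡ + 3 * X
      l = ℤSolver.solve-∀
      third : + 9 ∣ + 3 * X → + 3 ∣ X
      third (divides k e) = divides k (ℤₚ.*-cancelˡ-≡ (+ 3) X (k * + 3) (trans e (l′ k)))
        where
        l′ : ∀ k → k * + 9 ≡ + 3 * (k * + 3)
        l′ = ℤSolver.solve-∀

    product-element : r ⊠ r₀ ≡ element X₁ Y₁
    product-element = cong₂ _+ω_ω (trans (re-⊠ r r₀) (l₁ X Y)) (trans (im-⊠ r r₀) (l₂ X Y))
      where
      l₁ : ∀ X Y → (X + + 3 * Y) * + 10 - + 6 * Y * + 18 ≡ (X - + 81 * Y) + + 3 * (+ 3 * X + Y)
      l₁ = ℤSolver.solve-∀
      l₂ : ∀ X Y → (X + + 3 * Y) * + 18 + + 6 * Y * + 10 - + 6 * Y * + 18 ≡ + 6 * (+ 3 * X + Y)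
      l₂ = ℤSolver.solve-∀

  M-3 : M (+ 3) ≡ 𝟙
  M-3 = reduced (gcd-reduce X₁ Y₁ λ e → 3∤X₁ (divides (+ 0) e))
    where
    reduced : (∃ λ g → ∃ λ X₂ → ∃ λ Y₂ → X₁ ≡ + g * X₂ × Y₁ ≡ + g * Y₂ × X₂ ⟂ Y₂) → M (+ 3) ≡ 𝟙
    reduced (g , X₂ , Y₂ , X₁≡ , Y₁≡ , X₂⟂Y₂) = trans (sym (∙-identityʳ (M (+ 3)))) (trans (cong (M (+ 3) ∙_) (sym M₀3≡𝟙)) (trans (cong₂ _∙_ (sym M[m]) (sym M₀[m]))
      (trans (cong₂ _∙_ (CharacterProperties.M-product 𝐒 qs qrs (m⟂ N∣)) (CharacterProperties.M-product 𝐒₀ qs qrs (m⟂ N₀∣)))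
        (trans (sym (∏-∙ (λ q → M (+ q)) (λ q → S₀.M (+ q)) qs)) (trans (∏-cong qs (All.map (λ {q} (qr , d) → primewise q qr d) (primeFactors refl qrs)))
          (trans (sym (CharacterProperties.M-product 𝐒₂ qs qrs (m⟂ N₂∣))) (trans M₂[m] M₂3≡𝟙)))))))
      where
      r₂ = element X₂ Y₂
      3∤g : ¬ (+ 3 ∣ + g)
      3∤g d = 3∤X₁ (subst (+ 3 ∣_) (sym X₁≡) (∣m⇒∣m*n X₂ d))
      3∤X₂ : ¬ (+ 3 ∣ X₂)
      3∤X₂ d = 3∤X₁ (subst (+ 3 ∣_) (sym X₁≡) (∣n⇒∣m*n (+ g) d))
      3∣Y₂ : + 3 ∣ Y₂
      3∣Y₂ = [ (λ d → ⊥-elim (3∤g d)) , (λ d → d) ]′ (PrimeMod.euclid prime-3 (+ g) Y₂ (subst (+ 3 ∣_) Y₁≡ 3∣Y₁))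
      9∤Y₂ : ¬ (+ 9 ∣ Y₂)
      9∤Y₂ d = 9∤Y₁ (subst (+ 9 ∣_) (sym Y₁≡) (∣n⇒∣m*n (+ g) d))
      𝐒₂ = reciprocity r₂ (element-primary X₂ Y₂ 3∤X₂)
      module S₂ = SymbolCharacter 𝐒₂
      module E₂ = ElementCharacter X₂ Y₂ 3∤X₂ X₂⟂Y₂ 𝐒₂
      M₀3≡𝟙 : S₀.M (+ 3) ≡ 𝟙
      M₀3≡𝟙 = E₀.M-3-exact ∣-refl 9∤3
      M₂3≡𝟙 : S₂.M (+ 3) ≡ 𝟙
      M₂3≡𝟙 = E₂.M-3-exact 3∣Y₂ 9∤Y₂
      rr₀≡ : r ⊠ r₀ ≡ fromℤ (+ g) ⊠ r₂
      rr₀≡ = trans product-element (sym (trans (fromℤ-⊠ (+ g) r₂) (cong₂ _+ω_ω (trans (l₁ (+ g) X₂ Y₂) (cong₂ (λ a b → a + + 3 * b) (sym X₁≡) (sym Y₁≡))) (trans (l₂ (+ g) Y₂) (cong (+ 6 *_) (sym Y₁≡))))))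
        where
        l₁ : ∀ g x y → g * (x + + 3 * y) ≡ g * x + + 3 * (g * y)
        l₁ = ℤSolver.solve-∀
        l₂ : ∀ g y → g * (+ 6 * y) ≡ + 6 * (g * y)
        l₂ = ℤSolver.solve-∀
      NN₀ = normω r * normω r₀
      NN₀≡ : NN₀ ≡ + g * + g * normω r₂
      NN₀≡ = trans (sym (normω-* r r₀)) (trans (cong normω rr₀≡) (trans (normω-* (fromℤ (+ g)) r₂) (cong (_* normω r₂) (normω-fromℤ (+ g)))))
      N∣ : normω r ∣ NN₀
      N∣ = ∣m⇒∣m*n (normω r₀) ∣-refl
      N₀∣ : normω r₀ ∣ NN₀
      N₀∣ = ∣n⇒∣m*n (normω r) ∣-refl
      N₂∣ : normω r₂ ∣ NN₀
      N₂∣ = divides (+ g * + g) NN₀≡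
      3∤NN₀ : ¬ (+ 3 ∣ NN₀)
      3∤NN₀ = PrimeMod.∤-* prime-3 E.3∤N E₀.3∤N
      -- The characters of r, r₀ and r₂ can be compared only at primes other than 3, through
      -- reciprocity. So 3 is replaced by a number congruent to 3 modulo all three norms; it is
      -- prime to 3 and to the norms because 3 does not divide their product.
      m : ℕ
      m = 3 ℕ.+ ℤ.∣ NN₀ ∣
      F = factorise m
      qs = PrimeFactorisation.factors F
      qrs = PrimeFactorisation.factorsPrime F
      m≡ : + product qs ≡ + 3 + + ℤ.∣ NN₀ ∣
      m≡ = cong +_ (sym (PrimeFactorisation.isFactorisation F))
      m⟂NN₀ : + product qs ⟂ NN₀
      m⟂NN₀ ℓ lr d e = 3∤NN₀ (subst (λ n → + n ∣ NN₀) (prime∣prime lr prime-3 (subst (+ ℓ ∣_) (trans (cong (_- + ℤ.∣ NN₀ ∣) m≡) (l (+ ℤ.∣ NN₀ ∣))) (∣m∣n⇒∣m-n d (∣ᵤ⇒∣ {+ ℓ} {+ ℤ.∣ NN₀ ∣} (∣⇒∣ᵤ e))))) e)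
        where
        l : ∀ n → + 3 + n - n ≡ + 3
        l = ℤSolver.solve-∀
      m⟂ : ∀ {b} → b ∣ NN₀ → + product qs ⟂ b
      m⟂ b∣ = ⟂-factorʳ b∣ m⟂NN₀
      m-3 : ∀ {b} → b ∣ NN₀ → b ∣ + product qs - + 3
      m-3 {b} b∣ = subst (b ∣_) (sym (trans (cong (_- + 3) m≡) (l (+ ℤ.∣ NN₀ ∣)))) (∣-trans b∣ (∣ᵤ⇒∣ ℕ∣.∣-refl))
        where
        l : ∀ n → + 3 + n - + 3 ≡ n
        l = ℤSolver.solve-∀
      M[m] : M (+ product qs) ≡ M (+ 3)
      M[m] = M-cong (m⟂ N∣) (m-3 N∣)
      M₀[m] : S₀.M (+ product qs) ≡ S₀.M (+ 3)
      M₀[m] = S₀.M-cong (m⟂ N₀∣) (m-3 N₀∣)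
      M₂[m] : S₂.M (+ product qs) ≡ S₂.M (+ 3)
      M₂[m] = S₂.M-cong (m⟂ N₂∣) (m-3 N₂∣)
      primewise : ∀ q → Prime q → + q ∣ + product qs → M (+ q) ∙ S₀.M (+ q) ≡ S₂.M (+ q)
      primewise q qr d = trans (cong₂ _∙_ (M-res qr C q∤3 (q∤ N∣)) (S₀.M-res qr C q∤3 (q∤ N₀∣)))
        (trans (sym (Residue.res-* qr q∤3 C r r₀ (q∤ N∣) (q∤ N₀∣))) (trans (cong (Residue.res qr C) rr₀≡)
          (trans (Residue.res-scale qr q∤3 C (+ g) r₂ (λ e → q∤NN₀ (subst (+ q ∣_) (sym NN₀≡) (∣m⇒∣m*n (normω r₂) (∣m⇒∣m*n (+ g) e)))) (q∤ N₂∣)) (sym (S₂.M-res qr C q∤3 (q∤ N₂∣))))))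
        where
        C = classify q
        q∤NN₀ : ¬ (+ q ∣ NN₀)
        q∤NN₀ = m⟂NN₀ q qr d
        q∤ : ∀ {b} → b ∣ NN₀ → ¬ (+ q ∣ b)
        q∤ b∣ e = q∤NN₀ (∣-trans e b∣)
        q∤3 : ¬ (+ q ∣ + 3)
        q∤3 e = 3∤NN₀ (∣ᵤ⇒∣ (∣⇒∣ᵤ (subst (+ 3 ∣_) (trans (cong (_- + 3) m≡) (l (+ ℤ.∣ NN₀ ∣))) (∣m∣n⇒∣m-n (subst (λ n → + n ∣ + product qs) (prime∣prime qr prime-3 e) d) ∣-refl))))
          where
          l : ∀ n → + 3 + n - + 3 ≡ n
          l = ℤSolver.solve-∀

module KeyLemma (X Y : ℤ) (3∤X : ¬ (+ 3 ∣ X)) (X⟂Y : X ⟂ Y) (𝐒 : SymbolCharacter (element X Y)) where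
  open SymbolCharacter 𝐒
  open CharacterProperties 𝐒
  open ElementCharacter X Y 3∤X X⟂Y 𝐒
  private N = normω (element X Y)

  M-3 : + 3 ∣ Y → M (+ 3) ≡ 𝟙
  M-3 3∣Y with + 9 ∣? Y
  ... | yes 9∣Y = Supplement.M-3 X Y 3∤X X⟂Y 𝐒 9∣Y
  ... | no 9∤Y = M-3-exact 3∣Y 9∤Y

  M-∣2XY : ∀ P → P ≢ + 0 → P ⟂ N → (∀ q → Prime q → + q ∣ P → + q ∣ + 2 * (X * Y)) → M P ≡ 𝟙
  M-∣2XY P P≢0 P⟂N primes = M≡𝟙 P P≢0 P⟂N λ q qr d → byPrime q qr d (+ q ∣? + 3)
    where
    byPrime : ∀ q → Prime q → + q ∣ P → Dec (+ q ∣ + 3) → M (+ q) ≡ 𝟙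
    byPrime q qr d (no q∤3) = M-prime∣2XY q qr q∤3 (P⟂N q qr d) (primes q qr d)
    byPrime q qr d (yes q∣3) = trans (cong (λ n → M (+ n)) q≡3) (M-3 ([ (λ e → ⊥-elim (3∤2 e)) , (λ e → [ (λ f → ⊥-elim (3∤X f)) , (λ f → f) ]′ (PrimeMod.euclid prime-3 X Y e)) ]′
      (PrimeMod.euclid prime-3 (+ 2) (X * Y) (subst (λ n → + n ∣ + 2 * (X * Y)) q≡3 (primes q qr d)))))
      where
      q≡3 = prime∣prime qr prime-3 q∣3
      3∤2 : ¬ (+ 3 ∣ + 2)
      3∤2 e = ℕₚ.<⇒≱ (ℕ.s≤s (ℕ.s≤s (ℕ.s≤s ℕ.z≤n))) (ℕ∣.∣⇒≤ (∣⇒∣ᵤ e))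

  -- P and Q collect the rational factors that separate n from a cube modulo the norm; M is trivial
  -- on both.
  M-congruence : ∀ n P Q m → P ≢ + 0 → Q ≢ + 0 → n ⟂ N → P ⟂ N → Q ⟂ N → m ⟂ N →
    (∀ q → Prime q → + q ∣ P * Q → + q ∣ + 2 * (X * Y)) → N ∣ P * n - Q * (m * (m * m)) → M n ≡ 𝟙
  M-congruence n P Q m P≢0 Q≢0 n⟂ P⟂ Q⟂ m⟂ primes N∣ = begin
    M n                          ≡⟨ cong (_∙ M n) (M-∣2XY P P≢0 P⟂ λ q qr d → primes q qr (∣m⇒∣m*n Q d)) ⟨
    M P ∙ M n                    ≡⟨ M-* P n P⟂ n⟂ ⟨
    M (P * n)                    ≡⟨ M-cong (⟂-*ˡ P⟂ n⟂) N∣ ⟩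
    M (Q * (m * (m * m)))        ≡⟨ M-* Q (m * (m * m)) Q⟂ (⟂-*ˡ m⟂ (⟂-*ˡ m⟂ m⟂)) ⟩
    M Q ∙ M (m * (m * m))        ≡⟨ cong₂ _∙_ (M-∣2XY Q Q≢0 Q⟂ λ q qr d → primes q qr (∣n⇒∣m*n P d))
                                              (trans (M-* m (m * m) m⟂ (⟂-*ˡ m⟂ m⟂)) (trans (cong (M m ∙_) (M-* m m m⟂ m⟂)) (cube≡𝟙 (M m)))) ⟩
    𝟙                            ∎
    where open ≡-Reasoning

-- Prime factorisations in Z[ω]

normω≡0⇒≡0 : ∀ α → normω α ≡ + 0 → α ≡ 0ω
normω≡0⇒≡0 α N≡0 = cong₂ _+ω_ω a≡0 b≡0
  where
  a = re α
  b = im α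
  square≡0 : ∀ x → x * x ≡ + 0 → x ≡ + 0
  square≡0 x e = [ (λ z → z) , (λ z → z) ]′ (ℤₚ.i*j≡0⇒i≡0∨j≡0 x e)
  sum≡0 : ℤ.∣ + 2 * a - b ∣ ℕ.* ℤ.∣ + 2 * a - b ∣ ℕ.+ 3 ℕ.* (ℤ.∣ b ∣ ℕ.* ℤ.∣ b ∣) ≡ 0
  sum≡0 = ℤₚ.+-injective (trans (sym (4normω α)) (cong (+ 4 *_) N≡0))
  b≡0 : b ≡ + 0
  b≡0 = square≡0 b (trans (x²≡∣x∣² b) (cong +_ ([ (λ ()) , (λ e → e) ]′ (ℕₚ.m*n≡0⇒m≡0∨n≡0 3 (ℕₚ.m+n≡0⇒n≡0 (ℤ.∣ + 2 * a - b ∣ ℕ.* ℤ.∣ + 2 * a - b ∣) sum≡0)))))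
  a≡0 : a ≡ + 0
  a≡0 = square≡0 a (trans (sym (trans (cong (λ b → a * a - a * b + b * b) b≡0) (l′ a))) N≡0)
    where
    l′ : ∀ a → a * a - a * + 0 + + 0 * + 0 ≡ a * a
    l′ = ℤSolver.solve-∀

⊠-cancelˡ : ∀ γ {α β} → γ ≢ 0ω → γ ⊠ α ≡ γ ⊠ β → α ≡ β
⊠-cancelˡ γ {α} {β} γ≢0 e = fromℤ-cancelˡ (normω γ) {{ℤ.≢-nonZero λ N≡0 → γ≢0 (normω≡0⇒≡0 γ N≡0)}}
  (trans (sym (l α)) (trans (cong (conj γ ⊠_) e) (l β)))
  where
  l : ∀ α → conj γ ⊠ (γ ⊠ α) ≡ fromℤ (normω γ) ⊠ α
  l α = trans (sym (⊠-assoc (conj γ) γ α)) (cong (_⊠ α) (trans (⊠-comm (conj γ) γ) (⊠-conj γ)))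

∣ω-trans : ∀ {π ρ α} → π ∣ω ρ → ρ ∣ω α → π ∣ω α
∣ω-trans {π} {ρ} {α} d e = go (∣ω⇒ d) (∣ω⇒ e)
  where
  go : (∃ λ κ → ρ ≡ κ ⊠ π) → (∃ λ κ → α ≡ κ ⊠ ρ) → π ∣ω α
  go (κ , e) (μ , f) = ⇒∣ω (μ ⊠ κ) (trans f (trans (cong (μ ⊠_) e) (sym (⊠-assoc μ κ π))))

∣ω-refl : ∀ {π} → π ∣ω π
∣ω-refl {π} = ⇒∣ω 1ω (sym (⊠-identityˡ π))

unit⇒ : ∀ {ε} → IsUnitω ε → ∃ λ υ → ε ⊠ υ ≡ 1ω
unit⇒ {ε} (υ , e) = υ , trans (⊠≡*ω ε υ) e

⇒unit : ∀ {ε} υ → ε ⊠ υ ≡ 1ω → IsUnitω ε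
⇒unit {ε} υ e = υ , trans (sym (⊠≡*ω ε υ)) e

∣unit⇒unit : ∀ {π ε} → π ∣ω ε → IsUnitω ε → IsUnitω π
∣unit⇒unit {π} {ε} d u = go (∣ω⇒ d) (unit⇒ u)
  where
  go : (∃ λ κ → ε ≡ κ ⊠ π) → (∃ λ υ → ε ⊠ υ ≡ 1ω) → IsUnitω π
  go (κ , e) (υ , f) = ⇒unit (κ ⊠ υ) (trans (sym (⊠-assoc π κ υ)) (trans (cong (_⊠ υ) (trans (⊠-comm π κ) (sym e))) f))

unit-* : ∀ {ε η} → IsUnitω ε → IsUnitω η → IsUnitω (ε ⊠ η)
unit-* {ε} {η} u v = go (unit⇒ u) (unit⇒ v)
  where
  go : (∃ λ υ → ε ⊠ υ ≡ 1ω) → (∃ λ υ → η ⊠ υ ≡ 1ω) → IsUnitω (ε ⊠ η)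
  go (υ , e) (υ′ , f) = ⇒unit (υ ⊠ υ′) (trans (⊠-interchange ε η υ υ′) (trans (cong₂ _⊠_ e f) (⊠-identityˡ 1ω)))

unit-norm : ∀ {ε} → IsUnitω ε → ℤ.∣ normω ε ∣ ≡ 1
unit-norm {ε} u = go (unit⇒ u)
  where
  go : (∃ λ υ → ε ⊠ υ ≡ 1ω) → ℤ.∣ normω ε ∣ ≡ 1
  go (υ , e) = ℕₚ.m*n≡1⇒m≡1 ℤ.∣ normω ε ∣ ℤ.∣ normω υ ∣ (trans (sym (ℤₚ.abs-* (normω ε) (normω υ))) (cong ℤ.∣_∣ (trans (sym (normω-* ε υ)) (cong normω e))))

prime-split : ∀ {π α β} → IsPrimeω π → π ∣ω (α ⊠ β) → π ∣ω α ⊎ π ∣ω β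
prime-split {π} {α} {β} (_ , _ , euclid) d = euclid α β (subst (π ∣ω_) (⊠≡*ω α β) d)

-- π′ divides κπ. If it divides κ, cancellation makes π a unit, which is excluded; so it divides π,
-- and cancellation makes κ a unit.
associate : ∀ {π π′} → IsPrimeω π → IsPrimeω π′ → π ∣ω π′ → ∃ λ κ → π′ ≡ κ ⊠ π × IsUnitω κ
associate {π} {π′} πp@(_ , ¬unit , _) πp′@(π′≢0 , _ , _) d = go (∣ω⇒ d)
  where
  go : (∃ λ κ → π′ ≡ κ ⊠ π) → ∃ λ κ → π′ ≡ κ ⊠ π × IsUnitω κ
  go (κ , e) = κ , e , [ (λ d → ⊥-elim (¬unit (fromκ (∣ω⇒ d)))) , (λ d → fromπ (∣ω⇒ d)) ]′ (prime-split πp′ (subst (π′ ∣ω_) e ∣ω-refl))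
    where
    fromκ : (∃ λ μ → κ ≡ μ ⊠ π′) → IsUnitω π
    fromκ (μ , f) = ⇒unit μ (⊠-cancelˡ π′ π′≢0 (trans (sym (trans e (trans (cong (_⊠ π) f)
      (trans (cong (_⊠ π) (⊠-comm μ π′)) (trans (⊠-assoc π′ μ π) (cong (π′ ⊠_) (⊠-comm μ π))))))) (sym (⊠-identityʳ π′))))
    fromπ : (∃ λ μ → π ≡ μ ⊠ π′) → IsUnitω κ
    fromπ (μ , f) = ⇒unit μ (⊠-cancelˡ π′ π′≢0 (trans (⊠-comm π′ (κ ⊠ μ)) (trans (⊠-assoc κ μ π′) (trans (cong (κ ⊠_) (sym f)) (trans (sym e) (sym (⊠-identityʳ π′)))))))

CubicValue : Zω → Set
CubicValue χ = χ ≡ 0ω ⊎ χ ≡ 1ω ⊎ χ ≡ ω ⊎ χ ≡ ω²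

-- Each difference of distinct values divides 3 (the witness is the cofactor), so a prime that does
-- not divide 3 separates them.
value-difference : ∀ {χ ψ} → CubicValue χ → CubicValue ψ → χ ≡ ψ ⊎ (χ -ω ψ) ∣ω fromℤ (+ 3)
value-difference (inj₁ refl) (inj₁ refl) = inj₁ refl
value-difference (inj₁ refl) (inj₂ (inj₁ refl)) = inj₂ (((- + 3) +ω (+ 0) ω) , refl)
value-difference (inj₁ refl) (inj₂ (inj₂ (inj₁ refl))) = inj₂ (((+ 3) +ω (+ 3) ω) , refl)
value-difference (inj₁ refl) (inj₂ (inj₂ (inj₂ refl))) = inj₂ (((+ 0) +ω (- + 3) ω) , refl)
value-difference (inj₂ (inj₁ refl)) (inj₁ refl) = inj₂ (((+ 3) +ω (+ 0) ω) , refl)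
value-difference (inj₂ (inj₁ refl)) (inj₂ (inj₁ refl)) = inj₁ refl
value-difference (inj₂ (inj₁ refl)) (inj₂ (inj₂ (inj₁ refl))) = inj₂ (((+ 2) +ω (+ 1) ω) , refl)
value-difference (inj₂ (inj₁ refl)) (inj₂ (inj₂ (inj₂ refl))) = inj₂ (((+ 1) +ω (- + 1) ω) , refl)
value-difference (inj₂ (inj₂ (inj₁ refl))) (inj₁ refl) = inj₂ (((- + 3) +ω (- + 3) ω) , refl)
value-difference (inj₂ (inj₂ (inj₁ refl))) (inj₂ (inj₁ refl)) = inj₂ (((- + 2) +ω (- + 1) ω) , refl)
value-difference (inj₂ (inj₂ (inj₁ refl))) (inj₂ (inj₂ (inj₁ refl))) = inj₁ refl
value-difference (inj₂ (inj₂ (inj₁ refl))) (inj₂ (inj₂ (inj₂ refl))) = inj₂ (((- + 1) +ω (- + 2) ω) , refl)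
value-difference (inj₂ (inj₂ (inj₂ refl))) (inj₁ refl) = inj₂ (((+ 0) +ω (+ 3) ω) , refl)
value-difference (inj₂ (inj₂ (inj₂ refl))) (inj₂ (inj₁ refl)) = inj₂ (((- + 1) +ω (+ 1) ω) , refl)
value-difference (inj₂ (inj₂ (inj₂ refl))) (inj₂ (inj₂ (inj₁ refl))) = inj₂ (((+ 1) +ω (+ 2) ω) , refl)
value-difference (inj₂ (inj₂ (inj₂ refl))) (inj₂ (inj₂ (inj₂ refl))) = inj₁ refl

-- `CubicSym` asserts that some factorisation has the given product of values. To use it as a
-- hypothesis, any two factorisations must be compared; unique factorisation is proved here just in
-- this form.
module SymbolUniqueness (τ : Zω) where

  IsSymbol : Zω × Zω → Set
  IsSymbol f = IsPrimeω (proj₁ f) × ¬ (proj₁ f ∣ω fromℤ (+ 3)) × CubicSymPrime τ (proj₁ f) (proj₂ f)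

  moduli values : List (Zω × Zω) → Zω
  moduli fs = productω (map proj₁ fs)
  values fs = productω (map proj₂ fs)

  moduli-∷ : ∀ f fs → moduli (f ∷ fs) ≡ proj₁ f ⊠ moduli fs
  moduli-∷ f fs = sym (⊠≡*ω _ _)

  values-∷ : ∀ f fs → values (f ∷ fs) ≡ proj₂ f ⊠ values fs
  values-∷ f fs = sym (⊠≡*ω _ _)

  -- The exponent depends only on the norm, so both values are congruent to the same power of τ
  -- modulo π.
  value-unique : ∀ {f g} → IsSymbol f → IsSymbol g → proj₁ f ∣ω proj₁ g → ℤ.∣ normω (proj₁ f) ∣ ≡ ℤ.∣ normω (proj₁ g) ∣ → proj₂ f ≡ proj₂ g
  value-unique {π , χ} {π′ , ψ} (πp , π∤3 , χ-val , π∣) (_ , _ , ψ-val , π′∣) π∣π′ N≡ =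
    [ (λ e → e) , (λ d → ⊥-elim (π∤3 (∣ω-trans (≋⇒∣ω (≋-trans (≋-sym χ≋) ψ≋)) d))) ]′ (value-difference χ-val ψ-val)
    where
    open Zωmod π
    e : ℕ
    e = (ℤ.∣ normω π ∣ ℕ.∸ 1) ℕ./ 3
    χ≋ : τ ^ω e ≋ χ
    χ≋ = ∣ω⇒≋ π∣
    ψ≋ : τ ^ω e ≋ ψ
    ψ≋ = ∣ω⇒≋ (∣ω-trans π∣π′ (subst (λ n → π′ ∣ω ((τ ^ω ((n ℕ.∸ 1) ℕ./ 3)) -ω ψ)) (sym N≡) π′∣))

  record Extraction (π : Zω) (gs : List (Zω × Zω)) : Set where
    field
      found : Zω × Zω
      rest : List (Zω × Zω)
      found-symbol : IsSymbol found
      rest-symbols : All IsSymbol rest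
      divides-found : π ∣ω proj₁ found
      moduli≡ : moduli gs ≡ proj₁ found ⊠ moduli rest
      values≡ : values gs ≡ proj₂ found ⊠ values rest

  extract : ∀ {π} → IsPrimeω π → ∀ gs → All IsSymbol gs → π ∣ω moduli gs → Extraction π gs
  extract πp [] [] d = ⊥-elim (proj₁ (proj₂ πp) (∣unit⇒unit d (⇒unit 1ω (⊠-identityˡ 1ω))))
  extract {π} πp (g ∷ gs) (s ∷ ss) d = [ atHead , (λ d → inTail (extract πp gs ss d)) ]′ (prime-split πp (subst (π ∣ω_) (moduli-∷ g gs) d))
    where
    atHead : π ∣ω proj₁ g → Extraction π (g ∷ gs)
    atHead d = record { found = g ; rest = gs ; found-symbol = s ; rest-symbols = ss ; divides-found = d ; moduli≡ = moduli-∷ g gs ; values≡ = values-∷ g gs }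
    inTail : Extraction π gs → Extraction π (g ∷ gs)
    inTail E = record
      { found = found ; rest = g ∷ rest ; found-symbol = found-symbol ; rest-symbols = s ∷ rest-symbols ; divides-found = divides-found
      ; moduli≡ = trans (moduli-∷ g gs) (trans (cong (proj₁ g ⊠_) moduli≡) (trans (⊠-swapˡ _ _ _) (cong (proj₁ found ⊠_) (sym (moduli-∷ g rest)))))
      ; values≡ = trans (values-∷ g gs) (trans (cong (proj₂ g ⊠_) values≡) (trans (⊠-swapˡ _ _ _) (cong (proj₂ found ⊠_) (sym (values-∷ g rest))))) }
      where open Extraction E

  -- The first prime on the left divides the product on the right, hence is associate to one of its
  -- factors. Both are removed, and the unit κ between them joins η.
  values-unique : ∀ {ε η} fs gs → IsUnitω ε → IsUnitω η → All IsSymbol fs → All IsSymbol gs →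
    ε ⊠ moduli fs ≡ η ⊠ moduli gs → values fs ≡ values gs
  values-unique [] [] _ _ _ _ _ = refl
  values-unique {ε} {η} [] (g ∷ gs) u v [] (s ∷ ss) e = ⊥-elim (proj₁ (proj₂ (proj₁ s)) (∣unit⇒unit (⇒∣ω (η ⊠ moduli gs)
    (trans (sym (⊠-identityʳ ε)) (trans e (trans (cong (η ⊠_) (trans (moduli-∷ g gs) (⊠-comm _ _))) (sym (⊠-assoc η _ _)))))) u))
  values-unique {ε} {η} (f ∷ fs) gs u v (s ∷ ss) ts e = [ (λ d → ⊥-elim (proj₁ (proj₂ (proj₁ s)) (∣unit⇒unit d v))) , (λ d → match (extract (proj₁ s) gs ts d)) ]′
    (prime-split (proj₁ s) (⇒∣ω (ε ⊠ moduli fs) (trans (sym e) (trans (cong (ε ⊠_) (trans (moduli-∷ f fs) (⊠-comm _ _))) (sym (⊠-assoc ε _ _))))))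
    where
    π = proj₁ f
    match : Extraction π gs → values (f ∷ fs) ≡ values gs
    match E = conclude (associate (proj₁ s) (proj₁ found-symbol) divides-found)
      where
      open Extraction E
      conclude : (∃ λ κ → proj₁ found ≡ κ ⊠ π × IsUnitω κ) → values (f ∷ fs) ≡ values gs
      conclude (κ , π′≡ , κ-unit) = trans (values-∷ f fs) (trans (cong₂ _⊠_ (value-unique s found-symbol divides-found (sym norm≡)) tail≡) (sym values≡))
        where
        norm≡ : ℤ.∣ normω (proj₁ found) ∣ ≡ ℤ.∣ normω π ∣
        norm≡ = trans (cong ℤ.∣_∣ (trans (cong normω π′≡) (normω-* κ π))) (trans (ℤₚ.abs-* (normω κ) (normω π)) (trans (cong (ℕ._* ℤ.∣ normω π ∣) (unit-norm {κ} κ-unit)) (ℕₚ.*-identityˡ _)))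
        cancelled : ε ⊠ moduli fs ≡ (η ⊠ κ) ⊠ moduli rest
        cancelled = ⊠-cancelˡ π (proj₁ (proj₁ s)) (begin
          π ⊠ (ε ⊠ moduli fs)            ≡⟨ ⊠-swapˡ π ε _ ⟩
          ε ⊠ (π ⊠ moduli fs)            ≡⟨ cong (ε ⊠_) (moduli-∷ f fs) ⟨
          ε ⊠ moduli (f ∷ fs)            ≡⟨ e ⟩
          η ⊠ moduli gs                  ≡⟨ cong (η ⊠_) moduli≡ ⟩
          η ⊠ (proj₁ found ⊠ moduli rest) ≡⟨ cong (λ ρ → η ⊠ (ρ ⊠ moduli rest)) π′≡ ⟩
          η ⊠ (κ ⊠ π ⊠ moduli rest)      ≡⟨ ⊠-assoc η (κ ⊠ π) (moduli rest) ⟨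
          η ⊠ (κ ⊠ π) ⊠ moduli rest      ≡⟨ cong (_⊠ moduli rest) (⊠-assoc η κ π) ⟨
          η ⊠ κ ⊠ π ⊠ moduli rest        ≡⟨ cong (_⊠ moduli rest) (⊠-comm (η ⊠ κ) π) ⟩
          π ⊠ (η ⊠ κ) ⊠ moduli rest      ≡⟨ ⊠-assoc π (η ⊠ κ) (moduli rest) ⟩
          π ⊠ ((η ⊠ κ) ⊠ moduli rest)    ∎)
          where open ≡-Reasoning
        tail≡ : values fs ≡ values rest
        tail≡ = values-unique {ε} {η ⊠ κ} fs rest u (unit-* {η} {κ} v κ-unit) ss rest-symbols cancelled

symbol : ∀ {qs} → All Prime qs → Zω → μ₃
symbol [] α = 𝟙
symbol (_∷_ {q} qr qrs) α = Residue.res qr (classify q) α ∙ symbol qrs α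

conj-∣ω : ∀ {ρ α} → ρ ∣ω α → conj ρ ∣ω conj α
conj-∣ω {ρ} {α} d = go (∣ω⇒ d)
  where
  go : (∃ λ κ → α ≡ κ ⊠ ρ) → conj ρ ∣ω conj α
  go (κ , e) = ⇒∣ω (conj κ) (trans (cong conj e) (conj-* κ ρ))

conj-prime : ∀ {π} → IsPrimeω π → IsPrimeω (conj π)
conj-prime {π} (π≢0 , ¬unit , euclid) = (λ e → π≢0 (trans (sym (conj-involutive π)) (trans (cong conj e) (conj-fromℤ (+ 0)))))
  , (λ u → ¬unit (unit (unit⇒ u)))
  , λ α β d → [ (λ e → inj₁ (subst (conj π ∣ω_) (conj-involutive α) (conj-∣ω e))) , (λ e → inj₂ (subst (conj π ∣ω_) (conj-involutive β) (conj-∣ω e))) ]′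
      (euclid (conj α) (conj β) (subst (π ∣ω_) (trans (cong conj (sym (⊠≡*ω α β))) (trans (conj-* α β) (⊠≡*ω _ _))) (subst (_∣ω conj (α *ω β)) (conj-involutive π) (conj-∣ω d))))
  where
  unit : (∃ λ υ → conj π ⊠ υ ≡ 1ω) → IsUnitω π
  unit (υ , e) = ⇒unit (conj υ) (trans (sym (cong (_⊠ conj υ) (conj-involutive π))) (trans (sym (conj-* (conj π) υ)) (trans (cong conj e) (conj-fromℤ (+ 1)))))

⟦⟧-value : ∀ x → CubicValue ⟦ x ⟧
⟦⟧-value 𝟙 = inj₂ (inj₁ refl)
⟦⟧-value ζ = inj₂ (inj₂ (inj₁ refl))
⟦⟧-value ζ² = inj₂ (inj₂ (inj₂ refl))

-ω-conj : ∀ α β → conj (α -ω β) ≡ conj α -ω conj β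
-ω-conj = go
  where
  opaque
    unfolding conj
    go : ∀ α β → conj (α -ω β) ≡ conj α -ω conj β
    go (a +ω b ω) (c +ω d ω) = cong₂ _+ω_ω (l a b c d) (l′ b d)
      where
      l : ∀ a b c d → a - c - (b - d) ≡ (a - b) - (c - d)
      l = ℤSolver.solve-∀
      l′ : ∀ b d → - (b - d) ≡ - b - (- d)
      l′ = ℤSolver.solve-∀

inert≢split : ∀ n k → 2 ℕ.+ 3 ℕ.* n ≢ 1 ℕ.+ 3 ℕ.* k
inert≢split n k g = 2≢1 (trans (sym (mod3 2 n (ℕ.s≤s (ℕ.s≤s (ℕ.s≤s ℕ.z≤n))))) (trans (cong (ℕ._% 3) g) (mod3 1 k (ℕ.s≤s (ℕ.s≤s ℕ.z≤n)))))
  where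
  mod3 : ∀ r k → r ℕ.< 3 → (r ℕ.+ 3 ℕ.* k) ℕ.% 3 ≡ r
  mod3 r k r<3 = trans (cong (λ m → (r ℕ.+ m) ℕ.% 3) (ℕₚ.*-comm 3 k)) (trans (ℕ/.[m+kn]%n≡m%n r k 3) (ℕ/.m<n⇒m%n≡m r<3))
  2≢1 : 2 ≢ 1
  2≢1 ()

module InertPrime {q : ℕ} (qr : Prime q) (q∤3 : ¬ (+ q ∣ + 3)) (k : ℕ) (e : q ≡ 2 ℕ.+ 3 ℕ.* k) where
  open Residue qr
  open Zωmodℤ (+ q)

  -- If q divides αβ, it divides one of the two norms, and an inert q dividing a norm divides the
  -- element.
  inert-prime : IsPrimeω (fromℤ (+ q))
  inert-prime = (λ e → ℕ.≢-nonZero⁻¹ q {{prime⇒nonZero qr}} (ℤₚ.+-injective (cong re e)))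
    , (λ u → PrimeMod.p∤1 qr (divides-unit (unit⇒ u)))
    , λ α β d → [ (λ f → inj₁ (inert⇒∣norm⇒∣ω {k} e α f)) , (λ f → inj₂ (inert⇒∣norm⇒∣ω {k} e β f)) ]′
        (PrimeMod.euclid qr (normω α) (normω β) (norm-∣ α β (∣ω⇒≋0 d)))
    where
    divides-unit : (∃ λ υ → fromℤ (+ q) ⊠ υ ≡ 1ω) → + q ∣ + 1
    divides-unit (υ , f) = divides (re υ) (trans (sym (cong re f)) (trans (cong re (fromℤ-⊠ (+ q) υ)) (ℤₚ.*-comm (+ q) (re υ))))
    norm-∣ : ∀ α β → α *ω β ≋ 0ω → + q ∣ normω α * normω β
    norm-∣ α β f = subst (+ q ∣_) (normω-* α β) (ℤmod.≋0⇒∣ (+ q) (normω-cong q∤3 (≋-trans (≡⇒≋ (⊠≡*ω α β)) f)))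

  inert∤3 : ¬ (fromℤ (+ q) ∣ω fromℤ (+ 3))
  inert∤3 d = q∤3 (proj₁ (fromℤ∣ω⇒∣ d))

  inert-symbol : ∀ τ → ¬ (+ q ∣ normω τ) → ∀ C → CubicSymPrime τ (fromℤ (+ q)) ⟦ res C τ ⟧
  inert-symbol τ q∤τ (divisible n f) = ⊥-elim (¬divisible q∤3 n f)
  inert-symbol τ q∤τ (split n f) = ⊥-elim (inert≢split k n (trans (sym e) f))
  inert-symbol τ q∤τ C@(inert n f) = ⟦⟧-value (res C τ) , subst (λ m → fromℤ (+ q) ∣ω ((τ ^ω m) -ω ⟦ res C τ ⟧)) (sym exponent≡)
    (subst (λ α → fromℤ (+ q) ∣ω (α -ω ⟦ res C τ ⟧)) (↑≡^ω τ _) (≋⇒∣ω (res-spec q∤3 C τ q∤τ)))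
    where
    exponent≡ : (ℤ.∣ normω (fromℤ (+ q)) ∣ ℕ.∸ 1) ℕ./ 3 ≡ suc n ℕ.* (1 ℕ.+ 3 ℕ.* n)
    exponent≡ = trans (cong (λ m → (m ℕ.∸ 1) ℕ./ 3) (trans (cong ℤ.∣_∣ (normω-fromℤ (+ q))) (trans (ℤₚ.abs-* (+ q) (+ q)) (trans (cong₂ ℕ._*_ f f) (l n)))))
      (ℕ/.m*n/n≡m (suc n ℕ.* (1 ℕ.+ 3 ℕ.* n)) 3)
      where
      l : ∀ n → (2 ℕ.+ 3 ℕ.* n) ℕ.* (2 ℕ.+ 3 ℕ.* n) ≡ 1 ℕ.+ suc n ℕ.* (1 ℕ.+ 3 ℕ.* n) ℕ.* 3
      l = ℕSolver.solve-∀

module SplitPrime {p : ℕ} (pr : Prime p) (p∤3 : ¬ (+ p ∣ + 3)) (k : ℕ) (p≡1+3k : p ≡ 1 ℕ.+ 3 ℕ.* k)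
                  (h : ℤ) (root : + p ∣ h * h + h + + 1) where
  open JacobiSum pr h root p∤3 k p≡1+3k using (J; norm-J)
  open Evaluation pr h root p∤3
  open Character k p≡1+3k
  open PrimeMod pr
  open ℤmod (+ p)
  private module ω = Zωmodℤ (+ p)

  open JacobiDivisibility pr h root p∤3 k p≡1+3k

  -- The multiples of J are the kernel of `ev`, and ℤ/p is a domain.
  J-prime : IsPrimeω J
  J-prime = (λ e → ℕ.≢-nonZero⁻¹ p {{prime⇒nonZero pr}} (ℤₚ.+-injective (trans (sym norm-J) (cong normω e))))
    , (λ u → p∤1 (subst (λ n → + n ∣ + 1) (trans (sym (unit-norm {J} u)) (cong ℤ.∣_∣ norm-J)) ∣-refl))
    , λ α β d → [ (λ f → inj₁ (ev≋0⇒∣ω α (∣⇒≋0 f))) , (λ f → inj₂ (ev≋0⇒∣ω β (∣⇒≋0 f))) ]′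
        (euclid (ev α) (ev β) (≋0⇒∣ (≋-trans (≋-sym (ev-⊠ α β)) (≋-trans (≡⇒≋ (cong ev (⊠≡*ω α β))) (∣ω⇒ev≋0 d)))))

  J∤3 : ¬ (J ∣ω fromℤ (+ 3))
  J∤3 d = p∤3 (≋0⇒∣ (≋-trans (≡⇒≋ (sym (ev-fromℤ (+ 3)))) (∣ω⇒ev≋0 d)))

  J̄∤3 : ¬ (conj J ∣ω fromℤ (+ 3))
  J̄∤3 d = J∤3 (subst₂ _∣ω_ (conj-involutive J) (conj-fromℤ (+ 3)) (conj-∣ω d))

  module _ (τ : Zω) (p∤τ : ¬ (+ p ∣ normω τ)) where
    private
      ev-norm : ev τ * ev (conj τ) ≋ normω τ
      ev-norm = ≋-trans (≋-sym (ev-⊠ τ (conj τ))) (≡⇒≋ (trans (cong ev (⊠-conj τ)) (ev-fromℤ (normω τ))))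

    p∤evτ : ¬ (+ p ∣ ev τ)
    p∤evτ d = p∤τ (∣-resp-≋ ev-norm (∣m⇒∣m*n (ev (conj τ)) d))

    p∤evτ̄ : ¬ (+ p ∣ ev (conj τ))
    p∤evτ̄ d = p∤τ (∣-resp-≋ ev-norm (∣n⇒∣m*n (ev τ) d))

    x y : μ₃
    x = index (ev τ)
    y = index (ev (conj τ))

    exponent≡ : ∀ {n} → n ≡ p → (n ℕ.∸ 1) ℕ./ 3 ≡ k
    exponent≡ refl = trans (cong (λ m → (m ℕ.∸ 1) ℕ./ 3) (trans p≡1+3k (cong suc (ℕₚ.*-comm 3 k)))) (ℕ/.m*n/n≡m k 3)

    J∣power : ∀ α → ¬ (+ p ∣ ev α) → J ∣ω ((α ^ω k) -ω ⟦ index (ev α) ⟧)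
    J∣power α p∤α = ∣-ω (α ^ω k) ⟦ index (ev α) ⟧ (≋-trans (≡⇒≋ (cong ev (sym (↑≡^ω α k)))) (≋-trans (ev-↑ α k) (index-spec (ev α) p∤α)))
      where
      ∣-ω : ∀ α β → ev α ≋ ev β → J ∣ω (α -ω β)
      ∣-ω α β e = ev≋0⇒∣ω (α -ω β) (≋-trans (≡⇒≋ (l (re α) (im α) (re β) (im β) h)) (≋-trans (+-cong-≋ e (≋-refl { - ev β})) (≡⇒≋ (ℤₚ.+-inverseʳ (ev β)))))
        where
        l : ∀ a b c d h → (a - c) + h * (b - d) ≡ (a + h * b) - (c + h * d)
        l = ℤSolver.solve-∀

    J-symbol : CubicSymPrime τ J ⟦ x ⟧
    J-symbol = ⟦⟧-value x , subst (λ m → J ∣ω ((τ ^ω m) -ω ⟦ x ⟧)) (sym (exponent≡ (cong ℤ.∣_∣ norm-J))) (J∣power τ p∤evτ)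

    -- Conjugate the congruence for conj(τ) modulo J; conjugation inverts cube roots of unity.
    J̄-symbol : CubicSymPrime τ (conj J) ⟦ y ⁻¹ ⟧
    J̄-symbol = ⟦⟧-value (y ⁻¹) , subst (λ m → conj J ∣ω ((τ ^ω m) -ω ⟦ y ⁻¹ ⟧)) (sym (exponent≡ (cong ℤ.∣_∣ (trans (normω-conj J) norm-J))))
      (subst (conj J ∣ω_) (trans (-ω-conj (conj τ ^ω k) ⟦ y ⟧) (cong₂ _-ω_ (trans (cong conj (sym (↑≡^ω (conj τ) k))) (trans (conj-^ (conj τ) k) (trans (cong (_↑ k) (conj-involutive τ)) (↑≡^ω τ k)))) (⟦⟧-conj y)))
        (conj-∣ω (J∣power (conj τ) p∤evτ̄)))

    -- The right side is the product of the symbols at J and conj(J), so `res` is the multiplicative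
    -- symbol at p.
    res-split : ∀ C → Residue.res pr C τ ≡ x ∙ y ⁻¹
    res-split (divisible n f) = ⊥-elim (Residue.¬divisible pr p∤3 n f)
    res-split C@(split n f) = ev⟦⟧-injective (begin
      ev ⟦ Residue.res pr C τ ⟧           ≈⟨ ev-cong (Residue.res-spec pr p∤3 C τ p∤τ) ⟨
      ev ((τ ⊠ (conj τ ⊠ conj τ)) ↑ n)    ≡⟨ cong (λ m → ev ((τ ⊠ (conj τ ⊠ conj τ)) ↑ m)) n≡k ⟩
      ev ((τ ⊠ (conj τ ⊠ conj τ)) ↑ k)    ≡⟨ cong ev (trans (↑-distrib-⊠ τ _ k) (cong ((τ ↑ k) ⊠_) (↑-distrib-⊠ (conj τ) (conj τ) k))) ⟩
      ev ((τ ↑ k) ⊠ ((conj τ ↑ k) ⊠ (conj τ ↑ k)))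
        ≈⟨ ≋-trans (ev-⊠ _ _) (*-cong-≋ (power≋ τ p∤evτ) (≋-trans (ev-⊠ _ _) (*-cong-≋ (power≋ (conj τ) p∤evτ̄) (power≋ (conj τ) p∤evτ̄)))) ⟩
      ev ⟦ x ⟧ * (ev ⟦ y ⟧ * ev ⟦ y ⟧)     ≈⟨ *-congˡ-≋ (ev ⟦ x ⟧) (≋-sym (≋-trans (≡⇒≋ (cong ev (⟦⟧-∙ y y))) (ev-⊠ ⟦ y ⟧ ⟦ y ⟧))) ⟩
      ev ⟦ x ⟧ * ev ⟦ y ∙ y ⟧              ≈⟨ ev-⊠ ⟦ x ⟧ ⟦ y ∙ y ⟧ ⟨
      ev (⟦ x ⟧ ⊠ ⟦ y ∙ y ⟧)               ≡⟨ cong ev (⟦⟧-∙ x (y ∙ y)) ⟨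
      ev ⟦ x ∙ (y ∙ y) ⟧                   ≡⟨ cong (λ z → ev ⟦ x ∙ z ⟧) (square≡⁻¹ y) ⟩
      ev ⟦ x ∙ y ⁻¹ ⟧                      ∎)
      where
      open Relation.Binary.Reasoning.Setoid (CommutativeRing.setoid quotientRing)
      power≋ : ∀ α → ¬ (+ p ∣ ev α) → ev (α ↑ k) ≋ ev ⟦ index (ev α) ⟧
      power≋ α p∤α = ≋-trans (ev-↑ α k) (index-spec (ev α) p∤α)
      n≡k : n ≡ k
      n≡k = ℕₚ.*-cancelˡ-≡ n k 3 (ℕₚ.suc-injective (trans (sym f) p≡1+3k))
    res-split (inert n f) = ⊥-elim (inert≢split n k (trans (sym f) p≡1+3k))

⟦⟧≡1⇒≡𝟙 : ∀ x → ⟦ x ⟧ ≡ 1ω → x ≡ 𝟙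
⟦⟧≡1⇒≡𝟙 𝟙 _ = refl

module CubicSymbol (τ : Zω) where
  open SymbolUniqueness τ

  Good : ℕ → Set
  Good q = ¬ (+ q ∣ + 3) × ¬ (+ q ∣ normω τ)

  record Factors {qs} (qrs : All Prime qs) : Set where
    field
      list : List (Zω × Zω)
      symbols : All IsSymbol list
      moduli≡ : moduli list ≡ fromℤ (+ product qs)
      values≡ : values list ≡ ⟦ symbol qrs τ ⟧

  factors : ∀ {qs} (qrs : All Prime qs) → All Good qs → Factors qrs
  factors [] [] = record { list = [] ; symbols = [] ; moduli≡ = refl ; values≡ = refl }
  factors {q ∷ qs} (qr ∷ qrs) ((q∤3 , q∤τ) ∷ goods) = extend (factors qrs goods) (classify q) refl
    where
    product≡ : fromℤ (+ q) ⊠ fromℤ (+ product qs) ≡ fromℤ (+ product (q ∷ qs))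
    product≡ = trans (sym (fromℤ-* (+ q) (+ product qs))) (cong fromℤ (sym (ℤₚ.pos-* q (product qs))))
    extend : Factors qrs → ∀ C → C ≡ classify q → Factors (qr ∷ qrs)
    extend F (divisible k e) _ = ⊥-elim (Residue.¬divisible qr q∤3 k e)
    extend F C@(inert k e) C≡ = record
      { list = f ∷ list
      ; symbols = (inert-prime , inert∤3 , inert-symbol τ q∤τ C) ∷ symbols
      ; moduli≡ = trans (moduli-∷ f list) (trans (cong (fromℤ (+ q) ⊠_) moduli≡) product≡)
      ; values≡ = trans (values-∷ f list) (trans (cong₂ _⊠_ (cong (λ C → ⟦ Residue.res qr C τ ⟧) C≡) values≡) (sym (⟦⟧-∙ _ _))) }
      where
      open Factors F
      open InertPrime qr q∤3 k e
      f = fromℤ (+ q) , ⟦ Residue.res qr C τ ⟧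
    extend F C@(split k e) C≡ = withRoot (PowerSums.cubeRoot qr k e)
      where
      open Factors F
      withRoot : (∃ λ h → + q ∣ h * h + h + + 1) → Factors (qr ∷ qrs)
      withRoot (h , root) = record
        { list = f ∷ f̄ ∷ list
        ; symbols = (J-prime , J∤3 , J-symbol τ q∤τ) ∷ (conj-prime J-prime , J̄∤3 , J̄-symbol τ q∤τ) ∷ symbols
        ; moduli≡ = trans (moduli-∷ f (f̄ ∷ list)) (trans (cong (J ⊠_) (moduli-∷ f̄ list)) (trans (sym (⊠-assoc J (conj J) (moduli list))) (trans (cong₂ _⊠_ J⊠J̄ moduli≡) product≡)))
        ; values≡ = trans (values-∷ f (f̄ ∷ list)) (trans (cong (⟦ a ⟧ ⊠_) (values-∷ f̄ list)) (trans (sym (⊠-assoc ⟦ a ⟧ ⟦ b ⟧ (values list)))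
            (trans (cong₂ _⊠_ (trans (sym (⟦⟧-∙ a b)) (cong ⟦_⟧ (trans (sym (res-split τ q∤τ C)) (cong (λ C → Residue.res qr C τ) C≡)))) values≡) (sym (⟦⟧-∙ _ _))))) }
        where
        open SplitPrime qr q∤3 k e h root
        open JacobiSum qr h root q∤3 k e using (J; J⊠J̄)
        a = x τ q∤τ
        b = y τ q∤τ ⁻¹
        f = J , ⟦ a ⟧
        f̄ = conj J , ⟦ b ⟧

  cubicSym⇔symbol : ∀ {qs} (qrs : All Prime qs) → All Good qs → CubicSym τ (fromℤ (+ product qs)) 1ω ⇔ symbol qrs τ ≡ 𝟙
  cubicSym⇔symbol {qs} qrs goods = mk⇔ to from
    where
    open Factors (factors qrs goods)
    to : CubicSym τ (fromℤ (+ product qs)) 1ω → symbol qrs τ ≡ 𝟙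
    to (ε , fs , ε-unit , fs-symbols , n≡ , 1≡) = ⟦⟧≡1⇒≡𝟙 _ (trans (sym values≡) (trans
      (values-unique {1ω} {ε} list fs (⇒unit 1ω (⊠-identityˡ 1ω)) ε-unit symbols fs-symbols (trans (⊠-identityˡ _) (trans moduli≡ (trans n≡ (sym (⊠≡*ω ε (moduli fs)))))))
      (sym 1≡)))
    from : symbol qrs τ ≡ 𝟙 → CubicSym τ (fromℤ (+ product qs)) 1ω
    from e = 1ω , list , ⇒unit 1ω (⊠-identityˡ 1ω) , symbols , trans (sym moduli≡) (trans (sym (⊠-identityˡ (moduli list))) (⊠≡*ω 1ω (moduli list))) , sym (trans values≡ (cong ⟦_⟧ e))

-- Vanishing of the symbol (E/n)₃

module _ {ℓ : ℕ} (lr : Prime ℓ) where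
  open PrimeMod lr using (euclid)

  ∣square : ∀ x → + ℓ ∣ x * x → + ℓ ∣ x
  ∣square x d = [ (λ e → e) , (λ e → e) ]′ (euclid x x d)

  ∣cube : ∀ x → + ℓ ∣ x * (x * x) → + ℓ ∣ x
  ∣cube x d = [ (λ e → e) , ∣square x ]′ (euclid x (x * x) d)

∣-sum : ∀ {ℓ x y z} → x ≡ y + z → ℓ ∣ x → ℓ ∣ y → ℓ ∣ z
∣-sum {ℓ} {x} {y} {z} e d f = subst (ℓ ∣_) (trans (cong (_- y) e) (l y z)) (∣m∣n⇒∣m-n d f)
  where
  l : ∀ y z → y + z - y ≡ z
  l = ℤSolver.solve-∀

-- One statement for u and for u√D, both after removal of rational factors. V + U√D is the reduced
-- element and K its norm; Γ is the removed factor that keeps K from being a cube, and Δ is 1 for u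
-- and, for u√D, minus the part of D that remains. The hypotheses on Γ and Δ say that their primes
-- do no harm: they stay prime to N and divide 2XY.
module SymbolVanishing
  (D z w n U V K Γ Δ m : ℤ) (n≡ : n ≡ z * z + + 27 * (D * (w * w))) (K≡ : K ≡ V * V - U * U * D)
  (KΓ²≡ : K * (Γ * Γ) ≡ Δ * (m * (m * m)))
  (w≢0 : w ≢ + 0) (Γ≢0 : Γ ≢ + 0) (Δ≢0 : Δ ≢ + 0)
  (U⟂V : U ⟂ V) (3∤U : ¬ (+ 3 ∣ U)) (n⟂3 : n ⟂ + 3) (n⟂w : n ⟂ w) (n⟂D : n ⟂ D) (n⟂K : n ⟂ K)
  (Γ∣K : ∀ q → Prime q → + q ∣ Γ → + q ∣ K)
  (Γ∣2Vw : ∀ q → Prime q → + q ∣ Γ → + q ∣ + 2 * (V * w))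
  (Δ∣V : ∀ q → Prime q → + q ∣ Δ → + q ∣ V) (Δ∣D : ∀ q → Prime q → + q ∣ Δ → + q ∣ D)
  where

  z⟂D : z ⟂ D
  z⟂D ℓ lr d e = n⟂D ℓ lr (subst (+ ℓ ∣_) (sym n≡) (∣m∣n⇒∣m+n (∣m⇒∣m*n z d) (∣n⇒∣m*n (+ 27) (∣m⇒∣m*n (w * w) e)))) e

  z⟂w : z ⟂ w
  z⟂w ℓ lr d e = n⟂w ℓ lr (subst (+ ℓ ∣_) (sym n≡) (∣m∣n⇒∣m+n (∣m⇒∣m*n z d) (∣n⇒∣m*n (+ 27) (∣n⇒∣m*n D (∣m⇒∣m*n w e))))) e

  n⟂z : n ⟂ z
  n⟂z ℓ lr d e = [ (λ f → n⟂3 ℓ lr d (PrimeMod.∣-^ lr (+ 3) 3 f)) , (λ f → [ n⟂D ℓ lr d , (λ g → n⟂w ℓ lr d (∣square lr w g)) ]′ (PrimeMod.euclid lr D (w * w) f)) ]′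
    (PrimeMod.euclid lr (+ 27) (D * (w * w)) (∣-sum n≡ d (∣m⇒∣m*n z e)))

  3∤n : ¬ (+ 3 ∣ n)
  3∤n d = n⟂3 3 prime-3 d ∣-refl

  3∤z : ¬ (+ 3 ∣ z)
  3∤z d = 3∤n (subst (+ 3 ∣_) (sym n≡) (∣m∣n⇒∣m+n (∣m⇒∣m*n z d) (∣m⇒∣m*n (D * (w * w)) (divides (+ 9) refl))))

  U∤K : ∀ ℓ → Prime ℓ → + ℓ ∣ U → ¬ (+ ℓ ∣ K)
  U∤K ℓ lr d e = U⟂V ℓ lr d (∣square lr V (subst (+ ℓ ∣_) (trans (cong (_+ U * U * D) K≡) (l (V * V) (U * U * D))) (∣m∣n⇒∣m+n e (∣m⇒∣m*n D (∣m⇒∣m*n U d)))))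
    where
    l : ∀ a b → a - b + b ≡ a
    l = ℤSolver.solve-∀

  symbol≡𝟙 : ∀ {qs} (qrs : All Prime qs) → n ≡ + product qs → symbol qrs (element (U * z) (V * w)) ≡ 𝟙
  symbol≡𝟙 {qs} qrs n≡qs = step₁ (gcd-reduce w U w≢0) (gcd-reduce z V λ e → 3∤z (divides (+ 0) e))
    where
    step₁ : (∃ λ g → ∃ λ w₁ → ∃ λ U₁ → w ≡ + g * w₁ × U ≡ + g * U₁ × w₁ ⟂ U₁) →
            (∃ λ f → ∃ λ z₁ → ∃ λ V₁ → z ≡ + f * z₁ × V ≡ + f * V₁ × z₁ ⟂ V₁) → symbol qrs (element (U * z) (V * w)) ≡ 𝟙
    step₁ (g , w₁ , U₁ , w≡ , U≡ , w₁⟂U₁) (f , z₁ , V₁ , z≡ , V≡ , z₁⟂V₁) = trans (symbol≡∏ qrs (primeFactors refl qrs)) (trans (sym (CharacterProperties.M-product 𝐒 qs qrs (subst (_⟂ N) n≡qs n⟂N)))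
      (trans (cong M (sym n≡qs)) (KeyLemma.M-congruence X Y 3∤X X⟂Y 𝐒 n P Q (+ 3 * m) P≢0 Q≢0 n⟂N P⟂N Q⟂N 3m⟂N primes N∣)))
      where
      -- As U ⟂ V and z ⟂ w, common factors of Uz and Vw come only from the pairs (w, U) and (z, V).
      X = U₁ * z₁
      Y = V₁ * w₁
      N = normω (element X Y)
      s = + g * + f

      w₁∣w : w₁ ∣ w
      w₁∣w = divides (+ g) w≡
      U₁∣U : U₁ ∣ U
      U₁∣U = divides (+ g) U≡
      z₁∣z : z₁ ∣ z
      z₁∣z = divides (+ f) z≡
      V₁∣V : V₁ ∣ V
      V₁∣V = divides (+ f) V≡
      g∣w : + g ∣ w
      g∣w = divides w₁ (trans w≡ (ℤₚ.*-comm (+ g) w₁))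
      g∣U : + g ∣ U
      g∣U = divides U₁ (trans U≡ (ℤₚ.*-comm (+ g) U₁))
      f∣z : + f ∣ z
      f∣z = divides z₁ (trans z≡ (ℤₚ.*-comm (+ f) z₁))

      3∤X : ¬ (+ 3 ∣ X)
      3∤X = PrimeMod.∤-* prime-3 (λ d → 3∤U (∣-trans d U₁∣U)) (λ d → 3∤z (∣-trans d z₁∣z))

      X⟂Y : X ⟂ Y
      X⟂Y ℓ lr d e = [ (λ d₁ → [ (λ e₁ → U⟂V ℓ lr (∣-trans d₁ U₁∣U) (∣-trans e₁ V₁∣V)) , (λ e₂ → w₁⟂U₁ ℓ lr e₂ d₁) ]′ V₁w₁)
        , (λ d₂ → [ z₁⟂V₁ ℓ lr d₂ , (λ e₂ → z⟂w ℓ lr (∣-trans d₂ z₁∣z) (∣-trans e₂ w₁∣w)) ]′ V₁w₁) ]′ (PrimeMod.euclid lr U₁ z₁ d)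
        where
        V₁w₁ = PrimeMod.euclid lr V₁ w₁ e

      𝐒 = reciprocity (element X Y) (element-primary X Y 3∤X)
      open SymbolCharacter 𝐒

      -- N(E) = U²n + 27w²K divided by g², which U², w² and the norm of E share.
      f²N≡ : + f * + f * N ≡ U₁ * U₁ * n + + 27 * (w₁ * w₁ * K)
      f²N≡ = trans (cong (+ f * + f *_) (norm-element X Y)) (trans (l₁ (+ f) U₁ z₁ V₁ w₁)
        (trans (cong₂ (λ z V → U₁ * U₁ * (z * z) + + 27 * (w₁ * w₁ * (V * V))) (sym z≡) (sym V≡))
          (trans (l₂ (+ g) U₁ z w₁ V D) (cong₂ (λ n K → U₁ * U₁ * n + + 27 * (w₁ * w₁ * K))
            (trans (cong (λ w → z * z + + 27 * (D * (w * w))) (sym w≡)) (sym n≡)) (trans (cong (λ U → V * V - U * U * D) (sym U≡)) (sym K≡))))))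
        where
        l₁ : ∀ f U z V w → f * f * (U * z * (U * z) + + 27 * (V * w * (V * w))) ≡ U * U * (f * z * (f * z)) + + 27 * (w * w * (f * V * (f * V)))
        l₁ = ℤSolver.solve-∀
        l₂ : ∀ g U z w V D → U * U * (z * z) + + 27 * (w * w * (V * V)) ≡ U * U * (z * z + + 27 * (D * (g * w * (g * w)))) + + 27 * (w * w * (V * V - g * U * (g * U) * D))
        l₂ = ℤSolver.solve-∀

      -- Multiplied by Γ², the relation modulo N reads Pn ≡ Q(3m)³; the 27 has gone into the cube.
      P = U₁ * U₁ * (Γ * Γ)
      Q = - (w₁ * w₁ * Δ)

      N∣ : N ∣ P * n - Q * (+ 3 * m * (+ 3 * m * (+ 3 * m)))
      N∣ = divides (Γ * Γ * (+ f * + f)) (sym (trans (ℤₚ.*-assoc (Γ * Γ) (+ f * + f) N) (trans (cong (Γ * Γ *_) f²N≡)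
        (trans (l₁ U₁ n w₁ K Γ) (trans (cong (λ k → U₁ * U₁ * (Γ * Γ) * n + + 27 * (w₁ * w₁ * k)) KΓ²≡) (l₂ U₁ n w₁ Δ m Γ))))))
        where
        l₁ : ∀ U n w K Γ → Γ * Γ * (U * U * n + + 27 * (w * w * K)) ≡ U * U * (Γ * Γ) * n + + 27 * (w * w * (K * (Γ * Γ)))
        l₁ = ℤSolver.solve-∀
        l₂ : ∀ U n w Δ m Γ → U * U * (Γ * Γ) * n + + 27 * (w * w * (Δ * (m * (m * m)))) ≡ U * U * (Γ * Γ) * n - - (w * w * Δ) * (+ 3 * m * (+ 3 * m * (+ 3 * m)))
        l₂ = ℤSolver.solve-∀

      ∣N⇒ : ∀ {ℓ} → + ℓ ∣ N → + ℓ ∣ U₁ * U₁ * n + + 27 * (w₁ * w₁ * K)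
      ∣N⇒ {ℓ} d = subst (+ ℓ ∣_) f²N≡ (∣n⇒∣m*n (+ f * + f) d)

      3⟂N : + 3 ⟂ N
      3⟂N = prime⟂ prime-3 (primary⇒3∤norm (element X Y) (element-primary X Y 3∤X))

      ∣27w₁²K : ∀ {ℓ} → Prime ℓ → + ℓ ∣ N → + ℓ ∣ + 27 * (w₁ * w₁ * K) → + ℓ ∣ w₁ ⊎ + ℓ ∣ K
      ∣27w₁²K {ℓ} lr dN d = [ (λ e → ⊥-elim (3⟂N ℓ lr (PrimeMod.∣-^ lr (+ 3) 3 e) dN)) , (λ e → [ (λ e₁ → inj₁ (∣square lr w₁ e₁)) , inj₂ ]′ (PrimeMod.euclid lr (w₁ * w₁) K e)) ]′
        (PrimeMod.euclid lr (+ 27) (w₁ * w₁ * K) d)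

      ∣U₁²n : ∀ {ℓ} → Prime ℓ → + ℓ ∣ U₁ * U₁ * n → + ℓ ∣ U₁ ⊎ + ℓ ∣ n
      ∣U₁²n lr d = [ (λ e → inj₁ (∣square lr U₁ e)) , inj₂ ]′ (PrimeMod.euclid lr (U₁ * U₁) n d)

      swap-+ : ∀ {ℓ a b} → + ℓ ∣ a + b → + ℓ ∣ b → + ℓ ∣ a
      swap-+ {ℓ} {a} {b} d e = ∣-sum (ℤₚ.+-comm a b) d e

      n⟂N : n ⟂ N
      n⟂N ℓ lr d e = [ (λ f → n⟂w ℓ lr d (∣-trans f w₁∣w)) , n⟂K ℓ lr d ]′ (∣27w₁²K lr e (∣-sum refl (∣N⇒ e) (∣n⇒∣m*n (U₁ * U₁) d)))

      U₁⟂N : U₁ ⟂ N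
      U₁⟂N ℓ lr d e = [ (λ f → w₁⟂U₁ ℓ lr f d) , U∤K ℓ lr (∣-trans d U₁∣U) ]′ (∣27w₁²K lr e (∣-sum refl (∣N⇒ e) (∣m⇒∣m*n n (∣m⇒∣m*n U₁ d))))

      K⟂N : K ⟂ N
      K⟂N ℓ lr d e = [ (λ f → U∤K ℓ lr (∣-trans f U₁∣U) d) , (λ f → n⟂K ℓ lr f d) ]′ (∣U₁²n lr (swap-+ (∣N⇒ e) (∣n⇒∣m*n (+ 27) (∣n⇒∣m*n (w₁ * w₁) d))))

      w₁⟂N : w₁ ⟂ N
      w₁⟂N ℓ lr d e = [ w₁⟂U₁ ℓ lr d , (λ f → n⟂w ℓ lr f (∣-trans d w₁∣w)) ]′ (∣U₁²n lr (swap-+ (∣N⇒ e) (∣n⇒∣m*n (+ 27) (∣m⇒∣m*n K (∣m⇒∣m*n w₁ d)))))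

      Γ⟂N : Γ ⟂ N
      Γ⟂N ℓ lr d = K⟂N ℓ lr (Γ∣K ℓ lr d)

      -- A prime of D cannot divide f, which divides z, because z ⟂ D. So it survives the passage
      -- from V to V₁.
      z₁∤V₁-part : ∀ {q} → Prime q → + q ∣ V → + q ∣ D → + q ∣ V₁
      z₁∤V₁-part {q} qr dV dD = [ (λ e → ⊥-elim (z⟂D q qr (∣-trans e f∣z) dD)) , (λ e → e) ]′ (PrimeMod.euclid qr (+ f) V₁ (subst (+ q ∣_) V≡ dV))

      Δ⟂N : Δ ⟂ N
      Δ⟂N ℓ lr d e = [ (λ d₁ → U⟂V ℓ lr (∣-trans d₁ U₁∣U) (Δ∣V ℓ lr d)) , (λ d₂ → z⟂D ℓ lr (∣-trans d₂ z₁∣z) (Δ∣D ℓ lr d)) ]′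
        (PrimeMod.euclid lr U₁ z₁ (∣square lr X (swap-+ (subst (+ ℓ ∣_) (norm-element X Y) e) (∣n⇒∣m*n (+ 27) (∣m⇒∣m*n Y (∣m⇒∣m*n w₁ (z₁∤V₁-part lr (Δ∣V ℓ lr d) (Δ∣D ℓ lr d))))))))

      m⟂N : m ⟂ N
      m⟂N ℓ lr d = [ K⟂N ℓ lr , (λ e → Γ⟂N ℓ lr (∣square lr Γ e)) ]′ (PrimeMod.euclid lr K (Γ * Γ) (subst (+ ℓ ∣_) (sym KΓ²≡) (∣n⇒∣m*n Δ (∣m⇒∣m*n (m * m) d))))

      3m⟂N : + 3 * m ⟂ N
      3m⟂N = ⟂-*ˡ 3⟂N m⟂N

      P⟂N : P ⟂ N
      P⟂N = ⟂-*ˡ (⟂-*ˡ U₁⟂N U₁⟂N) (⟂-*ˡ Γ⟂N Γ⟂N)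

      Q⟂N : Q ⟂ N
      Q⟂N ℓ lr d = ⟂-*ˡ (⟂-*ˡ w₁⟂N w₁⟂N) Δ⟂N ℓ lr (subst (+ ℓ ∣_) (ℤₚ.neg-involutive _) (∣m⇒∣-m d))

      *≢0 : ∀ {a b} → a ≢ + 0 → b ≢ + 0 → a * b ≢ + 0
      *≢0 {a} a≢0 b≢0 e = [ a≢0 , b≢0 ]′ (ℤₚ.i*j≡0⇒i≡0∨j≡0 a e)

      U₁≢0 : U₁ ≢ + 0
      U₁≢0 e = 3∤U (divides (+ 0) (trans U≡ (trans (cong (+ g *_) e) (ℤₚ.*-zeroʳ (+ g)))))

      w₁≢0 : w₁ ≢ + 0
      w₁≢0 e = w≢0 (trans w≡ (trans (cong (+ g *_) e) (ℤₚ.*-zeroʳ (+ g))))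

      P≢0 : P ≢ + 0
      P≢0 = *≢0 (*≢0 U₁≢0 U₁≢0) (*≢0 Γ≢0 Γ≢0)

      Q≢0 : Q ≢ + 0
      Q≢0 e = *≢0 (*≢0 w₁≢0 w₁≢0) Δ≢0 (ℤₚ.neg-injective {j = + 0} e)

      primes : ∀ q → Prime q → + q ∣ P * Q → + q ∣ + 2 * (X * Y)
      primes q qr d = [ (λ e → [ (λ e₁ → ∣n⇒∣m*n (+ 2) (∣m⇒∣m*n Y (∣m⇒∣m*n z₁ (∣square qr U₁ e₁)))) , (λ e₂ → fromΓ (∣square qr Γ e₂)) ]′ (PrimeMod.euclid qr (U₁ * U₁) (Γ * Γ) e))
        , (λ e → [ (λ e₁ → fromY (∣n⇒∣m*n V₁ (∣square qr w₁ e₁))) , (λ e₂ → fromY (∣m⇒∣m*n w₁ (z₁∤V₁-part qr (Δ∣V q qr e₂) (Δ∣D q qr e₂)))) ]′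
            (PrimeMod.euclid qr (w₁ * w₁) Δ (subst (+ q ∣_) (ℤₚ.neg-involutive (w₁ * w₁ * Δ)) (∣m⇒∣-m e)))) ]′ (PrimeMod.euclid qr P Q d)
        where
        fromY : + q ∣ Y → + q ∣ + 2 * (X * Y)
        fromY e = ∣n⇒∣m*n (+ 2) (∣n⇒∣m*n X e)
        fromΓ : + q ∣ Γ → + q ∣ + 2 * (X * Y)
        fromΓ dΓ = [ ∣m⇒∣m*n (X * Y) , (λ e → [ fromV , fromw ]′ (PrimeMod.euclid qr V w e)) ]′ (PrimeMod.euclid qr (+ 2) (V * w) (Γ∣2Vw q qr dΓ))
          where
          dK = Γ∣K q qr dΓ
          fromw : + q ∣ w → + q ∣ + 2 * (X * Y)
          fromw e = [ (λ e₁ → ⊥-elim (U∤K q qr (∣-trans e₁ g∣U) dK)) , (λ e₂ → fromY (∣n⇒∣m*n V₁ e₂)) ]′ (PrimeMod.euclid qr (+ g) w₁ (subst (+ q ∣_) w≡ e))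
          fromV : + q ∣ V → + q ∣ + 2 * (X * Y)
          fromV e = fromY (∣m⇒∣m*n w₁ (z₁∤V₁-part qr e ([ (λ e₁ → ⊥-elim (U∤K q qr (∣square qr U e₁) dK)) , (λ e₂ → e₂) ]′
            (PrimeMod.euclid qr (U * U) D (subst (+ q ∣_) (trans (cong (λ K → V * V - K) K≡) (l (V * V) (U * U * D))) (∣m∣n⇒∣m-n (∣m⇒∣m*n V e) dK))))))
            where
            l : ∀ a b → a - (a - b) ≡ b
            l = ℤSolver.solve-∀

      element≡s : element (U * z) (V * w) ≡ fromℤ s ⊠ element X Y
      element≡s = trans (cong₂ element (trans (cong₂ _*_ U≡ z≡) (l₁ (+ g) U₁ (+ f) z₁)) (trans (cong₂ _*_ V≡ w≡) (l₂ (+ g) V₁ (+ f) w₁)))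
        (trans (cong₂ _+ω_ω (l₃ s X Y) (l₄ s Y)) (sym (fromℤ-⊠ s (element X Y))))
        where
        l₁ : ∀ g U f z → g * U * (f * z) ≡ g * f * (U * z)
        l₁ = ℤSolver.solve-∀
        l₂ : ∀ g V f w → f * V * (g * w) ≡ g * f * (V * w)
        l₂ = ℤSolver.solve-∀
        l₃ : ∀ s X Y → s * X + + 3 * (s * Y) ≡ s * (X + + 3 * Y)
        l₃ = ℤSolver.solve-∀
        l₄ : ∀ s Y → + 6 * (s * Y) ≡ s * (+ 6 * Y)
        l₄ = ℤSolver.solve-∀

      symbol≡∏ : ∀ {ps} (prs : All Prime ps) → All (IsPrimeFactor (+ product qs)) ps → symbol prs (element (U * z) (V * w)) ≡ ∏ (λ q → M (+ q)) ps
      symbol≡∏ [] [] = refl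
      symbol≡∏ (_∷_ {q} qr qrs) ((_ , d) ∷ ds) = cong₂ _∙_ (trans (cong (Residue.res qr (classify q)) element≡s)
          (trans (Residue.res-scale qr q∤3 (classify q) s (element X Y) q∤s q∤N) (sym (M-res qr (classify q) q∤3 q∤N)))) (symbol≡∏ qrs ds)
        where
        q∣n : + q ∣ n
        q∣n = subst (+ q ∣_) (sym n≡qs) d
        q∤3 : ¬ (+ q ∣ + 3)
        q∤3 = n⟂3 q qr q∣n
        q∤N : ¬ (+ q ∣ N)
        q∤N = n⟂N q qr q∣n
        q∤s : ¬ (+ q ∣ s)
        q∤s = PrimeMod.∤-* qr (λ e → n⟂w q qr q∣n (∣-trans e g∣w)) (λ e → n⟂z q qr q∣n (∣-trans e f∣z))

distinctPrimes∣ : ∀ {ps n} → Unique ps → All Prime ps → All (ℕ∣._∣ n) ps → product ps ℕ∣.∣ n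
distinctPrimes∣ {[]} _ _ _ = ℕ∣.1∣ _
distinctPrimes∣ {p ∷ ps} {n} (p∉ ∷ unique) (pr ∷ prs) (ℕ∣.divides m n≡ ∷ ds) = subst (p ℕ.* product ps ℕ∣.∣_) (trans (ℕₚ.*-comm p m) (sym n≡))
  (ℕ∣.*-monoʳ-∣ p (distinctPrimes∣ unique prs (tail p∉ prs ds)))
  where
  tail : ∀ {qs} → All (p ≢_) qs → All Prime qs → All (ℕ∣._∣ n) qs → All (ℕ∣._∣ m) qs
  tail [] [] [] = []
  tail {q ∷ qs} (p≢q ∷ p∉) (qr ∷ qrs) (d ∷ ds) = [ (λ e → e) , (λ e → ⊥-elim (p≢q (sym (prime∣prime qr pr (∣ᵤ⇒∣ e))))) ]′ (euclidsLemma m p qr (subst (q ℕ∣.∣_) n≡ d)) ∷ tail p∉ qrs ds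

squarefree∣ : ∀ e → e ≢ 0 → SquareFree e → ∀ n → (∀ q → Prime q → q ℕ∣.∣ e → q ℕ∣.∣ n) → e ℕ∣.∣ n
squarefree∣ e e≢0 sf n primes = subst (ℕ∣._∣ n) (sym e≡) (distinctPrimes∣ (unique (factors F) e≡ (factorsPrime F) ℕ∣.∣-refl) (factorsPrime F)
  (All.map (λ {q} (qr , d) → primes q qr (subst (q ℕ∣.∣_) (sym e≡) (∣⇒∣ᵤ d))) (primeFactors refl (factorsPrime F))))
  where
  open PrimeFactorisation
  F = factorise e {{ℕ.≢-nonZero e≢0}}
  e≡ = isFactorisation F
  unique : ∀ ps {c} → c ≡ product ps → All Prime ps → c ℕ∣.∣ e → Unique ps
  unique [] _ _ _ = []
  unique (p ∷ ps) {c} c≡ (pr ∷ prs) c∣e = All.tabulate (λ {q} q∈ p≡q → sf p pr (ℕ∣.∣-trans (ℕ∣.*-monoʳ-∣ p (subst (ℕ∣._∣ product ps) (sym p≡q) (∈⇒∣product q∈))) (subst (ℕ∣._∣ e) c≡ c∣e)))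
    ∷ unique ps refl prs (ℕ∣.∣-trans (ℕ∣.divides p refl) (subst (ℕ∣._∣ e) c≡ c∣e))

*-cancelˡ-prime : ∀ {q} → Prime q → ∀ {a b} → + q * a ≡ + q * b → a ≡ b
*-cancelˡ-prime {q} qr {a} {b} e = ℤₚ.*-cancelˡ-≡ (+ q) a b {{prime⇒nonZero qr}} e

-- Compare q-adic valuations: v(K) = 3v(m) - 2v(γ) with v(γ) ∈ {1, 2}.
cubefree⇒∣ : ∀ {q} → Prime q → ∀ K γ m → K * (γ * γ) ≡ m * (m * m) → ¬ (+ q * (+ q * + q) ∣ γ) → + q ∣ γ → + q ∣ K
cubefree⇒∣ {q} qr K γ m e q³∤γ (divides γ₁ γ≡) = Relation.Nullary.Decidable.decidable-stable (+ q ∣? K) λ q∤K →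
    byM q∤K (∣cube qr m (subst (+ q ∣_) e (∣n⇒∣m*n K (∣m⇒∣m*n γ (divides γ₁ γ≡)))))
  where
  Q = + q
  l₁ : ∀ K γ Q → Q * (Q * (K * (γ * γ))) ≡ K * (γ * Q * (γ * Q))
  l₁ = ℤSolver.solve-∀
  l₂ : ∀ m Q → m * Q * (m * Q * (m * Q)) ≡ Q * (Q * (Q * (m * (m * m))))
  l₂ = ℤSolver.solve-∀
  l₃ : ∀ γ Q → γ * Q * Q * Q ≡ γ * (Q * (Q * Q))
  l₃ = ℤSolver.solve-∀
  ∣γ : ∀ {γ} → ¬ (Q ∣ K) → Q ∣ K * (γ * γ) → Q ∣ γ
  ∣γ {γ} q∤K d = [ (λ f → ⊥-elim (q∤K f)) , ∣square qr γ ]′ (PrimeMod.euclid qr K (γ * γ) d)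
  byM : ¬ (Q ∣ K) → Q ∣ m → ⊥
  byM q∤K (divides m₁ m≡) = byγ₁ (∣γ q∤K (divides (m₁ * (m₁ * m₁)) (trans e₁ (ℤₚ.*-comm Q _))))
    where
    e₁ : K * (γ₁ * γ₁) ≡ Q * (m₁ * (m₁ * m₁))
    e₁ = *-cancelˡ-prime qr (*-cancelˡ-prime qr (trans (l₁ K γ₁ Q) (trans (sym (cong (λ γ → K * (γ * γ)) γ≡)) (trans e (trans (cong (λ m → m * (m * m)) m≡) (l₂ m₁ Q))))))
    byγ₁ : Q ∣ γ₁ → ⊥
    byγ₁ (divides γ₂ γ₁≡) = byM₁ (∣cube qr m₁ (divides (K * (γ₂ * γ₂)) (sym (trans (ℤₚ.*-comm _ Q) e₂))))
      where
      e₂ : Q * (K * (γ₂ * γ₂)) ≡ m₁ * (m₁ * m₁)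
      e₂ = *-cancelˡ-prime qr (trans (l₁ K γ₂ Q) (trans (sym (cong (λ γ → K * (γ * γ)) γ₁≡)) e₁))
      byM₁ : Q ∣ m₁ → ⊥
      byM₁ (divides m₂ m₁≡) = q³∤γ (cubed (∣γ q∤K (divides (Q * (m₂ * (m₂ * m₂))) e₃)))
        where
        e₃ : K * (γ₂ * γ₂) ≡ Q * (m₂ * (m₂ * m₂)) * Q
        e₃ = *-cancelˡ-prime qr (trans e₂ (trans (cong (λ m → m * (m * m)) m₁≡) (trans (l₂ m₂ Q) (cong (Q *_) (ℤₚ.*-comm Q _)))))
        cubed : Q ∣ γ₂ → Q * (Q * Q) ∣ γ
        cubed (divides γ₃ γ₂≡) = divides γ₃ (trans γ≡ (trans (cong (_* Q) (trans γ₁≡ (cong (_* Q) γ₂≡))) (l₃ γ₃ Q)))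

symbol-cong : ∀ {qs α β} (qrs : All Prime qs) → All (λ q → ∀ (qr : Prime q) → Residue.res qr (classify q) α ≡ Residue.res qr (classify q) β) qs → symbol qrs α ≡ symbol qrs β
symbol-cong [] [] = refl
symbol-cong (qr ∷ qrs) (e ∷ es) = cong₂ _∙_ (e qr) (symbol-cong qrs es)

form-identity : ∀ D z w n U V → n ≡ z * z + + 27 * (D * (w * w)) → form (U * z) (V * w) ≡ U * U * n + + 27 * (w * w * (V * V - U * U * D))
form-identity D z w n U V n≡ = trans (l D z w U V) (cong (λ n → U * U * n + + 27 * (w * w * (V * V - U * U * D))) (sym n≡))
  where
  l : ∀ D z w U V → U * z * (U * z) + + 27 * (V * w * (V * w)) ≡ U * U * (z * z + + 27 * (D * (w * w))) + + 27 * (w * w * (V * V - U * U * D))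
  l = ℤSolver.solve-∀

element-∤ : ∀ D z w n U V {q} → Prime q → n ≡ z * z + + 27 * (D * (w * w)) → n ⟂ + 3 → n ⟂ w → n ⟂ V * V - U * U * D → + q ∣ n → ¬ (+ q ∣ normω (element (U * z) (V * w)))
element-∤ D z w n U V {q} qr n≡ n⟂3 n⟂w n⟂K q∣n d = PrimeMod.∤-* qr (λ e → n⟂3 q qr q∣n (PrimeMod.∣-^ qr (+ 3) 3 e))
  (PrimeMod.∤-* qr (λ e → n⟂w q qr q∣n (∣square qr w e)) (n⟂K q qr q∣n))
  (∣-sum {x = form (U * z) (V * w)} (form-identity D z w n U V n≡) (subst (+ q ∣_) (norm-element (U * z) (V * w)) d) (∣n⇒∣m*n (U * U) q∣n))

-- The hypothesis `∣w` is what the factor C of w provides: C is the product of the primes to which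
-- it refers.
module Reduction
  (D : ℕ) (D-squarefree : SquareFree D) (A B z w n m : ℤ)
  (n≡ : n ≡ z * z + + 27 * (+ D * (w * w)))
  (cube : A * A - B * B * + D ≡ m * (m * m)) (N≢0 : A * A - B * B * + D ≢ + 0)
  (cubefree : ∀ q → Prime q → + q * (+ q * + q) ∣ A → ¬ (+ q * (+ q * + q) ∣ B))
  (∣w : ∀ q → Prime q → ¬ (+ q ∣ + 2) → + q ∣ A → + q ∣ B → ¬ (+ q ∣ + D) → + q ∣ w)
  (w≢0 : w ≢ + 0) (n⟂3 : n ⟂ + 3) (n⟂w : n ⟂ w) (n⟂D : n ⟂ + D) (n⟂N : n ⟂ A * A - B * B * + D)
  {qs : List ℕ} (qrs : All Prime qs) (n≡qs : n ≡ + product qs)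
  where

  private
    E = element (B * z) (A * w)

    primeFactorsOfn : All (λ q → + q ∣ n) qs
    primeFactorsOfn = All.map (λ {q} (_ , d) → subst (+ q ∣_) (sym n≡qs) d) (primeFactors refl qrs)

  symbol≡𝟙 : symbol qrs E ≡ 𝟙
  symbol≡𝟙 = reduced (gcd-reduce′ A B λ A≡0 B≡0 → N≢0 (trans (cong₂ (λ A B → A * A - B * B * + D) A≡0 B≡0) (l (+ D))))
    where
    l : ∀ D → + 0 * + 0 - + 0 * + 0 * D ≡ + 0
    l = ℤSolver.solve-∀
    reduced : (∃ λ g → ∃ λ A₀ → ∃ λ B₀ → A ≡ + g * A₀ × B ≡ + g * B₀ × A₀ ⟂ B₀) → symbol qrs E ≡ 𝟙
    reduced (g , A₀ , B₀ , A≡ , B≡ , A₀⟂B₀) = byB₀ (+ 3 ∣? B₀)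
      where
      G = + g
      N = A * A - B * B * + D
      N₀ = A₀ * A₀ - B₀ * B₀ * + D

      N≡ : N ≡ N₀ * (G * G)
      N≡ = trans (cong₂ (λ A B → A * A - B * B * + D) A≡ B≡) (l₁ G A₀ B₀ (+ D))
        where
        l₁ : ∀ G A B D → G * A * (G * A) - G * B * (G * B) * D ≡ (A * A - B * B * D) * (G * G)
        l₁ = ℤSolver.solve-∀

      N₀G²≡m³ : N₀ * (G * G) ≡ m * (m * m)
      N₀G²≡m³ = trans (sym N≡) cube

      G≢0 : G ≢ + 0
      G≢0 e = N≢0 (trans N≡ (trans (cong (λ G → N₀ * (G * G)) e) (ℤₚ.*-zeroʳ N₀)))

      g∣A : ∀ {q} → q ∣ G → q ∣ A
      g∣A {q} d = subst (q ∣_) (sym A≡) (∣m⇒∣m*n A₀ d)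

      g∣B : ∀ {q} → q ∣ G → q ∣ B
      g∣B {q} d = subst (q ∣_) (sym B≡) (∣m⇒∣m*n B₀ d)

      g-cubefree : ∀ q → Prime q → ¬ (+ q * (+ q * + q) ∣ G)
      g-cubefree q qr d = cubefree q qr (g∣A d) (g∣B d)

      n⟂N₀ : n ⟂ N₀
      n⟂N₀ = ⟂-factorʳ (divides (G * G) (trans N≡ (ℤₚ.*-comm N₀ (G * G)))) n⟂N

      n⟂G : n ⟂ G
      n⟂G = ⟂-factorʳ (divides (N₀ * G) (trans N≡ (sym (ℤₚ.*-assoc N₀ G G)))) n⟂N

      q∣A₀² : ∀ {q} → q ∣ N₀ → q ∣ + D → q ∣ A₀ * A₀
      q∣A₀² {q} d e = subst (q ∣_) (l₂ (A₀ * A₀) (B₀ * B₀ * + D)) (∣m∣n⇒∣m+n d (∣n⇒∣m*n (B₀ * B₀) e))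
        where
        l₂ : ∀ a b → a - b + b ≡ a
        l₂ = ℤSolver.solve-∀

      unswapped : ¬ (+ 3 ∣ B₀) → symbol qrs E ≡ 𝟙
      unswapped 3∤B₀ = trans (symbol-cong qrs (All.map (λ {q} d qr → same q qr d) primeFactorsOfn))
        (SymbolVanishing.symbol≡𝟙 (+ D) z w n B₀ A₀ N₀ G (+ 1) m n≡ refl (trans N₀G²≡m³ (sym (ℤₚ.*-identityˡ (m * (m * m))))) w≢0 G≢0 (λ ())
          (⟂-sym A₀⟂B₀) 3∤B₀ n⟂3 n⟂w n⟂D n⟂N₀ G∣N₀ G∣2A₀w (λ q qr d → ⊥-elim (PrimeMod.p∤1 qr d)) (λ q qr d → ⊥-elim (PrimeMod.p∤1 qr d)) qrs n≡qs)
        where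
        G∣N₀ : ∀ q → Prime q → + q ∣ G → + q ∣ N₀
        G∣N₀ q qr d = cubefree⇒∣ qr N₀ G m N₀G²≡m³ (g-cubefree q qr) d
        -- Besides q = 2 there are two cases: a q dividing D divides A₀, since it divides N₀ = A₀² -
        -- B₀²D; any other q divides w by the choice of C.
        G∣2A₀w : ∀ q → Prime q → + q ∣ G → + q ∣ + 2 * (A₀ * w)
        G∣2A₀w q qr d with + q ∣? + 2 | + q ∣? + D
        ... | yes q∣2 | _ = ∣m⇒∣m*n (A₀ * w) q∣2
        ... | no _ | yes q∣D = ∣n⇒∣m*n (+ 2) (∣m⇒∣m*n w (∣square qr A₀ (q∣A₀² (G∣N₀ q qr d) q∣D)))
        ... | no q∤2 | no q∤D = ∣n⇒∣m*n (+ 2) (∣n⇒∣m*n A₀ (∣w q qr q∤2 (g∣A d) (g∣B d) q∤D))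
        E≡ : E ≡ fromℤ G ⊠ element (B₀ * z) (A₀ * w)
        E≡ = trans (cong₂ (λ A B → element (B * z) (A * w)) A≡ B≡) (trans (cong₂ _+ω_ω (l₁ G A₀ B₀ z w) (l₂ G A₀ w)) (sym (fromℤ-⊠ G _)))
          where
          l₁ : ∀ G A B z w → G * B * z + + 3 * (G * A * w) ≡ G * (B * z + + 3 * (A * w))
          l₁ = ℤSolver.solve-∀
          l₂ : ∀ G A w → + 6 * (G * A * w) ≡ G * (+ 6 * (A * w))
          l₂ = ℤSolver.solve-∀
        same : ∀ q → (qr : Prime q) → + q ∣ n → Residue.res qr (classify q) E ≡ Residue.res qr (classify q) (element (B₀ * z) (A₀ * w))
        same q qr d = trans (cong (Residue.res qr (classify q)) E≡) (Residue.res-scale qr (n⟂3 q qr d) (classify q) G _ (n⟂G q qr d)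
          (element-∤ (+ D) z w n B₀ A₀ qr n≡ n⟂3 n⟂w n⟂N₀ d))

      -- Multiplying A + B√D by √D exchanges A and BD, which makes the element primary when 3 divides B.
      swapped : + 3 ∣ B₀ → (∃ λ e → ∃ λ A₁ → ∃ λ D₁ → A₀ ≡ + e * A₁ × + D ≡ + e * D₁ × A₁ ⟂ D₁) → symbol qrs E ≡ 𝟙
      swapped 3∣B₀ (e , A₁ , D₁ , A₀≡ , D≡ , A₁⟂D₁) = conclude
          (∣ᵤ⇒∣ {e′} {G} (e∣ g λ q qr d → ∣⇒∣ᵤ {+ q} {G} (proj₁ (e-primes q qr (∣ᵤ⇒∣ d)))))
          (∣ᵤ⇒∣ {e′} {m} (e∣ ℤ.∣ m ∣ λ q qr d → ∣⇒∣ᵤ {+ q} {m} (proj₂ (e-primes q qr (∣ᵤ⇒∣ d)))))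
        where
        e′ = + e
        -- √D(A₀ + B₀√D) = e(B₀D₁ + A₁√D), where N₀ = eN₁ and B₀D₁ + A₁√D has norm -D₁N₁.
        N₁ = e′ * (A₁ * A₁) - B₀ * B₀ * D₁

        A₁∣A₀ : A₁ ∣ A₀
        A₁∣A₀ = divides e′ A₀≡
        e∣A₀ : e′ ∣ A₀
        e∣A₀ = divides A₁ (trans A₀≡ (ℤₚ.*-comm e′ A₁))
        e∣D : e′ ∣ + D
        e∣D = divides D₁ (trans D≡ (ℤₚ.*-comm e′ D₁))
        D₁∣D : D₁ ∣ + D
        D₁∣D = divides e′ D≡

        3∤A₀ : ¬ (+ 3 ∣ A₀)
        3∤A₀ d = A₀⟂B₀ 3 prime-3 d 3∣B₀

        e≢0 : e ≢ 0
        e≢0 f = 3∤A₀ (divides (+ 0) (trans A₀≡ (cong (λ e → + e * A₁) f)))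

        N₀≡ : N₀ ≡ e′ * N₁
        N₀≡ = trans (cong₂ (λ A D → A * A - B₀ * B₀ * D) A₀≡ D≡) (l₁ e′ A₁ B₀ D₁)
          where
          l₁ : ∀ e A B D → e * A * (e * A) - B * B * (e * D) ≡ e * (e * (A * A) - B * B * D)
          l₁ = ℤSolver.solve-∀

        square∣⇒ : ∀ q {x} → + q * + q ∣ + x → q ℕ.* q ℕ∣.∣ x
        square∣⇒ q {x} d = ∣⇒∣ᵤ {+ (q ℕ.* q)} {+ x} (subst (_∣ + x) (sym (ℤₚ.pos-* q q)) d)

        e⟂D₁ : e′ ⟂ D₁
        e⟂D₁ q qr (divides k f) (divides l f′) = D-squarefree q qr (square∣⇒ q (divides (k * l) (trans D≡ (trans (cong₂ _*_ f f′) (l₁ k l (+ q))))))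
          where
          l₁ : ∀ k l q → k * q * (l * q) ≡ k * l * (q * q)
          l₁ = ℤSolver.solve-∀

        e-squarefree : SquareFree e
        e-squarefree q qr d = D-squarefree q qr (ℕ∣.∣-trans d (∣⇒∣ᵤ {e′} {+ D} e∣D))

        e∣ : ∀ k → (∀ q → Prime q → q ℕ∣.∣ e → q ℕ∣.∣ k) → e ℕ∣.∣ k
        e∣ = squarefree∣ e e≢0 e-squarefree

        e⟂N₁ : e′ ⟂ N₁
        e⟂N₁ q qr d f = PrimeMod.∤-* qr (λ h → A₀⟂B₀ q qr (∣-trans d e∣A₀) (∣square qr B₀ h)) (e⟂D₁ q qr d)
          (subst (+ q ∣_) (l₁ (e′ * (A₁ * A₁)) (B₀ * B₀ * D₁)) (∣m∣n⇒∣m-n (∣m⇒∣m*n (A₁ * A₁) d) f))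
          where
          l₁ : ∀ a b → a - (a - b) ≡ b
          l₁ = ℤSolver.solve-∀

        eN₁G²≡m³ : e′ * N₁ * (G * G) ≡ m * (m * m)
        eN₁G²≡m³ = trans (cong (_* (G * G)) (sym N₀≡)) N₀G²≡m³

        -- In eN₁G² = m³ the prime q divides e once and N₁ not at all. It divides m, hence q³
        -- divides the left side, and so q divides G.
        e-primes : ∀ q → Prime q → + q ∣ e′ → + q ∣ G × + q ∣ m
        e-primes q qr d@(divides k f) = q∣G q∣m , q∣m
          where
          q∣m : + q ∣ m
          q∣m = ∣cube qr m (subst (+ q ∣_) eN₁G²≡m³ (∣m⇒∣m*n (G * G) (∣m⇒∣m*n N₁ d)))
          q∤k : ¬ (+ q ∣ k)
          q∤k (divides j h) = e-squarefree q qr (square∣⇒ q (divides j (trans f (trans (cong (_* + q) h) (ℤₚ.*-assoc j (+ q) (+ q))))))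
          q∣G : + q ∣ m → + q ∣ G
          q∣G (divides m₁ h) = [ (λ i → [ (λ j → ⊥-elim (q∤k j)) , (λ j → ⊥-elim (e⟂N₁ q qr d j)) ]′ (PrimeMod.euclid qr k N₁ i)) , ∣square qr G ]′
            (PrimeMod.euclid qr (k * N₁) (G * G) (divides (+ q * (m₁ * (m₁ * m₁))) (*-cancelˡ-prime qr (trans (l₁ k N₁ G (+ q)) (trans (cong (λ e → e * N₁ * (G * G)) (sym f))
              (trans eN₁G²≡m³ (trans (cong (λ m → m * (m * m)) h) (l₂ m₁ (+ q)))))))))
            where
            l₁ : ∀ k N G q → q * (k * N * (G * G)) ≡ k * q * N * (G * G)
            l₁ = ℤSolver.solve-∀
            l₂ : ∀ m q → m * q * (m * q * (m * q)) ≡ q * (q * (m * (m * m)) * q)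
            l₂ = ℤSolver.solve-∀

        -- With e dividing both G and m, the equation eN₁G² = m³ loses the factor e³ and becomes
        -- N₁G₁² = m₁³.
        conclude : e′ ∣ G → e′ ∣ m → symbol qrs E ≡ 𝟙
        conclude (divides G₁ G≡) (divides m₁ m≡) = trans (symbol-cong qrs (All.map (λ {q} d qr → same q qr d) primeFactorsOfn))
          (SymbolVanishing.symbol≡𝟙 (+ D) z w n A₁ (B₀ * D₁) K G₁ (- D₁) m₁ n≡ K≡ KG₁²≡ w≢0 G₁≢0 D₁≢0
            A₁⟂B₀D₁ (λ d → 3∤A₀ (∣-trans d A₁∣A₀)) n⟂3 n⟂w n⟂D n⟂K G₁∣K G₁∣2Vw
            (λ q qr d → ∣n⇒∣m*n B₀ (unneg d)) (λ q qr d → ∣-trans (unneg d) D₁∣D) qrs n≡qs)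
          where
          K = - (D₁ * N₁)
          E* = element (A₁ * z) (B₀ * D₁ * w)
          unneg : ∀ {q x} → q ∣ - x → q ∣ x
          unneg {q} {x} d = subst (q ∣_) (ℤₚ.neg-involutive x) (∣m⇒∣-m d)
          K≡ : K ≡ B₀ * D₁ * (B₀ * D₁) - A₁ * A₁ * + D
          K≡ = trans (l₁ e′ A₁ B₀ D₁) (cong (λ D → B₀ * D₁ * (B₀ * D₁) - A₁ * A₁ * D) (sym D≡))
            where
            l₁ : ∀ e A B D → - (D * (e * (A * A) - B * B * D)) ≡ B * D * (B * D) - A * A * (e * D)
            l₁ = ℤSolver.solve-∀
          N₁G₁²≡m₁³ : N₁ * (G₁ * G₁) ≡ m₁ * (m₁ * m₁)
          N₁G₁²≡m₁³ = cancel (cancel (cancel (trans (l₁ N₁ G₁ e′) (trans (cong (λ G → e′ * N₁ * (G * G)) (sym G≡)) (trans eN₁G²≡m³ (trans (cong (λ m → m * (m * m)) m≡) (l₂ m₁ e′)))))))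
            where
            l₁ : ∀ N G e → e * (e * (e * (N * (G * G)))) ≡ e * N * (G * e * (G * e))
            l₁ = ℤSolver.solve-∀
            l₂ : ∀ m e → m * e * (m * e * (m * e)) ≡ e * (e * (e * (m * (m * m))))
            l₂ = ℤSolver.solve-∀
            cancel : ∀ {a b} → e′ * a ≡ e′ * b → a ≡ b
            cancel {a} {b} = ℤₚ.*-cancelˡ-≡ e′ a b {{ℕ.≢-nonZero e≢0}}
          KG₁²≡ : K * (G₁ * G₁) ≡ - D₁ * (m₁ * (m₁ * m₁))
          KG₁²≡ = trans (l₁ D₁ N₁ (G₁ * G₁)) (cong (- D₁ *_) N₁G₁²≡m₁³)
            where
            l₁ : ∀ D N g → - (D * N) * g ≡ - D * (N * g)
            l₁ = ℤSolver.solve-∀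
          G₁≢0 : G₁ ≢ + 0
          G₁≢0 h = G≢0 (trans G≡ (trans (cong (_* e′) h) (ℤₚ.*-zeroˡ e′)))
          D₁≢0 : - D₁ ≢ + 0
          D₁≢0 h = D-squarefree 3 prime-3 (square∣⇒ 3 (divides (+ 0) (trans D≡ (trans (cong (e′ *_) (ℤₚ.neg-injective {j = + 0} h)) (ℤₚ.*-zeroʳ e′)))))
          A₁⟂B₀D₁ : A₁ ⟂ B₀ * D₁
          A₁⟂B₀D₁ q qr d f = [ A₀⟂B₀ q qr (∣-trans d A₁∣A₀) , A₁⟂D₁ q qr d ]′ (PrimeMod.euclid qr B₀ D₁ f)
          n⟂K : n ⟂ K
          n⟂K q qr d f = [ (λ h → n⟂D q qr d (∣-trans h D₁∣D)) , (λ h → n⟂N₀ q qr d (subst (+ q ∣_) (sym N₀≡) (∣n⇒∣m*n e′ h))) ]′ (PrimeMod.euclid qr D₁ N₁ (unneg f))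
          G₁∣G : ∀ {q} → q ∣ G₁ → q ∣ G
          G₁∣G {q} d = subst (q ∣_) (sym G≡) (∣m⇒∣m*n e′ d)
          G₁∣N₁ : ∀ q → Prime q → + q ∣ G₁ → + q ∣ N₁
          G₁∣N₁ q qr d = cubefree⇒∣ qr N₁ G₁ m₁ N₁G₁²≡m₁³ (λ h → g-cubefree q qr (G₁∣G h)) d
          G₁∣K : ∀ q → Prime q → + q ∣ G₁ → + q ∣ K
          G₁∣K q qr d = ∣m⇒∣-m (∣n⇒∣m*n D₁ (G₁∣N₁ q qr d))
          G₁∣2Vw : ∀ q → Prime q → + q ∣ G₁ → + q ∣ + 2 * (B₀ * D₁ * w)
          G₁∣2Vw q qr d with + q ∣? + 2 | + q ∣? + D
          ... | yes q∣2 | _ = ∣m⇒∣m*n (B₀ * D₁ * w) q∣2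
          ... | no _ | yes q∣D = ∣n⇒∣m*n (+ 2) (∣m⇒∣m*n w (∣n⇒∣m*n B₀ ([ (λ h → ⊥-elim (e⟂N₁ q qr h (G₁∣N₁ q qr d))) , (λ h → h) ]′ (PrimeMod.euclid qr e′ D₁ (subst (+ q ∣_) D≡ q∣D)))))
          ... | no q∤2 | no q∤D = ∣n⇒∣m*n (+ 2) (∣n⇒∣m*n (B₀ * D₁) (∣w q qr q∤2 (g∣A (G₁∣G d)) (g∣B (G₁∣G d)) q∤D))

          -- Replacing z² by -27Dw² modulo q turns zE into t√-3 times E*, so multiplying u by √D
          -- changes E only by factors that the symbol does not see.
          same : ∀ q → (qr : Prime q) → + q ∣ n → Residue.res qr (classify q) E ≡ Residue.res qr (classify q) E*
          same q qr d = begin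
            res C E                         ≡⟨ res-scale q∤3 C z E q∤z q∤E ⟨
            res C (fromℤ z ⊠ E)             ≡⟨ res-cong q∤3 C q∤zE zE≋ ⟩
            res C (fromℤ t ⊠ (√-3 ⊠ E*))    ≡⟨ res-scale q∤3 C t (√-3 ⊠ E*) q∤t q∤√-3E* ⟩
            res C (√-3 ⊠ E*)                ≡⟨ res-√-3* q∤3 C E* q∤E* ⟩
            res C E*                        ∎
            where
            open ≡-Reasoning
            open Residue qr
            open Zωmodℤ (+ q) using (_≋_; components)
            open PrimeMod qr using (∤-*; ∣-^)
            module Z = ℤmod (+ q)
            C = classify q
            t = + 3 * (w * (G * e′))
            q∤3 = n⟂3 q qr d
            q∤z : ¬ (+ q ∣ z)
            q∤z h = ∤-* (λ i → q∤3 (∣-^ (+ 3) 3 i)) (∤-* (n⟂D q qr d) (λ i → n⟂w q qr d (∣square qr w i))) (∣-sum n≡ d (∣m⇒∣m*n z h))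
            q∤t : ¬ (+ q ∣ t)
            q∤t = ∤-* q∤3 (∤-* (n⟂w q qr d) (∤-* (n⟂G q qr d) (λ h → n⟂D q qr d (∣-trans h e∣D))))
            q∤E : ¬ (+ q ∣ normω E)
            q∤E = element-∤ (+ D) z w n B A qr n≡ n⟂3 n⟂w n⟂N d
            q∤E* : ¬ (+ q ∣ normω E*)
            q∤E* = element-∤ (+ D) z w n A₁ (B₀ * D₁) qr n≡ n⟂3 n⟂w (subst (n ⟂_) K≡ n⟂K) d
            q∤zE : ¬ (+ q ∣ normω (fromℤ z ⊠ E))
            q∤zE h = ∤-* (∤norm-fromℤ q∤3 q∤z) q∤E (subst (+ q ∣_) (normω-* (fromℤ z) E) h)
            q∤√-3E* : ¬ (+ q ∣ normω (√-3 ⊠ E*))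
            q∤√-3E* h = ∤-* q∤3 q∤E* (subst (+ q ∣_) (normω-* √-3 E*) h)
            zE≋ : fromℤ z ⊠ E ≋ fromℤ t ⊠ (√-3 ⊠ E*)
            zE≋ = components
              (Z.∣⇒≋ (subst (+ q ∣_) (trans (l₁ z w G B₀ A₁ e′ D₁) (sym (cong₂ _-_ (cong re lhs) (cong re rhs)))) (∣m⇒∣m*n (G * B₀) q∣n′)))
              (Z.∣⇒≋ (subst (+ q ∣_) (trans (l₂ z w G B₀ A₁ e′ D₁) (sym (cong₂ _-_ (cong im lhs) (cong im rhs)))) (∣m⇒∣m*n (+ 0) q∣n′)))
              where
              q∣n′ : + q ∣ z * z + + 27 * (e′ * D₁ * (w * w))
              q∣n′ = subst (λ D → + q ∣ z * z + + 27 * (D * (w * w))) D≡ (subst (+ q ∣_) n≡ d)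
              lhs : fromℤ z ⊠ E ≡ (z * (G * B₀ * z + + 3 * (G * (e′ * A₁) * w))) +ω (z * (+ 6 * (G * (e′ * A₁) * w))) ω
              lhs = trans (cong₂ (λ A B → fromℤ z ⊠ element (B * z) (A * w)) (trans A≡ (cong (G *_) A₀≡)) B≡) (fromℤ-⊠ z _)
              x′ = A₁ * z + + 3 * (B₀ * D₁ * w)
              y′ = + 6 * (B₀ * D₁ * w)
              rhs : fromℤ t ⊠ (√-3 ⊠ E*) ≡ (t * (+ 1 * x′ - + 2 * y′)) +ω (t * (+ 1 * y′ + + 2 * x′ - + 2 * y′)) ω
              rhs = trans (cong (fromℤ t ⊠_) (cong₂ _+ω_ω (re-⊠ √-3 E*) (im-⊠ √-3 E*))) (fromℤ-⊠ t _)
              l₁ : ∀ z w G B A e D → (z * z + + 27 * (e * D * (w * w))) * (G * B) ≡ z * (G * B * z + + 3 * (G * (e * A) * w)) - + 3 * (w * (G * e)) * (+ 1 * (A * z + + 3 * (B * D * w)) - + 2 * (+ 6 * (B * D * w)))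
              l₁ = ℤSolver.solve-∀
              l₂ : ∀ z w G B A e D → (z * z + + 27 * (e * D * (w * w))) * + 0 ≡ z * (+ 6 * (G * (e * A) * w)) - + 3 * (w * (G * e)) * (+ 1 * (+ 6 * (B * D * w)) + + 2 * (A * z + + 3 * (B * D * w)) - + 2 * (+ 6 * (B * D * w)))
              l₂ = ℤSolver.solve-∀

      byB₀ : Dec (+ 3 ∣ B₀) → symbol qrs E ≡ 𝟙
      byB₀ (no 3∤B₀) = unswapped 3∤B₀
      byB₀ (yes 3∣B₀) = swapped 3∣B₀ (gcd-reduce A₀ (+ D) λ e → A₀⟂B₀ 3 prime-3 (divides (+ 0) e) 3∣B₀)

-- The theorem

module CofactorProperties (D : ℕ) (A B : ℤ) where
  private
    g = gcdAB A B
    ps = cPrimes D A B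
    candidates = upTo (suc g)

    factors-spec : All (CPrimeFactor D g) ps
    factors-spec = Allₚ.all-filter (cPrimeFactor? D g) candidates

    factors-prime : All Prime ps
    factors-prime = All.map proj₁ factors-spec

  Cof∣gcd : Cof D A B ℕ∣.∣ g
  Cof∣gcd = distinctPrimes∣ (Uniqueₚ.filter⁺ (cPrimeFactor? D g) (Uniqueₚ.upTo⁺ (suc g))) factors-prime (All.map (λ pf → proj₁ (proj₂ (proj₂ pf))) factors-spec)

  Cof∣A : + Cof D A B ∣ A
  Cof∣A = ∣ᵤ⇒∣ (ℕ∣.∣-trans Cof∣gcd (ℕG.gcd[m,n]∣m ℤ.∣ A ∣ ℤ.∣ B ∣))

  Cof∣B : + Cof D A B ∣ B
  Cof∣B = ∣ᵤ⇒∣ (ℕ∣.∣-trans Cof∣gcd (ℕG.gcd[m,n]∣n ℤ.∣ A ∣ ℤ.∣ B ∣))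

  ∣Cof : g ≢ 0 → ∀ q → Prime q → ¬ (+ q ∣ + 2) → + q ∣ A → + q ∣ B → ¬ (+ q ∣ + D) → + q ∣ + Cof D A B
  ∣Cof g≢0 q qr q∤2 q∣A q∣B q∤D = ∣ᵤ⇒∣ (∈⇒∣product (∈-filter⁺ (cPrimeFactor? D g) (∈-upTo⁺ (ℕ.s≤s (ℕ∣.∣⇒≤ {{ℕ.≢-nonZero g≢0}} q∣g)))
    (qr , 2∤q , q∣g , λ d → q∤D (∣ᵤ⇒∣ d))))
    where
    q∣g : q ℕ∣.∣ g
    q∣g = ℕG.gcd-greatest (∣⇒∣ᵤ q∣A) (∣⇒∣ᵤ q∣B)
    2∤q : ¬ (2 ℕ∣.∣ q)
    2∤q d = [ (λ ()) , (λ 2≡q → q∤2 (subst (λ n → + n ∣ + 2) 2≡q ∣-refl)) ]′ (prime⇒irreducible qr d)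

BoverC* : ∀ D A B → B ≡ BoverC D A B * + Cof D A B
BoverC* D A B = trans (ℤ/.a≡a%ℕn+[a/ℕn]*n B c {{nz}}) (trans (cong (λ r → + r + BoverC D A B * + c) r≡0) (ℤₚ.+-identityˡ _))
  where
  c = Cof D A B
  nz = Cof-nonZero {D} {A} {B}
  r = ℤ/._%ℕ_ B c {{nz}}
  c∣r : c ℕ∣.∣ r
  c∣r = ∣⇒∣ᵤ {+ c} {+ r} (∣-sum (trans (ℤ/.a≡a%ℕn+[a/ℕn]*n B c {{nz}}) (ℤₚ.+-comm (+ r) (BoverC D A B * + c))) (CofactorProperties.Cof∣B D A B) (divides (BoverC D A B) refl))
  r≡0 : r ≡ 0
  r≡0 = zero-below r c∣r (ℤ/.n%ℕd<d B c {{nz}})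
    where
    zero-below : ∀ r → c ℕ∣.∣ r → r ℕ.< c → r ≡ 0
    zero-below zero _ _ = refl
    zero-below (suc r) d r<c = ⊥-elim (ℕₚ.<⇒≱ r<c (ℕ∣.∣⇒≤ d))

gcd≡1⇒⟂ : ∀ i j → gcd i j ≡ + 1 → i ⟂ j
gcd≡1⇒⟂ i j e ℓ lr d f = PrimeMod.p∤1 lr (subst (+ ℓ ∣_) e (∣ᵤ⇒∣ {+ ℓ} {gcd i j} (ℕG.gcd-greatest (∣⇒∣ᵤ d) (∣⇒∣ᵤ f))))

positive : ∀ a → + 0 ℤ.< a → ∃ λ n → a ≡ + n × n ≢ 0
positive (+ n) (ℤ.+<+ 0<n) = n , refl , λ n≡0 → ℕₚ.<-irrefl (sym n≡0) 0<n

p≡1+3k : ∀ p → p ℕ.% 3 ≡ 1 → p ≡ 1 ℕ.+ 3 ℕ.* ((p ℕ.∸ 1) ℕ./ 3)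
p≡1+3k p e = trans p≡ (cong (λ k → 1 ℕ.+ 3 ℕ.* k) (sym (trans (cong (λ n → (n ℕ.∸ 1) ℕ./ 3) (trans p≡ (cong suc (ℕₚ.*-comm 3 (p ℕ./ 3))))) (ℕ/.m*n/n≡m (p ℕ./ 3) 3))))
  where
  p≡ : p ≡ 1 ℕ.+ 3 ℕ.* (p ℕ./ 3)
  p≡ = trans (ℕ/.m≡m%n+[m/n]*n p 3) (cong₂ ℕ._+_ e (ℕₚ.*-comm (p ℕ./ 3) 3))

-- Modulo p the relation z² + 27Dw² ≡ 0 makes (1+2h)z/(9w) a square root of D, where h is a primitive cube root of unity,
-- and -√-3(Bz + 3Aw√-3) reduces to 9w(A ∓ B√D) at the two places above p.
module PowerCriterion {p : ℕ} (pr : Prime p) (p∤3 : ¬ (+ p ∣ + 3)) (k : ℕ) (p≡ : p ≡ 1 ℕ.+ 3 ℕ.* k)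
  (D A B z w m : ℤ) (p∣ : + p ∣ z * z + + 27 * (D * (w * w))) (p∤w : ¬ (+ p ∣ w))
  (cube : A * A - B * B * D ≡ m * (m * m)) (p∤N : ¬ (+ p ∣ A * A - B * B * D))
  (p∤E : ¬ (+ p ∣ normω (element (B * z) (A * w))))
  where
  open ℤmod (+ p)
  open PrimeMod pr
  private
    E = element (B * z) (A * w)
    rootData = PowerSums.cubeRoot pr k p≡
    h = proj₁ rootData
    root = proj₂ rootData
    μ = + 1 + + 2 * h

    p∤9w : ¬ (+ p ∣ + 9 * w)
    p∤9w = ∤-* (λ d → p∤3 (∣-^ (+ 3) 2 d)) p∤w

    sqrt-spec : + 9 * w * (+ 9 * w) * D ≋ μ * z * (μ * z)
    sqrt-spec = ∣⇒≋ (subst (+ p ∣_) (l z w D h) (∣m∣n⇒∣m-n (∣n⇒∣m*n (+ 3) p∣) (∣n⇒∣m*n (+ 4 * (z * z)) root)))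
      where
      l : ∀ z w D h → + 3 * (z * z + + 27 * (D * (w * w))) - + 4 * (z * z) * (h * h + h + + 1) ≡ + 9 * w * (+ 9 * w) * D - (+ 1 + + 2 * h) * z * ((+ 1 + + 2 * h) * z)
      l = ℤSolver.solve-∀

  squareRoot : ∃ λ s → + p ∣ s * s - D
  squareRoot = s , ≋⇒∣ (begin
    μ * z * v * (μ * z * v)               ≡⟨ l₁ (μ * z) v ⟩
    μ * z * (μ * z) * (v * v)             ≈⟨ *-congʳ-≋ (v * v) sqrt-spec ⟨
    + 9 * w * (+ 9 * w) * D * (v * v)     ≡⟨ l₂ (+ 9 * w) D v ⟩
    + 9 * w * v * (+ 9 * w * v) * D       ≈⟨ *-congʳ-≋ D (*-cong-≋ 9wv≋1 9wv≋1) ⟩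
    + 1 * + 1 * D                         ≡⟨ l₃ D ⟩
    D                                     ∎)
    where
    open Relation.Binary.Reasoning.Setoid (CommutativeRing.setoid quotientRing)
    v = proj₁ (inverse (+ 9 * w) p∤9w)
    9wv≋1 = proj₂ (inverse (+ 9 * w) p∤9w)
    s = μ * z * v
    l₁ : ∀ x v → x * v * (x * v) ≡ x * x * (v * v)
    l₁ = ℤSolver.solve-∀
    l₂ : ∀ w D v → w * w * D * (v * v) ≡ w * v * (w * v) * D
    l₂ = ℤSolver.solve-∀
    l₃ : ∀ D → + 1 * + 1 * D ≡ D
    l₃ = ℤSolver.solve-∀

  private
    open Evaluation pr h root p∤3

    p∤m : ¬ (+ p ∣ m)
    p∤m d = p∤N (subst (+ p ∣_) (sym cube) (∣m⇒∣m*n (m * m) d))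

    cube-power : ∀ x → ¬ (+ p ∣ x) → (x * (x * x)) ^ k ≋ + 1
    cube-power x p∤x = ≋-trans (≡⇒≋ (trans (cong (_^ k) (l x)) (ℤₚ.^-*-assoc x 3 k))) (fermat-unit x p∤x p≡)
      where
      l : ∀ x → x * (x * x) ≡ x * (x * (x * + 1))
      l = ℤSolver.solve-∀

  module _ (s : ℤ) (s²≋D : s * s ≋ D) where
    private
      -- The product of the two powers is N(u)^k = m^(p-1).
      conjugate : (A + B * s) ^ k * (A + B * - s) ^ k ≋ + 1
      conjugate = begin
        (A + B * s) ^ k * (A + B * - s) ^ k   ≡⟨ ^-distribʳ-* (A + B * s) (A + B * - s) k ⟨
        ((A + B * s) * (A + B * - s)) ^ k     ≈⟨ ^-cong-≋ k norm≋ ⟩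
        (m * (m * m)) ^ k                     ≈⟨ cube-power m p∤m ⟩
        + 1                                   ∎
        where
        open Relation.Binary.Reasoning.Setoid (CommutativeRing.setoid quotientRing)
        l : ∀ A B s → (A + B * s) * (A + B * - s) ≡ A * A - B * B * (s * s)
        l = ℤSolver.solve-∀
        norm≋ : (A + B * s) * (A + B * - s) ≋ m * (m * m)
        norm≋ = ≋-trans (≡⇒≋ (l A B s)) (≋-trans (+-cong-≋ (≋-refl {A * A}) (-‿cong-≋ (*-congˡ-≋ (B * B) s²≋D))) (≡⇒≋ cube))

      F = fromℤ (- + 1) ⊠ (√-3 ⊠ E)

      F-components : F ≡ (+ 9 * (A * w) - B * z) +ω (- (+ 2 * (B * z))) ω
      F-components = trans (fromℤ-⊠ (- + 1) (√-3 ⊠ E)) (cong₂ _+ω_ω (trans (cong (- + 1 *_) (re-⊠ √-3 E)) (l₁ (A * w) (B * z))) (trans (cong (- + 1 *_) (im-⊠ √-3 E)) (l₂ (A * w) (B * z))))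
        where
        l₁ : ∀ a b → - + 1 * (+ 1 * (b + + 3 * a) - + 2 * (+ 6 * a)) ≡ + 9 * a - b
        l₁ = ℤSolver.solve-∀
        l₂ : ∀ a b → - + 1 * (+ 1 * (+ 6 * a) + + 2 * (b + + 3 * a) - + 2 * (+ 6 * a)) ≡ - (+ 2 * b)
        l₂ = ℤSolver.solve-∀

      res-F : ∀ C → Residue.res pr C F ≡ Residue.res pr C E
      res-F C = trans (Residue.res-scale pr p∤3 C (- + 1) (√-3 ⊠ E) (λ d → p∤1 (∣m⇒∣-m d)) (λ d → ∤-* p∤3 p∤E (subst (+ p ∣_) (normω-* √-3 E) d)))
        (Residue.res-√-3* pr p∤3 C E p∤E)

      p∤F : ¬ (+ p ∣ normω F)
      p∤F d = ∤-* (λ e → p∤1 e) (∤-* p∤3 p∤E) (subst (+ p ∣_) (trans (normω-* (fromℤ (- + 1)) (√-3 ⊠ E)) (cong (+ 1 *_) (normω-* √-3 E))) d)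

      ev-F : ev F ≡ + 9 * (A * w) - B * (μ * z)
      ev-F = trans (cong ev F-components) (l (A * w) B z h)
        where
        l : ∀ a B z h → + 9 * a - B * z + h * - (+ 2 * (B * z)) ≡ + 9 * a - B * ((+ 1 + + 2 * h) * z)
        l = ℤSolver.solve-∀

      ev-F̄ : ev (conj F) ≡ + 9 * (A * w) + B * (μ * z)
      ev-F̄ = trans (cong₂ (λ a b → a + h * b) (trans (re-conj F) (cong (λ α → re α - im α) F-components)) (trans (im-conj F) (cong (λ α → - im α) F-components))) (l (A * w) B z h)
        where
        l : ∀ a B z h → + 9 * a - B * z - - (+ 2 * (B * z)) + h * - - (+ 2 * (B * z)) ≡ + 9 * a + B * ((+ 1 + + 2 * h) * z)
        l = ℤSolver.solve-∀

      -- F and conj(F) reduce to WX and WY, where W = 9w. In (F conj(F)²)^k = (W³ · XY · Y)^k the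
      -- cube W³ and the norm XY both contribute 1.
      ev-power : ∀ σ → + 9 * w * σ ≋ μ * z → (A + B * - σ) ^ k * (A + B * σ) ^ k ≋ + 1 → ∀ C → ev ⟦ Residue.res pr C F ⟧ ≋ (A + B * σ) ^ k
      ev-power σ 9wσ≋ norm≋1 (divisible n e) = ⊥-elim (Residue.¬divisible pr p∤3 n e)
      ev-power σ 9wσ≋ norm≋1 (inert n e) = ⊥-elim (inert≢split n k (trans (sym e) p≡))
      ev-power σ 9wσ≋ norm≋1 C@(split n e) = begin
        ev ⟦ Residue.res pr C F ⟧                 ≈⟨ ev-cong (Residue.res-spec pr p∤3 C F p∤F) ⟨
        ev ((F ⊠ (conj F ⊠ conj F)) ↑ n)         ≡⟨ cong (λ j → ev ((F ⊠ (conj F ⊠ conj F)) ↑ j)) n≡k ⟩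
        ev ((F ⊠ (conj F ⊠ conj F)) ↑ k)         ≈⟨ ev-↑ _ k ⟩
        ev (F ⊠ (conj F ⊠ conj F)) ^ k           ≈⟨ ^-cong-≋ k (≋-trans (ev-⊠ F _) (*-cong-≋ ev-F≋ (≋-trans (ev-⊠ (conj F) (conj F)) (*-cong-≋ ev-F̄≋ ev-F̄≋)))) ⟩
        (W * X * (W * Y * (W * Y))) ^ k          ≡⟨ cong (_^ k) (l₁ W X Y) ⟩
        (W * (W * W) * (X * Y * Y)) ^ k          ≡⟨ trans (^-distribʳ-* _ _ k) (cong ((W * (W * W)) ^ k *_) (trans (^-distribʳ-* (X * Y) Y k) (cong (_* Y ^ k) (^-distribʳ-* X Y k)))) ⟩
        (W * (W * W)) ^ k * (X ^ k * Y ^ k * Y ^ k) ≈⟨ *-cong-≋ (cube-power W p∤9w) (*-congʳ-≋ (Y ^ k) norm≋1) ⟩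
        + 1 * (+ 1 * Y ^ k)                      ≡⟨ trans (ℤₚ.*-identityˡ _) (ℤₚ.*-identityˡ _) ⟩
        Y ^ k                                    ∎
        where
        open Relation.Binary.Reasoning.Setoid (CommutativeRing.setoid quotientRing)
        W = + 9 * w
        X = A + B * - σ
        Y = A + B * σ
        n≡k : n ≡ k
        n≡k = ℕₚ.*-cancelˡ-≡ n k 3 (ℕₚ.suc-injective (trans (sym e) p≡))
        l₁ : ∀ W X Y → W * X * (W * Y * (W * Y)) ≡ W * (W * W) * (X * Y * Y)
        l₁ = ℤSolver.solve-∀
        ev-F≋ : ev F ≋ W * X
        ev-F≋ = ≋-trans (≡⇒≋ ev-F) (≋-trans (+-cong-≋ (≋-refl {+ 9 * (A * w)}) (-‿cong-≋ (*-congˡ-≋ B (≋-sym 9wσ≋)))) (≡⇒≋ (l A B w σ)))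
          where
          l : ∀ A B w σ → + 9 * (A * w) - B * (+ 9 * w * σ) ≡ + 9 * w * (A + B * - σ)
          l = ℤSolver.solve-∀
        ev-F̄≋ : ev (conj F) ≋ W * Y
        ev-F̄≋ = ≋-trans (≡⇒≋ ev-F̄) (≋-trans (+-cong-≋ (≋-refl {+ 9 * (A * w)}) (*-congˡ-≋ B (≋-sym 9wσ≋))) (≡⇒≋ (l A B w σ)))
          where
          l : ∀ A B w σ → + 9 * (A * w) + B * (+ 9 * w * σ) ≡ + 9 * w * (A + B * σ)
          l = ℤSolver.solve-∀

      X^k = (A + B * s) ^ k
      X̄^k = (A + B * - s) ^ k

      -- The place fixes one square root σ of D through 9wσ ≡ (1 + 2h)z, and s is σ or -σ. The
      -- choice does not affect the criterion, since the two powers are inverse to each other.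
      signs : + 9 * w * s ≋ μ * z ⊎ + 9 * w * - s ≋ μ * z
      signs = [ (λ d → inj₁ (∣⇒≋ d)) , (λ d → inj₂ (≋-sym (∣⇒≋ (subst (+ p ∣_) (l₂ (+ 9 * w) s (μ * z)) d)))) ]′ (euclid (+ 9 * w * s - μ * z) (μ * z + + 9 * w * s)
        (subst (+ p ∣_) (l₁ (+ 9 * w) s (μ * z)) (≋⇒∣ (≋-trans (*-congˡ-≋ (+ 9 * w * (+ 9 * w)) s²≋D) sqrt-spec))))
        where
        l₁ : ∀ w s x → w * w * (s * s) - x * x ≡ (w * s - x) * (x + w * s)
        l₁ = ℤSolver.solve-∀
        l₂ : ∀ w s x → x + w * s ≡ x - w * - s
        l₂ = ℤSolver.solve-∀

      unit-cancel : ∀ {x y} → x * y ≋ + 1 → x ≋ + 1 → y ≋ + 1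
      unit-cancel {x} {y} xy≋1 x≋1 = ≋-trans (≡⇒≋ (sym (ℤₚ.*-identityˡ y))) (≋-trans (*-congʳ-≋ y (≋-sym x≋1)) xy≋1)

      ev-1 : ev ⟦ 𝟙 ⟧ ≋ + 1
      ev-1 = ≡⇒≋ (ev-fromℤ (+ 1))

    res≡𝟙⇒power≋1 : ∀ C → Residue.res pr C E ≡ 𝟙 → (A + B * s) ^ k ≋ + 1
    res≡𝟙⇒power≋1 C e = [ (λ f → power s f (≋-trans (≡⇒≋ (ℤₚ.*-comm X̄^k X^k)) conjugate))
      , (λ f → unit-cancel (≋-trans (≡⇒≋ (ℤₚ.*-comm X̄^k X^k)) conjugate) (power (- s) f (≋-trans (≡⇒≋ (cong (λ t → (A + B * t) ^ k * X̄^k) (ℤₚ.neg-involutive s))) conjugate))) ]′ signs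
      where
      power : ∀ σ → + 9 * w * σ ≋ μ * z → (A + B * - σ) ^ k * (A + B * σ) ^ k ≋ + 1 → (A + B * σ) ^ k ≋ + 1
      power σ f norm≋1 = ≋-trans (≋-sym (ev-power σ f norm≋1 C)) (≋-trans (≡⇒≋ (cong (λ x → ev ⟦ x ⟧) (trans (res-F C) e))) ev-1)

    power≋1⇒res≡𝟙 : ∀ C → (A + B * s) ^ k ≋ + 1 → Residue.res pr C E ≡ 𝟙
    power≋1⇒res≡𝟙 C e = trans (sym (res-F C)) ([ (λ f → value s f (≋-trans (≡⇒≋ (ℤₚ.*-comm X̄^k X^k)) conjugate) e)
      , (λ f → value (- s) f (≋-trans (≡⇒≋ (cong (λ t → (A + B * t) ^ k * X̄^k) (ℤₚ.neg-involutive s))) conjugate) (unit-cancel conjugate e)) ]′ signs)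
      where
      value : ∀ σ → + 9 * w * σ ≋ μ * z → (A + B * - σ) ^ k * (A + B * σ) ^ k ≋ + 1 → (A + B * σ) ^ k ≋ + 1 → Residue.res pr C F ≡ 𝟙
      value σ f norm≋1 e = ev⟦⟧-injective (≋-trans (ev-power σ f norm≋1 C) (≋-trans e (≋-sym ev-1)))

theorem1p1 :
    (D : ℕ) → 1 ℕ.< D → SquareFree D →
    (A B : ℤ) → InS D A B →
    (a b c : ℤ) → + 0 ℤ.< a →
    gcd (gcd a (+ 2 ℤ.* b)) c ≡ + 1 →
    b ℤ.* b ℤ.- a ℤ.* c ≡ - (+ 27 ℤ.* + Cof D A B ℤ.* + Cof D A B ℤ.* + D) →
    (p : ℕ) → Prime p → p ℕ.% 3 ≡ 1 →
    (x y : ℤ) →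
    + p ≡ a ℤ.* x ℤ.* x ℤ.+ + 2 ℤ.* b ℤ.* x ℤ.* y ℤ.+ c ℤ.* y ℤ.* y →
    gcd (a ℤ.* + p) (+ 3 ℤ.* normQD D A B ℤ.* + D ℤ.* y) ≡ + 1 →
    (∃ λ s → s ℤ.* s ≡ℤ + D [mod + p ])
    × (∀ s → s ℤ.* s ≡ℤ + D [mod + p ] →
        ((A ℤ.+ B ℤ.* s) ℤ.^ ((p ℕ.∸ 1) ℕ./ 3) ≡ℤ + 1 [mod + p ])
        ⇔ CubicSym
            ((+ 9 ℤ.* A ℤ.- BoverC D A B ℤ.* b)
              +ω (- (+ 2 ℤ.* BoverC D A B ℤ.* b)) ω)
            (fromℤ a) 1ω)
theorem1p1 D _ D-squarefree A B ((m , N≡) , _ , gcd-cubefree) a b c 0<a _ discriminant p pr p%3≡1 x y p≡ coprime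
  = (proj₁ squareRoot , ∣⇒∣ᵤ (proj₂ squareRoot))
  , λ s s²≡D → let s²≋D = Zₚ.∣⇒≋ (∣ᵤ⇒∣ s²≡D) in mk⇔
      (λ power → fromSymbol (trans symbol-τ≡symbol-E (symbolFromRes (power≋1⇒res≡𝟙 s s²≋D (classify p) (Zₚ.∣⇒≋ (∣ᵤ⇒∣ power))))))
      (λ cubic → ∣⇒∣ᵤ (Zₚ.≋⇒∣ (res≡𝟙⇒power≋1 s s²≋D (classify p) (resFromSymbol (trans (sym symbol-τ≡symbol-E) (toSymbol cubic))))))
  where
  module Zₚ = ℤmod (+ p)
  C = + Cof D A B
  B′ = BoverC D A B
  N = A * A - B * B * + D
  z = a * x + b * y
  w = C * y
  n = a * + p
  E = element (B * z) (A * w)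
  τ = (+ 9 * A - B′ * b) +ω (- (+ 2 * B′ * b)) ω

  a′ : ∃ λ n → a ≡ + n × n ≢ 0
  a′ = positive a 0<a

  F : PrimeFactorisation (proj₁ a′)
  F = factorise (proj₁ a′) {{ℕ.≢-nonZero (proj₂ (proj₂ a′))}}

  qs = PrimeFactorisation.factors F
  qrs = PrimeFactorisation.factorsPrime F

  a≡ : a ≡ + product qs
  a≡ = trans (proj₁ (proj₂ a′)) (cong +_ (PrimeFactorisation.isFactorisation F))

  n≡qs : n ≡ + product (p ∷ qs)
  n≡qs = trans (ℤₚ.*-comm a (+ p)) (trans (cong (+ p *_) a≡) (sym (ℤₚ.pos-* p (product qs))))

  -- a times the form is (ax + by)² - (b² - ac)y².
  n≡ : n ≡ z * z + + 27 * (+ D * (w * w))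
  n≡ = trans (cong (a *_) p≡) (trans (l₁ a b c x y) (trans (cong (λ d → z * z - d * (y * y)) discriminant) (l₂ z C (+ D) y)))
    where
    l₁ : ∀ a b c x y → a * (a * x * x + + 2 * b * x * y + c * y * y) ≡ (a * x + b * y) * (a * x + b * y) - (b * b - a * c) * (y * y)
    l₁ = ℤSolver.solve-∀
    l₂ : ∀ z C D y → z * z - - (+ 27 * C * C * D) * (y * y) ≡ z * z + + 27 * (D * (C * y * (C * y)))
    l₂ = ℤSolver.solve-∀

  n⟂ : n ⟂ + 3 * N * + D * y
  n⟂ = gcd≡1⇒⟂ n (+ 3 * N * + D * y) coprime

  n⟂y : n ⟂ y
  n⟂y = ⟂-factorʳ (∣n⇒∣m*n (+ 3 * N * + D) ∣-refl) n⟂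
  n⟂D : n ⟂ + D
  n⟂D = ⟂-factorʳ (∣m⇒∣m*n y (∣n⇒∣m*n (+ 3 * N) ∣-refl)) n⟂
  n⟂N : n ⟂ N
  n⟂N = ⟂-factorʳ (∣m⇒∣m*n y (∣m⇒∣m*n (+ D) (∣n⇒∣m*n (+ 3) ∣-refl))) n⟂
  n⟂3 : n ⟂ + 3
  n⟂3 = ⟂-factorʳ (∣m⇒∣m*n y (∣m⇒∣m*n (+ D) (∣m⇒∣m*n N ∣-refl))) n⟂

  open CofactorProperties D A B

  n⟂C : n ⟂ C
  n⟂C ℓ lr d e = n⟂N ℓ lr d (∣m∣n⇒∣m-n (∣m⇒∣m*n A (∣-trans e Cof∣A)) (∣m⇒∣m*n (+ D) (∣m⇒∣m*n B (∣-trans e Cof∣B))))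

  n⟂w : n ⟂ w
  n⟂w ℓ lr d e = [ n⟂C ℓ lr d , n⟂y ℓ lr d ]′ (PrimeMod.euclid lr C y e)

  p∣n : + p ∣ n
  p∣n = ∣n⇒∣m*n a ∣-refl

  ⟂⇒≢0 : ∀ {b} → n ⟂ b → b ≢ + 0
  ⟂⇒≢0 n⟂b e = n⟂b p pr p∣n (divides (+ 0) e)

  g≢0 : gcdAB A B ≢ 0
  g≢0 e = ⟂⇒≢0 n⟂N (cong₂ (λ A B → A * A - B * B * + D) (vanish A (ℕG.gcd[m,n]∣m ℤ.∣ A ∣ ℤ.∣ B ∣)) (vanish B (ℕG.gcd[m,n]∣n ℤ.∣ A ∣ ℤ.∣ B ∣)))
    where
    vanish : ∀ i → gcdAB A B ℕ∣.∣ ℤ.∣ i ∣ → i ≡ + 0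
    vanish i d = ℤₚ.∣i∣≡0⇒i≡0 (ℕ∣.0∣⇒≡0 (subst (ℕ∣._∣ ℤ.∣ i ∣) e d))

  cubefree : ∀ q → Prime q → + q * (+ q * + q) ∣ A → ¬ (+ q * (+ q * + q) ∣ B)
  cubefree q qr d e = gcd-cubefree q qr (subst (ℕ∣._∣ gcdAB A B) ∣q³∣≡ (ℕG.gcd-greatest (∣⇒∣ᵤ d) (∣⇒∣ᵤ e)))
    where
    ∣q³∣≡ : ℤ.∣ + q * (+ q * + q) ∣ ≡ q ℕ.^ 3
    ∣q³∣≡ = trans (ℤₚ.abs-* (+ q) (+ q * + q)) (cong (q ℕ.*_) (trans (ℤₚ.abs-* (+ q) (+ q)) (cong (q ℕ.*_) (sym (ℕₚ.*-identityʳ q)))))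

  N≡m³ : N ≡ m * (m * m)
  N≡m³ = trans N≡ (ℤₚ.*-assoc m m m)

  symbol-E : symbol (pr ∷ qrs) E ≡ 𝟙
  symbol-E = Reduction.symbol≡𝟙 D D-squarefree A B z w n m n≡ N≡m³ (⟂⇒≢0 n⟂N) cubefree
    (λ q qr q∤2 q∣A q∣B q∤D → ∣m⇒∣m*n y (∣Cof g≢0 q qr q∤2 q∣A q∣B q∤D)) (⟂⇒≢0 n⟂w) n⟂3 n⟂w n⟂D n⟂N (pr ∷ qrs) n≡qs

  symbolFromRes : Residue.res pr (classify p) E ≡ 𝟙 → symbol qrs E ≡ 𝟙
  symbolFromRes e = trans (cong (_∙ symbol qrs E) (sym e)) symbol-E

  resFromSymbol : symbol qrs E ≡ 𝟙 → Residue.res pr (classify p) E ≡ 𝟙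
  resFromSymbol e = trans (sym (∙-identityʳ _)) (trans (cong (Residue.res pr (classify p) E ∙_) (sym e)) symbol-E)

  q∤E : ∀ q → Prime q → + q ∣ n → ¬ (+ q ∣ normω E)
  q∤E q qr d = element-∤ (+ D) z w n B A qr n≡ n⟂3 n⟂w n⟂N d

  open PowerCriterion pr (n⟂3 p pr p∣n) ((p ℕ.∸ 1) ℕ./ 3) (p≡1+3k p p%3≡1) (+ D) A B z w m
    (subst (+ p ∣_) n≡ p∣n) (n⟂w p pr p∣n) N≡m³ (n⟂N p pr p∣n) (q∤E p pr p∣n)

  module AtPrime {q : ℕ} (qr : Prime q) (q∣a : + q ∣ a) where
    open Residue qr
    open Zωmodℤ (+ q) using (_≋_; components)
    open PrimeMod qr using (∤-*)
    module Z = ℤmod (+ q)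

    q∣n : + q ∣ n
    q∣n = ∣m⇒∣m*n (+ p) q∣a

    q∤3 : ¬ (+ q ∣ + 3)
    q∤3 = n⟂3 q qr q∣n

    -- Modulo q dividing a, z is by, so Bz ≡ (B/C)bw, and -√-3(Bz + 3Aw√-3) ≡ w(9A - (B/C)b√-3).
    wτ≋ : fromℤ w ⊠ τ ≋ fromℤ (- + 1) ⊠ (√-3 ⊠ E)
    wτ≋ = components
      (Z.∣⇒≋ (subst (+ q ∣_) (trans (l₁ A B′ b C x y a) (sym (cong₂ _-_ (cong re lhs) (cong re rhs)))) (∣m⇒∣m*n (B′ * C * x) q∣a)))
      (Z.∣⇒≋ (subst (+ q ∣_) (trans (l₂ A B′ b C x y a) (sym (cong₂ _-_ (cong im lhs) (cong im rhs)))) (∣m⇒∣m*n (+ 2 * (B′ * C * x)) q∣a)))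
      where
      lhs : fromℤ w ⊠ τ ≡ (C * y * (+ 9 * A - B′ * b)) +ω (C * y * - (+ 2 * B′ * b)) ω
      lhs = fromℤ-⊠ w τ
      u = B′ * C * (a * x + b * y) + + 3 * (A * (C * y))
      v = + 6 * (A * (C * y))
      rhs : fromℤ (- + 1) ⊠ (√-3 ⊠ E) ≡ (- + 1 * (+ 1 * u - + 2 * v)) +ω (- + 1 * (+ 1 * v + + 2 * u - + 2 * v)) ω
      rhs = trans (cong (λ B → fromℤ (- + 1) ⊠ (√-3 ⊠ element (B * z) (A * w))) (BoverC* D A B))
        (trans (cong (fromℤ (- + 1) ⊠_) (cong₂ _+ω_ω (re-⊠ √-3 (element (B′ * C * z) (A * w))) (im-⊠ √-3 (element (B′ * C * z) (A * w))))) (fromℤ-⊠ (- + 1) _))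
      l₁ : ∀ A B b C x y a → a * (B * C * x) ≡ C * y * (+ 9 * A - B * b) - - + 1 * (+ 1 * (B * C * (a * x + b * y) + + 3 * (A * (C * y))) - + 2 * (+ 6 * (A * (C * y))))
      l₁ = ℤSolver.solve-∀
      l₂ : ∀ A B b C x y a → a * (+ 2 * (B * C * x)) ≡ C * y * - (+ 2 * B * b) - - + 1 * (+ 1 * (+ 6 * (A * (C * y))) + + 2 * (B * C * (a * x + b * y) + + 3 * (A * (C * y))) - + 2 * (+ 6 * (A * (C * y))))
      l₂ = ℤSolver.solve-∀

    q∤√-3E : ¬ (+ q ∣ normω (√-3 ⊠ E))
    q∤√-3E d = ∤-* q∤3 (q∤E q qr q∣n) (subst (+ q ∣_) (normω-* √-3 E) d)

    q∤-1 : ¬ (+ q ∣ - + 1)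
    q∤-1 d = PrimeMod.p∤1 qr (∣m⇒∣-m d)

    q∤wτ : ¬ (+ q ∣ normω (fromℤ w ⊠ τ))
    q∤wτ d = ∤-* (∤norm-fromℤ q∤3 q∤-1) q∤√-3E (subst (+ q ∣_) (normω-* (fromℤ (- + 1)) (√-3 ⊠ E)) (Z.∣-resp-≋ (normω-cong q∤3 wτ≋) d))

    q∤τ : ¬ (+ q ∣ normω τ)
    q∤τ d = q∤wτ (subst (+ q ∣_) (sym (normω-* (fromℤ w) τ)) (∣n⇒∣m*n (normω (fromℤ w)) d))

    res-τ≡res-E : res (classify q) τ ≡ res (classify q) E
    res-τ≡res-E = begin
      res κ τ                                  ≡⟨ res-scale q∤3 κ w τ (n⟂w q qr q∣n) q∤τ ⟨
      res κ (fromℤ w ⊠ τ)                      ≡⟨ res-cong q∤3 κ q∤wτ wτ≋ ⟩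
      res κ (fromℤ (- + 1) ⊠ (√-3 ⊠ E))        ≡⟨ res-scale q∤3 κ (- + 1) (√-3 ⊠ E) q∤-1 q∤√-3E ⟩
      res κ (√-3 ⊠ E)                          ≡⟨ res-√-3* q∤3 κ E (q∤E q qr q∣n) ⟩
      res κ E                                  ∎
      where
      open ≡-Reasoning
      κ = classify q

  primesOfa : All (λ q → Prime q × + q ∣ a) qs
  primesOfa = All.map (λ {q} (qr , d) → qr , subst (+ q ∣_) (sym a≡) d) (primeFactors refl qrs)

  symbol-τ≡symbol-E : symbol qrs τ ≡ symbol qrs E
  symbol-τ≡symbol-E = symbol-cong {qs} {τ} {E} qrs (All.map (λ (_ , d) qr → AtPrime.res-τ≡res-E qr d) primesOfa)

  cubic⇔ : CubicSym τ (fromℤ (+ product qs)) 1ω ⇔ symbol qrs τ ≡ 𝟙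
  cubic⇔ = CubicSymbol.cubicSym⇔symbol τ qrs (All.map (λ (qr , d) → AtPrime.q∤3 qr d , AtPrime.q∤τ qr d) primesOfa)

  toSymbol : CubicSym τ (fromℤ a) 1ω → symbol qrs τ ≡ 𝟙
  toSymbol cubic = Equivalence.to cubic⇔ (subst (λ a → CubicSym τ (fromℤ a) 1ω) a≡ cubic)

  fromSymbol : symbol qrs τ ≡ 𝟙 → CubicSym τ (fromℤ a) 1ω
  fromSymbol e = subst (λ a → CubicSym τ (fromℤ a) 1ω) (sym a≡) (Equivalence.from cubic⇔ e)
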